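{- Let $k\ge2$. The satisfiability problem for $\mathrm{EQLTL}(\mathrm{EQCTL}^*_k)$ over $k$-refinable upward unbounded layered structures (UULSs) is in ELEMENTARY; that is, there is an algorithm deciding, for each formula of $\mathrm{EQLTL}(\mathrm{EQCTL}^*_k)$, whether it has a UULS model, running in time bounded by a tower of exponentials of fixed height in the length of the formula.
   Context: UULSs. For $i\ge0$ let $T^i=\{j_i: j\ge0\}$. A $\mathcal{P}$-labeled $k$-refinable UULS ($\mathcal{P}$ a finite set of proposition letters) has domain $\bigcup_{i\ge0}T^i$, partial projections $\downarrow_0,\dots,\downarrow_{k-1}$ with $\downarrow_i(a_0)$ undefined, and $\downarrow_i(a_b)=c_d$ iff $b>0$, $b=d+1$ and $c=a\cdot k+i$, and a set of points for each $P\in\mathcal{P}$; thus it is a complete $k$-ary infinite tree generated from the leaves $T^0$. Identification with increasing tree sequences. A UULS is identified with $(\mathbb{N},<,g)$, where $g(i)$ is the finite tree rooted at $0_i$ with, if $i>0$, the subtree rooted at its leftmost son $0_{i-1}$ deleted, nodes being labeled by subsets of $\mathcal{P}$. Thus $g(i)$ is an almost $k$-ary tree of height $i$: a complete finite tree whose root (if $i>0$) has $k-1$ sons, each the root of a complete finite $k$-ary tree. The sons of the root keep the indices $1,\dots,k-1$ they have in the UULS; the sons of other internal nodes have indices $0,\dots,k-1$. Linear logics (over $(\mathbb{N},<,V)$, $V(i)$ a set of letters). PLTL: letters, Boolean connectives, next $\bigcirc$ and until (hence $\Diamond,\Box$), with standard semantics. EQLTL: formulas $\exists Q_1\cdots\exists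 Q_n\,\varphi$ ($n\ge0$) with $\varphi$ in PLTL, where $\exists Q$ means existence of a model differing from the given one at most in the truth set of the letter $Q$. Branching logics (over almost $k$-ary finite trees). $\mathrm{CTL}^*_k$ is CTL$^*$ with directed next operators: state formulas are letters, Boolean combinations of state formulas, and $\mathbf{E}\psi$, $\mathbf{A}\psi$ for path formulas $\psi$; path formulas are state formulas and are closed under Boolean connectives, until, $\mathbf{X}$ and $\mathbf{X}_0,\dots,\mathbf{X}_{k-1}$. $\mathbf{E}$/$\mathbf{A}$ quantify over maximal (finite) descending paths starting at the current node; $\mathbf{X}\psi$ holds on a path iff the path has a second node and $\psi$ holds on the path starting there; $\mathbf{X}_i\psi$ holds iff moreover this second node is the son with index $i$ of the first. $\mathrm{EQCTL}^*_k$: formulas $\exists Q_1\cdots\exists Q_n\,\varphi$ ($n\ge0$), $\varphi$ a state formula of $\mathrm{CTL}^*_k$, $\exists Q$ meaning existence of a relabeling of the tree by the letter $Q$. A tree satisfies a formula if it holds at the root. Temporalization. A formula is monolithic if its outermost operator is not a Boolean connective (letters included). $\mathrm{EQLTL}(\mathrm{EQCTL}^*_k)$-formulas are obtained from EQLTL-formulas by substituting monolithic $\mathrm{EQCTL}^*_k$-formulas for the free letters (letters bound by quantifiers of EQLTL remain letters of the outer level, distinct from those in the substituted formulas). In $(\mathbb{N},<,g)$, the semantics is that of EQLTL with the clause: a substituted formula $\alpha$ is true at $i$ iff the tree $g(i)$ satisfies $\alpha$. A UULS is a model of a formula iff the formula is true at $0\in\mathbb{N}$. -}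

module Defs where

open import Data.Empty using (⊥)
open import Data.Fin using (Fin; zero; suc; toℕ)
open import Data.Fin.Subset using (Side; Subset; _∈_)
open import Data.List using (List; []; _∷_)
open import Data.Maybe using (Maybe; just; nothing)
open import Data.Nat using (ℕ; zero; suc; _+_; _*_; _^_; _≤_; _<_)
open import Data.Nat.Binary using (ℕᵇ; zero; 2[1+_]; 1+[2_]; fromℕ; size)
open import Data.Product using (Σ; Σ-syntax; _×_; _,_)
open import Data.Sum using (_⊎_; inj₁; inj₂)
open import Data.Vec using (Vec; []; _∷_; lookup; replicate; _[_]≔_)
open import Function using (_∘_)
open import Function.Bundles using (_⇔_)
open import Relation.Binary.PropositionalEquality using (_≡_; _≢_)
open import Relation.Nullary using (¬_)

private variable
  k m n i : ℕ
  A : Set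

data Tree (k n : ℕ) : Set where
  node : (label : Subset n) (sons : Fin k → Maybe (Tree k n)) → Tree k n

-- Add a fresh letter (number zero); S is its truth set, a node being
-- identified by the list of son indices leading to it from the root.
mutual
  relabel : (List (Fin k) → Side) → Tree k n → Tree k (suc n)
  relabel S (node l sons) =
    node (S [] ∷ l) (λ c → relabelMaybe (S ∘ (c ∷_)) (sons c))

  relabelMaybe : (List (Fin k) → Side) →
                 Maybe (Tree k n) → Maybe (Tree k (suc n))
  relabelMaybe S nothing  = nothing
  relabelMaybe S (just t) = just (relabel S t)

-- Only maximal paths: `end` requires a leaf.
data Path {k n : ℕ} : Tree k n → Set where
  end  : ∀ {l sons} → (∀ c → sons c ≡ nothing) → Path (node l sons)
  step : ∀ {l sons t} (c : Fin k) → sons c ≡ just t → Path t →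
         Path (node l sons)

mutual
  data StateFormula (k n : ℕ) : Set where
    letter : Fin n → StateFormula k n
    ¬̇_     : StateFormula k n → StateFormula k n
    _∧̇_    : StateFormula k n → StateFormula k n → StateFormula k n
    𝐄 𝐀    : PathFormula k n → StateFormula k n

  data PathFormula (k n : ℕ) : Set where
    state : StateFormula k n → PathFormula k n
    ¬̇_    : PathFormula k n → PathFormula k n
    _∧̇_   : PathFormula k n → PathFormula k n → PathFormula k n
    _U_   : PathFormula k n → PathFormula k n → PathFormula k n
    X     : PathFormula k n → PathFormula k n
    X[_]  : Fin k → PathFormula k n → PathFormula k n

-- Bound letters are de Bruijn indices: in ∃̇ φ the quantified letter is
-- number zero and the other letters are shifted by one.
data EQCTL* (k : ℕ) : ℕ → Set where
  ctl* : StateFormula k n → EQCTL* k n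
  ∃̇_   : EQCTL* k (suc n) → EQCTL* k n

data Monolithic : EQCTL* k n → Set where
  letter : (p : Fin n) → Monolithic {k} (ctl* (letter p))
  𝐄      : (ψ : PathFormula k n) → Monolithic (ctl* (𝐄 ψ))
  𝐀      : (ψ : PathFormula k n) → Monolithic (ctl* (𝐀 ψ))
  ∃̇_     : (φ : EQCTL* k (suc n)) → Monolithic (∃̇ φ)

-- The suffixes of a finite path are reached by dropping steps.
data Until (P Q : {t : Tree k n} → Path t → Set) :
           {t : Tree k n} → Path t → Set where
  now   : {t : Tree k n} {π : Path t} → Q π → Until P Q π
  later : ∀ {l : Subset n} {sons : Fin k → Maybe (Tree k n)} {t c}
          {e : sons c ≡ just t} {π : Path t} →
          P (step {l = l} {sons} c e π) → Until P Q π →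
          Until P Q (step {l = l} {sons} c e π)

infix 4 _⊨ˢ_ _⊨ᵖ_ _⊨ᵗ_

mutual
  _⊨ˢ_ : Tree k n → StateFormula k n → Set
  node l sons ⊨ˢ letter p = p ∈ l
  t           ⊨ˢ (¬̇ φ)    = ¬ (t ⊨ˢ φ)
  t           ⊨ˢ (φ ∧̇ χ)  = (t ⊨ˢ φ) × (t ⊨ˢ χ)
  t           ⊨ˢ 𝐄 ψ      = Σ[ π ∈ Path t ] (π ⊨ᵖ ψ)
  t           ⊨ˢ 𝐀 ψ      = (π : Path t) → π ⊨ᵖ ψ

  _⊨ᵖ_ : {t : Tree k n} → Path t → PathFormula k n → Set
  _⊨ᵖ_ {t = t} π (state φ)  = t ⊨ˢ φ
  π          ⊨ᵖ (¬̇ ψ)       = ¬ (π ⊨ᵖ ψ)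
  π          ⊨ᵖ (ψ ∧̇ χ)     = (π ⊨ᵖ ψ) × (π ⊨ᵖ χ)
  π          ⊨ᵖ (ψ U χ)     = Until (_⊨ᵖ ψ) (_⊨ᵖ χ) π
  end _      ⊨ᵖ X ψ         = ⊥
  step _ _ π ⊨ᵖ X ψ         = π ⊨ᵖ ψ
  end _      ⊨ᵖ X[ d ] ψ    = ⊥
  step c _ π ⊨ᵖ X[ d ] ψ    = (c ≡ d) × (π ⊨ᵖ ψ)

_⊨ᵗ_ : Tree k n → EQCTL* k n → Set
t ⊨ᵗ ctl* φ = t ⊨ˢ φ
t ⊨ᵗ (∃̇ φ)  = Σ[ S ∈ (List (Fin _) → Side) ] (relabel S t ⊨ᵗ φ)

data PLTL (A : Set) : Set where
  letter : A → PLTL A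
  ¬̇_     : PLTL A → PLTL A
  _∧̇_    : PLTL A → PLTL A → PLTL A
  ○_     : PLTL A → PLTL A
  _U_    : PLTL A → PLTL A → PLTL A

-- The logic is classical, and the existential implicit in U ranges over
-- an infinite set, so it is the classical one, ¬ ¬ Σ.
infix 4 _,_⊨_
_,_⊨_ : (ℕ → A → Set) → ℕ → PLTL A → Set
V , x ⊨ letter p = V x p
V , x ⊨ (¬̇ φ)    = ¬ (V , x ⊨ φ)
V , x ⊨ (φ ∧̇ χ)  = (V , x ⊨ φ) × (V , x ⊨ χ)
V , x ⊨ (○ φ)    = V , suc x ⊨ φ
V , x ⊨ (φ U χ)  =
  ¬ ¬ (Σ[ y ∈ ℕ ] x ≤ y × (V , y ⊨ χ) × (∀ z → x ≤ z → z < y → V , z ⊨ φ))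

-- EQLTL-formulas whose free letters are drawn from A; m is the number of
-- quantifiers in whose scope the formula stands, their letters being de
-- Bruijn indices.
data EQLTL (A : Set) : ℕ → Set where
  pltl : PLTL (Fin m ⊎ A) → EQLTL A m
  ∃̇_   : EQLTL A (suc m) → EQLTL A m

_⊕_ : (ℕ → Subset m) → (ℕ → A → Set) → ℕ → Fin m ⊎ A → Set
(B ⊕ W) x (inj₁ q) = q ∈ B x
(B ⊕ W) x (inj₂ a) = W x a

-- W interprets the free letters and B the letters of the quantifiers in
-- scope.
Holds : (ℕ → A → Set) → (ℕ → Subset m) → ℕ → EQLTL A m → Set
Holds W B x (pltl φ) = B ⊕ W , x ⊨ φ
Holds W B x (∃̇ φ)    =
  Σ[ Q ∈ (ℕ → Side) ] Holds W (λ y → Q y ∷ B y) x φ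

-- The i-th layer; pt j is the point jᵢ.
record T (i : ℕ) : Set where
  constructor pt
  field index : ℕ

-- The projections, undefined on layer 0.
↓ : Fin k → T (suc i) → T i
↓ {k = k} c (pt a) = pt (a * k + toℕ c)

-- The points, and the projections of a k-refinable UULS, are fixed, so
-- that only the labelling by the letters 𝒫 = Fin n varies.
record UULS (k n : ℕ) : Set where
  field labelling : ∀ {i} → T i → Subset n

open UULS public

subtree : UULS k n → T i → Tree k n
subtree {i = zero}  M x = node (labelling M x) (λ _ → nothing)
subtree {i = suc i} M x =
  node (labelling M x) (λ c → just (subtree M (↓ c x)))

-- The tree rooted at 0ᵢ without the subtree of its leftmost son.
treeAt : UULS k n → ℕ → Tree k n
treeAt M zero = node (labelling M {zero} (pt 0)) (λ _ → nothing)
treeAt {k} {n} M (suc i) = node (labelling M {suc i} root) sons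
  where
  root : T (suc i)
  root = pt 0

  sons : Fin k → Maybe (Tree k n)
  sons zero    = nothing
  sons (suc c) = just (subtree M (↓ (suc c) root))

MonolithicEQCTL* : ℕ → ℕ → Set
MonolithicEQCTL* k n = Σ (EQCTL* k n) Monolithic

EQLTL[EQCTL*] : ℕ → ℕ → Set
EQLTL[EQCTL*] k n = EQLTL (MonolithicEQCTL* k n) 0

infix 4 _IsModelOf_
_IsModelOf_ : UULS k n → EQLTL[EQCTL*] k n → Set
M IsModelOf φ = Holds (λ x (α , _) → treeAt M x ⊨ᵗ α) (λ _ → []) 0 φ

-- n is the size of the finite set 𝒫 of letters.
Instance : ℕ → Set
Instance k = Σ[ n ∈ ℕ ] EQLTL[EQCTL*] k n

Satisfiable : Instance k → Set
Satisfiable {k} (n , φ) = Σ[ M ∈ UULS k n ] M IsModelOf φ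

-- One symbol plus the binary digits of the subscript.
∣_∣ˡ : Fin n → ℕ
∣ p ∣ˡ = suc (size (fromℕ (toℕ p)))

mutual
  ∣_∣ˢ : StateFormula k n → ℕ
  ∣ letter p ∣ˢ = ∣ p ∣ˡ
  ∣ ¬̇ φ ∣ˢ      = suc ∣ φ ∣ˢ
  ∣ φ ∧̇ χ ∣ˢ    = suc (∣ φ ∣ˢ + ∣ χ ∣ˢ)
  ∣ 𝐄 ψ ∣ˢ      = suc ∣ ψ ∣ᵖ
  ∣ 𝐀 ψ ∣ˢ      = suc ∣ ψ ∣ᵖ

  ∣_∣ᵖ : PathFormula k n → ℕ
  ∣ state φ ∣ᵖ  = ∣ φ ∣ˢ
  ∣ ¬̇ ψ ∣ᵖ      = suc ∣ ψ ∣ᵖ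
  ∣ ψ ∧̇ χ ∣ᵖ    = suc (∣ ψ ∣ᵖ + ∣ χ ∣ᵖ)
  ∣ ψ U χ ∣ᵖ    = suc (∣ ψ ∣ᵖ + ∣ χ ∣ᵖ)
  ∣ X ψ ∣ᵖ      = suc ∣ ψ ∣ᵖ
  ∣ X[ c ] ψ ∣ᵖ = suc ∣ ψ ∣ᵖ

∣_∣ᵗ : EQCTL* k n → ℕ
∣ ctl* φ ∣ᵗ = ∣ φ ∣ˢ
∣ ∃̇ φ ∣ᵗ    = suc ∣ φ ∣ᵗ

lengthPLTL : (A → ℕ) → PLTL A → ℕ
lengthPLTL f (letter p) = f p
lengthPLTL f (¬̇ φ)      = suc (lengthPLTL f φ)
lengthPLTL f (φ ∧̇ χ)    = suc (lengthPLTL f φ + lengthPLTL f χ)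
lengthPLTL f (○ φ)      = suc (lengthPLTL f φ)
lengthPLTL f (φ U χ)    = suc (lengthPLTL f φ + lengthPLTL f χ)

lengthLetter : Fin m ⊎ MonolithicEQCTL* k n → ℕ
lengthLetter (inj₁ q)       = ∣ q ∣ˡ
lengthLetter (inj₂ (α , _)) = ∣ α ∣ᵗ

lengthEQLTL : EQLTL (MonolithicEQCTL* k n) m → ℕ
lengthEQLTL (pltl φ) = lengthPLTL lengthLetter φ
lengthEQLTL (∃̇ φ)    = suc (lengthEQLTL φ)

formulaLength : Instance k → ℕ
formulaLength (n , φ) = lengthEQLTL φ

-- The model of computation is Jones' WHILE language over binary trees,
-- with unit cost for each elementary operation.  Only constant-time
-- operations on pointers are primitive (in particular there is no test
-- for equality of trees), so that running times agree, up to a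
-- polynomial, with those of Turing machines.
infixr 5 _∙_
data D : Set where
  nil : D
  _∙_ : D → D → D

data Expr (m : ℕ) : Set where
  var   : Fin m → Expr m
  nil   : Expr m
  cons  : Expr m → Expr m → Expr m
  hd tl : Expr m → Expr m

Store : ℕ → Set
Store m = Vec D m

head tail : D → D
head nil     = nil
head (a ∙ b) = a
tail nil     = nil
tail (a ∙ b) = b

eval : Store m → Expr m → D
eval σ (var x)    = lookup σ x
eval σ nil        = nil
eval σ (cons e f) = eval σ e ∙ eval σ f
eval σ (hd e)     = head (eval σ e)
eval σ (tl e)     = tail (eval σ e)

cost : Expr m → ℕ
cost (var x)    = 1
cost nil        = 1
cost (cons e f) = suc (cost e + cost f)
cost (hd e)     = suc (cost e)
cost (tl e)     = suc (cost e)

infix  6 _≔_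
infixr 5 _⨾_
data Command (m : ℕ) : Set where
  _≔_           : Fin m → Expr m → Command m
  _⨾_           : Command m → Command m → Command m
  if_then_else_ : Expr m → Command m → Command m → Command m
  while_loop_     : Expr m → Command m → Command m

-- Exec C σ t τ: started in store σ, C halts in store τ after time t.
-- In tests, nil is false and all other values are true.
data Exec {m : ℕ} : Command m → Store m → ℕ → Store m → Set where
  assign      : ∀ {x e σ} →
                Exec (x ≔ e) σ (suc (cost e)) (σ [ x ]≔ eval σ e)
  seq         : ∀ {C C′ σ τ υ s t} → Exec C σ s τ → Exec C′ τ t υ →
                Exec (C ⨾ C′) σ (s + t) υ
  if-true     : ∀ {e C C′ σ τ t} → eval σ e ≢ nil → Exec C σ t τ →
                Exec (if e then C else C′) σ (suc (cost e + t)) τ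
  if-false    : ∀ {e C C′ σ τ t} → eval σ e ≡ nil → Exec C′ σ t τ →
                Exec (if e then C else C′) σ (suc (cost e + t)) τ
  while-true  : ∀ {e C σ τ υ s t} → eval σ e ≢ nil →
                Exec C σ s τ → Exec (while e loop C) τ t υ →
                Exec (while e loop C) σ (suc (cost e + (s + t))) υ
  while-false : ∀ {e C σ} → eval σ e ≡ nil →
                Exec (while e loop C) σ (suc (cost e)) σ

-- Variable zero holds the input at the start and the output at the end;
-- the other variables are initially nil.
record Program : Set where
  field
    extraVars : ℕ
    body      : Command (suc extraVars)

Run : Program → D → ℕ → D → Set
Run p input t output =
  Σ[ σ ∈ Store extraVars ] Exec body (input ∷ replicate _ nil) t (output ∷ σ)
  where open Program p

tower : ℕ → ℕ → ℕ
tower zero    n = n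
tower (suc h) n = 2 ^ tower h n

Elementary : {I : Set} (encode : I → D) (length : I → ℕ) (P : I → Set) → Set
Elementary {I} encode length P =
  Σ[ p ∈ Program ] Σ[ h ∈ ℕ ] ((x : I) →
    Σ[ t ∈ ℕ ] Σ[ output ∈ D ]
      Run p (encode x) t output × t ≤ tower h (length x) ×
      (output ≢ nil ⇔ P x))

unary : ℕ → D
unary zero    = nil
unary (suc a) = nil ∙ unary a

binary : ℕᵇ → D
binary zero     = nil
binary 2[1+ b ] = nil ∙ binary b
binary 1+[2 b ] = (nil ∙ nil) ∙ binary b

encodeFin : Fin n → D
encodeFin p = binary (fromℕ (toℕ p))

mutual
  encodeˢ : StateFormula k n → D
  encodeˢ (letter p) = unary 0 ∙ encodeFin p
  encodeˢ (¬̇ φ)      = unary 1 ∙ encodeˢ φ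
  encodeˢ (φ ∧̇ χ)    = unary 2 ∙ encodeˢ φ ∙ encodeˢ χ
  encodeˢ (𝐄 ψ)      = unary 3 ∙ encodeᵖ ψ
  encodeˢ (𝐀 ψ)      = unary 4 ∙ encodeᵖ ψ

  encodeᵖ : PathFormula k n → D
  encodeᵖ (state φ)  = unary 0 ∙ encodeˢ φ
  encodeᵖ (¬̇ ψ)      = unary 1 ∙ encodeᵖ ψ
  encodeᵖ (ψ ∧̇ χ)    = unary 2 ∙ encodeᵖ ψ ∙ encodeᵖ χ
  encodeᵖ (ψ U χ)    = unary 3 ∙ encodeᵖ ψ ∙ encodeᵖ χ
  encodeᵖ (X ψ)      = unary 4 ∙ encodeᵖ ψ
  encodeᵖ (X[ c ] ψ) = unary 5 ∙ unary (toℕ c) ∙ encodeᵖ ψ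

encodeᵗ : EQCTL* k n → D
encodeᵗ (ctl* φ) = unary 0 ∙ encodeˢ φ
encodeᵗ (∃̇ φ)    = unary 1 ∙ encodeᵗ φ

encodePLTL : (A → D) → PLTL A → D
encodePLTL f (letter p) = unary 0 ∙ f p
encodePLTL f (¬̇ φ)      = unary 1 ∙ encodePLTL f φ
encodePLTL f (φ ∧̇ χ)    = unary 2 ∙ encodePLTL f φ ∙ encodePLTL f χ
encodePLTL f (○ φ)      = unary 3 ∙ encodePLTL f φ
encodePLTL f (φ U χ)    = unary 4 ∙ encodePLTL f φ ∙ encodePLTL f χ

encodeLetter : Fin m ⊎ MonolithicEQCTL* k n → D
encodeLetter (inj₁ q)       = unary 0 ∙ encodeFin q
encodeLetter (inj₂ (α , _)) = unary 1 ∙ encodeᵗ α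

encodeEQLTL : EQLTL (MonolithicEQCTL* k n) m → D
encodeEQLTL (pltl φ) = unary 0 ∙ encodePLTL encodeLetter φ
encodeEQLTL (∃̇ φ)    = unary 1 ∙ encodeEQLTL φ

encodeFormula : Instance k → D
encodeFormula (n , φ) = encodeEQLTL φ

-- The truth of CTL* formulas on the maximal paths of a tree is determined locally:
-- the set Θ of the truth sets of these paths depends only on the label of the root
-- and on the corresponding sets of the sons.  Collecting Θ over all labellings by
-- quantified letters gives the type of the tree, which decides all EQCTL* formulas
-- of the input and depends only on the label of the root and the types of the sons.
-- Hence the set of types of the complete trees of height i determines both the same
-- set for height i + 1 and the possible types of g(i + 1).
--
-- So a formula is satisfiable iff the finite graph of stages (the set of types at
-- height i, the type of g(i), the set of PLTL formulas true at i) has a subset G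
-- that contains an initial stage, in which every stage has a successor, and in
-- which every until formula true at a stage is fulfilled on some path in G, that
-- is, the stage lies in every subset of G that contains the fulfilling stages and
-- is closed under predecessors.  A run through G that serves the until formulas in
-- turn yields a model; conversely, the stages visited by a model form such a set.
--
-- All sets involved are subsets of power sets, iterated a fixed number of times, of
-- the set of subterms of the input, so the search takes elementary time.  That a
-- satisfiable formula is accepted is proved up to double negation only, which
-- suffices because acceptance is decidable.

module Submission where

open import Defs
open import Data.Bool using (true; false)
open import Data.Empty using (⊥; ⊥-elim)
open import Data.Fin using (Fin; zero; suc; toℕ)
open import Data.Fin.Properties using (toℕ-injective; toℕ<n)
open import Data.Fin.Subset using (Side; Subset; _∈_)
open import Data.List using (List; []; _∷_; _++_; map)
open import Data.Maybe using (Maybe; just; nothing)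
open import Data.Maybe.Relation.Binary.Pointwise using (Pointwise; just; nothing)
open import Data.Nat using (ℕ; zero; suc; _+_; _∸_; _*_; _^_; _≤_; _<_; z≤n; s≤s; nonZero)
open import Data.Nat.Binary using (2[1+_]; 1+[2_]; fromℕ; size) renaming (zero to zeroᵇ; toℕ to toℕᵇ)
open import Data.Nat.Binary.Properties using (toℕ-fromℕ)
open import Data.Nat.DivMod using (_divMod_; DivMod)
open import Data.Nat.Properties using
  ( ≤-refl; ≤-reflexive; ≤-trans; ≤-pred; <⇒≤; <⇒≱; module ≤-Reasoning
  ; m≤n⇒m≤1+n; m≤m+n; m≤n+m; m≤n⇒m<n∨m≡n; m+[n∸m]≡n
  ; +-suc; +-comm; +-assoc; +-identityʳ; +-cancelˡ-≡; +-mono-≤; +-monoˡ-≤; +-monoʳ-≤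
  ; *-suc; *-comm; *-assoc; *-identityˡ; *-identityʳ; *-distribˡ-+; *-mono-≤; *-monoˡ-≤; *-monoʳ-≤
  ; ^-distribˡ-+-*; ^-*-assoc; ^-monoˡ-≤; ^-monoʳ-≤; m^n>0 )
open import Data.Nat.Tactic.RingSolver using (solve-∀)
open import Data.Product using (Σ-syntax; _×_; _,_; proj₁; proj₂)
open import Data.Sum using (_⊎_; inj₁; inj₂; [_,_]′)
open import Data.Unit using (⊤; tt)
open import Data.Vec using ([]; _∷_; here; there)
open import Function using (_∘_; id; case_of_)
open import Function.Bundles using (_⇔_; mk⇔; module Equivalence)
open import Relation.Binary.PropositionalEquality using
  (_≡_; _≢_; refl; sym; trans; cong; cong₂; subst; module ≡-Reasoning)
open import Relation.Nullary using (¬_; Dec; yes; no; does)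
open import Relation.Nullary.Decidable using (decidable-stable; map′; _×-dec_; _⊎-dec_; ¬?)

-- Elementary bounds

-- The time bound concerns actual WHILE programs, and WHILE offers neither recursion nor a test for
-- equality. Programs are therefore assembled from combinators, each of which carries its code, its
-- running time and proofs that this time and the size of the output are elementary; the main loop
-- is a fold over a list. This explains the guess-and-check form of the procedure. Truth is not
-- computed by recursion on formulas: candidate truth sets are enumerated and tested against
-- fixed-point equations, whose unique solvability is proved separately. It also explains why there
-- is no syntax check. Every subterm of the input is read as a code of every syntactic kind, whether
-- it is one or not, and the truth conditions are local in `head` and `tail`. They define some truth
-- value for each subterm, and agreement with the semantics is proved for the genuine codes only.

⟪_⟫ : D → ℕ
⟪ nil ⟫   = 1
⟪ a ∙ b ⟫ = suc (⟪ a ⟫ + ⟪ b ⟫)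

1≤⟪_⟫ : ∀ x → 1 ≤ ⟪ x ⟫
1≤⟪ nil ⟫   = s≤s z≤n
1≤⟪ a ∙ b ⟫ = s≤s z≤n

size-head≤ : ∀ x → ⟪ head x ⟫ ≤ ⟪ x ⟫
size-head≤ nil     = ≤-refl
size-head≤ (a ∙ b) = m≤n⇒m≤1+n (m≤m+n ⟪ a ⟫ ⟪ b ⟫)

size-tail≤ : ∀ x → ⟪ tail x ⟫ ≤ ⟪ x ⟫
size-tail≤ nil     = ≤-refl
size-tail≤ (a ∙ b) = m≤n⇒m≤1+n (m≤n+m ⟪ b ⟫ ⟪ a ⟫)

2*m≤2^m : ∀ m → m + m ≤ 2 ^ m
2*m≤2^m zero          = z≤n
2*m≤2^m (suc zero)    = ≤-refl
2*m≤2^m (suc (suc m)) = begin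
  suc (suc m) + suc (suc m)       ≡⟨ cong suc (+-suc (suc m) (suc m)) ⟩
  2 + (suc m + suc m)             ≤⟨ +-mono-≤ (^-monoʳ-≤ 2 {1} {suc m} (s≤s z≤n)) (2*m≤2^m (suc m)) ⟩
  2 ^ suc m + 2 ^ suc m           ≡⟨ cong (2 ^ suc m +_) (sym (+-identityʳ _)) ⟩
  2 ^ suc (suc m)                 ∎
  where open ≤-Reasoning

m≤2^m : ∀ m → m ≤ 2 ^ m
m≤2^m m = ≤-trans (m≤m+n m m) (2*m≤2^m m)

tower-mono : ∀ h {m n} → m ≤ n → tower h m ≤ tower h n
tower-mono zero    m≤n = m≤n
tower-mono (suc h) m≤n = ^-monoʳ-≤ 2 (tower-mono h m≤n)

tower-+ : ∀ a b n → tower a (tower b n) ≡ tower (a + b) n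
tower-+ zero    b n = refl
tower-+ (suc a) b n = cong (2 ^_) (tower-+ a b n)

tower-step : ∀ h n → tower h n ≤ tower (suc h) n
tower-step h n = m≤2^m (tower h n)

tower-raise : ∀ d h n → tower h n ≤ tower (d + h) n
tower-raise zero    h n = ≤-refl
tower-raise (suc d) h n = ≤-trans (tower-raise d h n) (tower-step (d + h) n)

tower-⊔ˡ : ∀ a b n → tower a n ≤ tower (b + a) n
tower-⊔ˡ a b n = tower-raise b a n

tower-⊔ʳ : ∀ a b n → tower b n ≤ tower (b + a) n
tower-⊔ʳ a b n = subst (λ c → tower b n ≤ tower c n) (+-comm a b) (tower-raise a b n)

h≤tower : ∀ h {n} → 1 ≤ n → h ≤ tower h n
h≤tower zero    1≤n = z≤n
h≤tower (suc h) {n} 1≤n = begin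
  suc h                  ≤⟨ s≤s (h≤tower h 1≤n) ⟩
  suc (tower h n)        ≤⟨ +-monoˡ-≤ (tower h n) (1≤tower h) ⟩
  tower h n + tower h n  ≤⟨ 2*m≤2^m (tower h n) ⟩
  tower (suc h) n        ∎
  where
  open ≤-Reasoning
  1≤tower : ∀ h → 1 ≤ tower h n
  1≤tower zero    = 1≤n
  1≤tower (suc h) = m^n>0 2 (tower h n)

record Bounded {A : Set} (μ : A → ℕ) (f : A → ℕ) : Set where
  constructor bounded
  field
    height : ℕ
    bound  : ∀ x → f x ≤ tower height (μ x)

Elem : (D → ℕ) → Set
Elem = Bounded ⟪_⟫

elem-≤ : {f g : D → ℕ} → (∀ x → f x ≤ g x) → Elem g → Elem f
elem-≤ f≤g (bounded h b) = bounded h (λ x → ≤-trans (f≤g x) (b x))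

elem-size : Elem ⟪_⟫
elem-size = bounded 0 (λ x → ≤-refl)

-- A tower of height `c` over a positive number is at least `c`, so the constant is absorbed by the
-- height.
elem-const : ∀ c → Elem (λ _ → c)
elem-const c = bounded c (λ x → h≤tower c 1≤⟪ x ⟫)

elem-2^ : {f : D → ℕ} → Elem f → Elem (λ x → 2 ^ f x)
elem-2^ (bounded h b) = bounded (suc h) (λ x → ^-monoʳ-≤ 2 (b x))

elem-+ : {f g : D → ℕ} → Elem f → Elem g → Elem (λ x → f x + g x)
elem-+ (bounded h b) (bounded h′ b′) = bounded (suc (h′ + h)) λ x →
  ≤-trans (+-mono-≤ (≤-trans (b x) (tower-⊔ˡ h h′ ⟪ x ⟫)) (≤-trans (b′ x) (tower-⊔ʳ h h′ ⟪ x ⟫)))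
          (2*m≤2^m (tower (h′ + h) ⟪ x ⟫))

elem-* : {f g : D → ℕ} → Elem f → Elem g → Elem (λ x → f x * g x)
elem-* {f} {g} ef eg = elem-≤ fg≤ (elem-2^ (elem-+ ef eg))
  where
  fg≤ : ∀ x → f x * g x ≤ 2 ^ (f x + g x)
  fg≤ x = ≤-trans (*-mono-≤ (m≤2^m (f x)) (m≤2^m (g x)))
                  (≤-reflexive (sym (^-distribˡ-+-* 2 (f x) (g x))))

elem-^ : {f g : D → ℕ} → Elem f → Elem g → Elem (λ x → f x ^ g x)
elem-^ {f} {g} ef eg = elem-≤ fg≤ (elem-2^ (elem-* ef eg))
  where
  fg≤ : ∀ x → f x ^ g x ≤ 2 ^ (f x * g x)
  fg≤ x = ≤-trans (^-monoˡ-≤ (g x) (m≤2^m (f x))) (≤-reflexive (^-*-assoc 2 (f x) (g x)))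

-- Nothing is assumed about monotonicity of `f`: its bound is applied at `g x`, and only the tower
-- has to be monotone. This is why every program comes with a bound on its output size.
elem-∘ : {f : D → ℕ} {g : D → D} → Elem f → Elem (⟪_⟫ ∘ g) → Elem (f ∘ g)
elem-∘ {f} {g} (bounded h b) (bounded h′ b′) = bounded (h + h′) λ x →
  ≤-trans (b (g x)) (≤-trans (tower-mono h (b′ x)) (≤-reflexive (tower-+ h h′ ⟪ x ⟫)))

elem-tower : ∀ h {f : D → ℕ} → Elem f → Elem (λ x → tower h (f x))
elem-tower zero    e = e
elem-tower (suc h) e = elem-2^ (elem-tower h e)

-- Elementary functions

-- The code works on the first entry of a stack held in the only variable.
record Comp (f : D → D) : Set where
  field
    code    : Command 1
    time    : D → ℕ
    run     : ∀ x r → Exec code ((x ∙ r) ∷ []) (time x) ((f x ∙ r) ∷ [])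
    time-elem : Elem time
    size-elem : Elem (⟪_⟫ ∘ f)

open Comp

private
  store : Expr 1
  store = var zero

compExpr : {f : D → D} (e : Expr 1) → (∀ x r → eval ((x ∙ r) ∷ []) e ≡ f x ∙ r) →
           Elem (⟪_⟫ ∘ f) → Comp f
compExpr {f} e eq ef = record
  { code = zero ≔ e
  ; time = λ _ → suc (cost e)
  ; run  = λ x r → subst (λ y → Exec (zero ≔ e) ((x ∙ r) ∷ []) _ (y ∷ [])) (eq x r) assign
  ; time-elem = elem-const _
  ; size-elem = ef
  }

idᵉ : Comp id
idᵉ = compExpr (cons (hd store) (tl store)) (λ _ _ → refl) elem-size

headᵉ : Comp head
headᵉ = compExpr (cons (hd (hd store)) (tl store)) (λ _ _ → refl) (elem-≤ size-head≤ elem-size)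

tailᵉ : Comp tail
tailᵉ = compExpr (cons (tl (hd store)) (tl store)) (λ _ _ → refl) (elem-≤ size-tail≤ elem-size)

nilᵉ : Comp (λ _ → nil)
nilᵉ = compExpr (cons nil (tl store)) (λ _ _ → refl) (elem-const 1)

infixr 9 _∘ᵉ_
_∘ᵉ_ : {f g : D → D} → Comp f → Comp g → Comp (f ∘ g)
_∘ᵉ_ {f} {g} F G = record
  { code = code G ⨾ code F
  ; time = λ x → time G x + time F (g x)
  ; run  = λ x r → seq (run G x r) (run F (g x) r)
  ; time-elem = elem-+ (time-elem G) (elem-∘ {g = g} (time-elem F) (size-elem G))
  ; size-elem = elem-∘ {g = g} (size-elem F) (size-elem G)
  }

infixr 5 _∙ᵉ_
_∙ᵉ_ : {f g : D → D} → Comp f → Comp g → Comp (λ x → f x ∙ g x)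
_∙ᵉ_ {f} {g} F G = record
  -- The argument is duplicated; `F` consumes one copy, and the other is then brought to the top for
  -- `G`. The constants in `time` are the costs of the three assignments.
  { code = zero ≔ cons (hd store) store ⨾ code F ⨾
           zero ≔ cons (hd (tl store)) (cons (hd store) (tl (tl store))) ⨾ code G ⨾
           zero ≔ cons (cons (hd (tl store)) (hd store)) (tl (tl store))
  ; time = λ x → 5 + (time F x + (11 + (time G x + 11)))
  ; run  = λ x r → seq assign (seq (run F x _) (seq assign (seq (run G x _) assign)))
  ; time-elem = elem-+ (elem-const 5) (elem-+ (time-elem F) (elem-+ (elem-const 11)
                  (elem-+ (time-elem G) (elem-const 11))))
  ; size-elem = elem-+ (elem-const 1) (elem-+ (size-elem F) (size-elem G))
  }

ifᴰ : {A : Set} → D → A → A → A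
ifᴰ nil     a b = b
ifᴰ (_ ∙ _) a b = a

ifᵉ : {c f g : D → D} → Comp c → Comp f → Comp g → Comp (λ x → ifᴰ (c x) (f x) (g x))
ifᵉ {c} {f} {g} C F G = record
  { code = zero ≔ cons (hd store) store ⨾ code C ⨾
           if hd store then (zero ≔ tl store ⨾ code F) else (zero ≔ tl store ⨾ code G)
  ; time = λ x → 5 + (time C x + suc (2 + ifᴰ (c x) (3 + time F x) (3 + time G x)))
  ; run  = λ x r → seq assign (seq (run C x (x ∙ r)) (branch x r))
  ; time-elem = elem-+ (elem-const 5) (elem-+ (time-elem C) (elem-+ (elem-const 3)
      (elem-≤ (λ x → ifᴰ-≤ (c x)) (elem-+ (elem-+ (elem-const 3) (time-elem F))
                                          (elem-+ (elem-const 3) (time-elem G))))))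
  ; size-elem = elem-≤ (λ x → size-≤ (c x)) (elem-+ (size-elem F) (size-elem G))
  }
  where
  ifᴰ-≤ : ∀ d {a b} → ifᴰ d a b ≤ a + b
  ifᴰ-≤ nil     {a} {b} = m≤n+m b a
  ifᴰ-≤ (_ ∙ _) {a} {b} = m≤m+n a b

  size-≤ : ∀ d {a b} → ⟪ ifᴰ d a b ⟫ ≤ ⟪ a ⟫ + ⟪ b ⟫
  size-≤ nil     {a} {b} = m≤n+m ⟪ b ⟫ ⟪ a ⟫
  size-≤ (_ ∙ _) {a} {b} = m≤m+n ⟪ a ⟫ ⟪ b ⟫

  branch : ∀ x r → Exec (if hd store then (zero ≔ tl store ⨾ code F) else (zero ≔ tl store ⨾ code G))
                        ((c x ∙ (x ∙ r)) ∷ [])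
                        (suc (2 + ifᴰ (c x) (3 + time F x) (3 + time G x)))
                        ((ifᴰ (c x) (f x) (g x) ∙ r) ∷ [])
  branch x r with c x
  ... | nil   = if-false refl (seq assign (run G x r))
  ... | _ ∙ _ = if-true (λ ()) (seq assign (run F x r))

iterate : (D → D) → ℕ → D → D
iterate f zero    x = x
iterate f (suc n) x = iterate f n (f x)

-- The number `N` of rounds is not computed by the program; it is justified by the guard, the head
-- of the state, turning nil after exactly `N x` rounds. The bound `β` on all intermediate states
-- limits the time of each single round.
whileᵉ : {i f : D → D} → Comp i → Comp f → (N β : D → ℕ) → Elem N → Elem β →
         (∀ x j → j < N x → head (iterate f j (i x)) ≢ nil) →
         (∀ x → head (iterate f (N x) (i x)) ≡ nil) →
         (∀ x j → j ≤ N x → ⟪ iterate f j (i x) ⟫ ≤ β x) →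
         Comp (λ x → iterate f (N x) (i x))
whileᵉ {i} {f} I F N β eN eβ nonstop stop small = record
  { code = code I ⨾ (while hd (hd store) loop code F)
  ; time = λ x → time I x + loopTime (N x) (i x)
  ; run  = λ x r → seq (run I x r) (exec (N x) (i x) r (nonstop x) (stop x))
  ; time-elem = elem-+ (time-elem I)
      (elem-≤ (λ x → loop≤ (N x) (i x) (β x) (small x))
        (elem-* (elem-+ (elem-const 1) eN)
                (elem-+ (elem-const 4) (elem-tower (Bounded.height (time-elem F)) eβ))))
  ; size-elem = elem-≤ (λ x → small x (N x) ≤-refl) eβ
  }
  where
  loopTime : ℕ → D → ℕ
  loopTime zero    x = 4
  loopTime (suc n) x = 4 + (time F x + loopTime n (f x))

  exec : ∀ n x r → (∀ j → j < n → head (iterate f j x) ≢ nil) →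
         head (iterate f n x) ≡ nil →
         Exec (while hd (hd store) loop code F) ((x ∙ r) ∷ []) (loopTime n x)
              ((iterate f n x ∙ r) ∷ [])
  exec zero    x r ns st = while-false st
  exec (suc n) x r ns st =
    while-true (ns 0 (s≤s z≤n)) (run F x r)
      (exec n (f x) r (λ j j<n → ns (suc j) (s≤s j<n)) st)

  loop≤ : ∀ n x b → (∀ j → j ≤ n → ⟪ iterate f j x ⟫ ≤ b) →
          loopTime n x ≤ suc n * (4 + tower (Bounded.height (time-elem F)) b)
  loop≤ zero    x b sm = ≤-trans (m≤m+n 4 _) (≤-reflexive (sym (+-identityʳ _)))
  loop≤ (suc n) x b sm = begin
    4 + (time F x + loopTime n (f x))
      ≡⟨ sym (+-assoc 4 (time F x) _) ⟩
    (4 + time F x) + loopTime n (f x)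
      ≤⟨ +-mono-≤ (+-monoʳ-≤ 4 (≤-trans (Bounded.bound (time-elem F) x)
                                  (tower-mono (Bounded.height (time-elem F)) (sm 0 z≤n))))
                  (loop≤ n (f x) b (λ j j≤n → sm (suc j) (s≤s j≤n))) ⟩
    suc (suc n) * (4 + tower (Bounded.height (time-elem F)) b) ∎
    where open ≤-Reasoning

constᵉ : (d : D) → Comp (λ _ → d)
constᵉ nil     = nilᵉ
constᵉ (a ∙ b) = constᵉ a ∙ᵉ constᵉ b

comp-≗ : {f g : D → D} → (∀ x → f x ≡ g x) → Comp f → Comp g
comp-≗ {f} {g} f≗g F = record
  { code = code F
  ; time = time F
  ; run  = λ x r → subst (λ y → Exec (code F) _ _ ((y ∙ r) ∷ [])) (f≗g x) (run F x r)
  ; time-elem = time-elem F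
  ; size-elem = elem-≤ (λ x → ≤-reflexive (cong ⟪_⟫ (sym (f≗g x)))) (size-elem F)
  }

open Equivalence using (to; from)

len : D → ℕ
len nil     = 0
len (_ ∙ l) = suc (len l)

len≤ : ∀ l → len l ≤ ⟪ l ⟫
len≤ nil     = z≤n
len≤ (y ∙ l) = s≤s (≤-trans (len≤ l) (m≤n+m ⟪ l ⟫ ⟪ y ⟫))

foldᴰ : (D → D → D) → D → D → D
foldᴰ f a nil     = a
foldᴰ f a (y ∙ l) = foldᴰ f (f y a) l

-- A round may multiply the size of the accumulator by a factor that depends on the list entry and
-- on the environment but not on the accumulator, so that the factors combine to a power. Growth
-- depending on the accumulator could iterate exponentials, while additive growth would exclude
-- `pow`.
foldᵉ : {f i l : D → D} → Comp f → Comp i → Comp l →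
        {c : D → ℕ} → Elem c → (∀ y a e → ⟪ f (y ∙ a ∙ e) ⟫ ≤ ⟪ a ⟫ * c (y ∙ e)) →
        Comp (λ e → foldᴰ (λ y a → f (y ∙ a ∙ e)) (i e) (l e))
foldᵉ {f} {i} {l} F I L {c} (bounded h cb) growth =
  comp-≗ (λ e → cong (head ∘ tail) (result e (l e) (i e)))
    (headᵉ ∘ᵉ tailᵉ ∘ᵉ whileᵉ (L ∙ᵉ I ∙ᵉ idᵉ)
      ((tailᵉ ∘ᵉ headᵉ) ∙ᵉ (F ∘ᵉ ((headᵉ ∘ᵉ headᵉ) ∙ᵉ tailᵉ)) ∙ᵉ (tailᵉ ∘ᵉ tailᵉ))
      (len ∘ l) β
      elem-len
      (elem-+ (elem-const 1) (elem-+ (size-elem L) (elem-+ (elem-const 1)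
        (elem-+ (elem-* (size-elem I) (elem-^ elem-C elem-len)) elem-size))))
      (λ e → nonstop e (l e) (i e))
      (λ e → cong head (result e (l e) (i e)))
      (λ e → small e (⟪ l e ⟫) (l e) (i e) ≤-refl))
  where
  next : D → D
  next s = tail (head s) ∙ f (head (head s) ∙ tail s) ∙ tail (tail s)

  -- One factor for all entries, as `b` bounds the size of the whole list. The outer `suc` keeps it
  -- positive, so that the powers for the rounds still to come only enlarge the bound.
  C : D → ℕ → ℕ
  C e b = suc (tower h (suc (b + ⟪ e ⟫)))

  β : D → ℕ
  β e = suc (⟪ l e ⟫ + suc (⟪ i e ⟫ * C e ⟪ l e ⟫ ^ len (l e) + ⟪ e ⟫))

  elem-len : Elem (len ∘ l)
  elem-len = elem-≤ (len≤ ∘ l) (size-elem L)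

  elem-C : Elem (λ e → C e ⟪ l e ⟫)
  elem-C = elem-+ (elem-const 1) (elem-tower h (elem-+ (elem-const 1) (elem-+ (size-elem L) elem-size)))

  result : ∀ e m a → iterate next (len m) (m ∙ a ∙ e) ≡ nil ∙ foldᴰ (λ y a → f (y ∙ a ∙ e)) a m ∙ e
  result e nil     a = refl
  result e (y ∙ m) a = result e m (f (y ∙ a ∙ e))

  nonstop : ∀ e m a j → j < len m → head (iterate next j (m ∙ a ∙ e)) ≢ nil
  nonstop e (y ∙ m) a zero    j< ()
  nonstop e (y ∙ m) a (suc j) (s≤s j<) = nonstop e m (f (y ∙ a ∙ e)) j j<

  open ≤-Reasoning

  small : ∀ e b m a → ⟪ m ⟫ ≤ b → ∀ j → j ≤ len m →
          ⟪ iterate next j (m ∙ a ∙ e) ⟫ ≤ suc (⟪ m ⟫ + suc (⟪ a ⟫ * C e b ^ len m + ⟪ e ⟫))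
  small e b m a m≤b zero j≤ =
    s≤s (+-monoʳ-≤ ⟪ m ⟫ (s≤s (+-monoˡ-≤ ⟪ e ⟫ (begin
      ⟪ a ⟫                    ≡⟨ sym (*-identityʳ ⟪ a ⟫) ⟩
      ⟪ a ⟫ * 1                ≤⟨ *-monoʳ-≤ ⟪ a ⟫ (m^n>0 (C e b) (len m)) ⟩
      ⟪ a ⟫ * C e b ^ len m    ∎))))
  small e b (y ∙ m) a m≤b (suc j) (s≤s j≤) = begin
    ⟪ iterate next j (m ∙ f (y ∙ a ∙ e) ∙ e) ⟫
      ≤⟨ small e b m _ (≤-trans (m≤n+m ⟪ m ⟫ (suc ⟪ y ⟫)) m≤b) j j≤ ⟩
    suc (⟪ m ⟫ + suc (⟪ f (y ∙ a ∙ e) ⟫ * C e b ^ len m + ⟪ e ⟫))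
      ≤⟨ s≤s (+-mono-≤ (m≤n+m ⟪ m ⟫ (suc ⟪ y ⟫)) (s≤s (+-monoˡ-≤ ⟪ e ⟫ (begin
         ⟪ f (y ∙ a ∙ e) ⟫ * C e b ^ len m       ≤⟨ *-monoˡ-≤ (C e b ^ len m) a′≤ ⟩
         ⟪ a ⟫ * C e b * C e b ^ len m           ≡⟨ *-assoc ⟪ a ⟫ (C e b) _ ⟩
         ⟪ a ⟫ * C e b ^ suc (len m)             ∎)))) ⟩
    suc (⟪ y ∙ m ⟫ + suc (⟪ a ⟫ * C e b ^ suc (len m) + ⟪ e ⟫)) ∎
    where
    a′≤ : ⟪ f (y ∙ a ∙ e) ⟫ ≤ ⟪ a ⟫ * C e b
    a′≤ = ≤-trans (growth y a e) (*-monoʳ-≤ ⟪ a ⟫ (≤-trans (cb (y ∙ e))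
      (m≤n⇒m≤1+n (tower-mono h (s≤s (+-monoˡ-≤ ⟪ e ⟫
        (≤-trans (≤-trans (m≤m+n ⟪ y ⟫ ⟪ m ⟫) (m≤n⇒m≤1+n ≤-refl)) m≤b)))))))

additive⇒multiplicative : ∀ x a c → 1 ≤ a → x ≤ a + c → x ≤ a * suc c
additive⇒multiplicative x a c 1≤a x≤ = begin
  x          ≤⟨ x≤ ⟩
  a + c      ≡⟨ cong (a +_) (sym (*-identityˡ c)) ⟩
  a + 1 * c  ≤⟨ +-monoʳ-≤ a (*-monoˡ-≤ c 1≤a) ⟩
  a + a * c  ≡⟨ sym (*-suc a c) ⟩
  a * suc c  ∎
  where open ≤-Reasoning

foldᵉ⁺ : {f i l : D → D} → Comp f → Comp i → Comp l →
         {c : D → ℕ} → Elem c → (∀ y a e → ⟪ f (y ∙ a ∙ e) ⟫ ≤ ⟪ a ⟫ + c (y ∙ e)) →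
         Comp (λ e → foldᴰ (λ y a → f (y ∙ a ∙ e)) (i e) (l e))
foldᵉ⁺ F I L ec growth = foldᵉ F I L (elem-+ (elem-const 1) ec)
  (λ y a e → additive⇒multiplicative _ ⟪ a ⟫ _ 1≤⟪ a ⟫ (growth y a e))

-- The argument of a predicate serves as an environment: entry `i` is the variable with de Bruijn
-- index `i`, and each bounded quantifier prepends the element it ranges over.
π : ℕ → D → D
π zero    = head
π (suc i) = π i ∘ tail

varᵉ : ∀ i → Comp (π i)
varᵉ zero    = headᵉ
varᵉ (suc i) = varᵉ i ∘ᵉ tailᵉ

-- Lists

infix 4 _∈ᴰ_
data _∈ᴰ_ (x : D) : D → Set where
  here  : ∀ {l} → x ∈ᴰ x ∙ l
  there : ∀ {y l} → x ∈ᴰ l → x ∈ᴰ y ∙ l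

Some All : D → (D → Set) → Set
Some l P = Σ[ y ∈ D ] y ∈ᴰ l × P y
All  l P = ∀ y → y ∈ᴰ l → P y

push : D → D → D
push m l = foldᴰ _∙_ l m

cons-growth : ∀ y a e → suc (⟪ y ⟫ + ⟪ a ⟫) ≤ ⟪ a ⟫ + ⟪ y ∙ e ⟫
cons-growth y a e = begin
  suc (⟪ y ⟫ + ⟪ a ⟫)    ≡⟨ +-comm (suc ⟪ y ⟫) ⟪ a ⟫ ⟩
  ⟪ a ⟫ + suc ⟪ y ⟫      ≤⟨ +-monoʳ-≤ ⟪ a ⟫ (s≤s (m≤m+n ⟪ y ⟫ ⟪ e ⟫)) ⟩
  ⟪ a ⟫ + ⟪ y ∙ e ⟫      ∎
  where open ≤-Reasoning

pushᵉ : {f g : D → D} → Comp f → Comp g → Comp (λ e → push (f e) (g e))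
pushᵉ F G = foldᵉ⁺ (headᵉ ∙ᵉ varᵉ 1) G F elem-size cons-growth

∈-pushʳ : ∀ m {l z} → z ∈ᴰ l → z ∈ᴰ push m l
∈-pushʳ nil     z∈ = z∈
∈-pushʳ (y ∙ m) z∈ = ∈-pushʳ m (there z∈)

∈-pushˡ : ∀ {m} l {z} → z ∈ᴰ m → z ∈ᴰ push m l
∈-pushˡ {y ∙ m} l here       = ∈-pushʳ m here
∈-pushˡ {y ∙ m} l (there z∈) = ∈-pushˡ (y ∙ l) z∈

∈-push⁻ : ∀ m {l z} → z ∈ᴰ push m l → z ∈ᴰ m ⊎ z ∈ᴰ l
∈-push⁻ nil     z∈ = inj₂ z∈
∈-push⁻ (y ∙ m) z∈ with ∈-push⁻ m z∈
... | inj₁ z∈m         = inj₁ (there z∈m)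
... | inj₂ here        = inj₁ here
... | inj₂ (there z∈l) = inj₂ z∈l

size-push : ∀ m l → ⟪ push m l ⟫ ≤ ⟪ m ⟫ + ⟪ l ⟫
size-push nil     l = m≤n+m ⟪ l ⟫ 1
size-push (y ∙ m) l = begin
  ⟪ push m (y ∙ l) ⟫              ≤⟨ size-push m (y ∙ l) ⟩
  ⟪ m ⟫ + suc (⟪ y ⟫ + ⟪ l ⟫)     ≡⟨ +-suc ⟪ m ⟫ _ ⟩
  suc (⟪ m ⟫ + (⟪ y ⟫ + ⟪ l ⟫))   ≡⟨ cong suc (sym (+-assoc (⟪ m ⟫) (⟪ y ⟫) (⟪ l ⟫))) ⟩
  suc (⟪ m ⟫ + ⟪ y ⟫ + ⟪ l ⟫)     ≡⟨ cong (λ n → suc (n + ⟪ l ⟫)) (+-comm (⟪ m ⟫) (⟪ y ⟫)) ⟩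
  ⟪ y ∙ m ⟫ + ⟪ l ⟫               ∎
  where open ≤-Reasoning

mapᴰ : (D → D) → D → D
mapᴰ g l = foldᴰ (λ y a → g y ∙ a) nil l

mapᵉ : {g l : D → D} → Comp g → Comp l → Comp (λ e → mapᴰ (λ y → g (y ∙ e)) (l e))
mapᵉ {g} G L = foldᵉ⁺ (G ∘ᵉ (headᵉ ∙ᵉ tailᵉ ∘ᵉ tailᵉ) ∙ᵉ varᵉ 1) nilᵉ L
  (elem-+ (elem-const 1) (Comp.size-elem G))
  (λ y a e → ≤-reflexive (+-comm (suc ⟪ g (y ∙ e) ⟫) ⟪ a ⟫))

∈-map : ∀ g {l y} → y ∈ᴰ l → g y ∈ᴰ mapᴰ g l
∈-map g {l} = go l nil
  where
  old : ∀ l a {z} → z ∈ᴰ a → z ∈ᴰ foldᴰ (λ y a → g y ∙ a) a l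
  old nil     a z∈ = z∈
  old (x ∙ l) a z∈ = old l _ (there z∈)

  go : ∀ l a {y} → y ∈ᴰ l → g y ∈ᴰ foldᴰ (λ y a → g y ∙ a) a l
  go (x ∙ l) a here       = old l _ here
  go (x ∙ l) a (there y∈) = go l _ y∈

∈-map⁻ : ∀ g l {z} → z ∈ᴰ mapᴰ g l → Some l (λ y → z ≡ g y)
∈-map⁻ g l z∈ with go l nil z∈
  where
  go : ∀ l a {z} → z ∈ᴰ foldᴰ (λ y a → g y ∙ a) a l → Some l (λ y → z ≡ g y) ⊎ z ∈ᴰ a
  go nil     a z∈ = inj₂ z∈
  go (x ∙ l) a z∈ with go l _ z∈
  ... | inj₁ (y , y∈ , eq) = inj₁ (y , there y∈ , eq)
  ... | inj₂ here          = inj₁ (x , here , refl)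
  ... | inj₂ (there z∈a)   = inj₂ z∈a
... | inj₁ found = found

concatMapᴰ : (D → D) → D → D
concatMapᴰ g l = foldᴰ (λ y a → push (g y) a) nil l

concatMapᵉ : {g l : D → D} → Comp g → Comp l → Comp (λ e → concatMapᴰ (λ y → g (y ∙ e)) (l e))
concatMapᵉ {g} G L = foldᵉ⁺ (pushᵉ (G ∘ᵉ (headᵉ ∙ᵉ tailᵉ ∘ᵉ tailᵉ)) (varᵉ 1)) nilᵉ L
  (Comp.size-elem G)
  (λ y a e → ≤-trans (size-push (g (y ∙ e)) a) (≤-reflexive (+-comm ⟪ g (y ∙ e) ⟫ ⟪ a ⟫)))

∈-concatMap : ∀ g {l y z} → y ∈ᴰ l → z ∈ᴰ g y → z ∈ᴰ concatMapᴰ g l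
∈-concatMap g {l} = go l nil
  where
  old : ∀ l a {z} → z ∈ᴰ a → z ∈ᴰ foldᴰ (λ y a → push (g y) a) a l
  old nil     a z∈ = z∈
  old (x ∙ l) a z∈ = old l _ (∈-pushʳ (g x) z∈)

  go : ∀ l a {y z} → y ∈ᴰ l → z ∈ᴰ g y → z ∈ᴰ foldᴰ (λ y a → push (g y) a) a l
  go (x ∙ l) a here       z∈ = old l _ (∈-pushˡ a z∈)
  go (x ∙ l) a (there y∈) z∈ = go l _ y∈ z∈

∈-concatMap⁻ : ∀ g l {z} → z ∈ᴰ concatMapᴰ g l → Some l (λ y → z ∈ᴰ g y)
∈-concatMap⁻ g l z∈ with go l nil z∈
  where
  go : ∀ l a {z} → z ∈ᴰ foldᴰ (λ y a → push (g y) a) a l → Some l (λ y → z ∈ᴰ g y) ⊎ z ∈ᴰ a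
  go nil     a z∈ = inj₂ z∈
  go (x ∙ l) a z∈ with go l _ z∈
  ... | inj₁ (y , y∈ , eq) = inj₁ (y , there y∈ , eq)
  ... | inj₂ z∈′ with ∈-push⁻ (g x) z∈′
  ...   | inj₁ z∈g = inj₁ (x , here , z∈g)
  ...   | inj₂ z∈a = inj₂ z∈a
... | inj₁ found = found

-- Elementary predicates

record Decider (P : D → Set) : Set where
  field
    test      : D → D
    test-comp : Comp test
    correct   : ∀ x → test x ≢ nil ⇔ P x

  decide : ∀ x → Dec (P x)
  decide x with test x in eq
  ... | nil   = no (λ p → from (correct x) p eq)
  ... | _ ∙ _ = yes (to (correct x) (λ eq′ → case trans (sym eq) eq′ of λ ()))

open Decider

one : D
one = nil ∙ nil

infixl 8 _$ᵉ_
_$ᵉ_ : {P : D → Set} {f : D → D} → Decider P → Comp f → Decider (P ∘ f)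
_$ᵉ_ {f = f} p F = record
  { test = test p ∘ f ; test-comp = test-comp p ∘ᵉ F ; correct = correct p ∘ f }

nonnilᵉ : {f : D → D} → Comp f → Decider (λ e → f e ≢ nil)
nonnilᵉ {f} F = record { test = f ; test-comp = F ; correct = λ _ → mk⇔ id id }

infix 7 ¬ᵉ_
¬ᵉ_ : {P : D → Set} → Decider P → Decider (λ e → ¬ P e)
¬ᵉ_ {P} p = record
  { test = λ e → ifᴰ (test p e) nil one
  ; test-comp = ifᵉ (test-comp p) nilᵉ (constᵉ one)
  ; correct = λ e → go e
  }
  where
  go : ∀ e → ifᴰ (test p e) nil one ≢ nil ⇔ (¬ P e)
  go e with test p e | correct p e
  ... | nil   | c = mk⇔ (λ _ pe → from c pe refl) (λ _ ())
  ... | _ ∙ _ | c = mk⇔ (λ t _ → t refl) (λ np _ → np (to c (λ ())))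

infixr 6 _×ᵉ_
_×ᵉ_ : {P Q : D → Set} → Decider P → Decider Q → Decider (λ e → P e × Q e)
_×ᵉ_ {P} {Q} p q = record
  { test = λ e → ifᴰ (test p e) (test q e) nil
  ; test-comp = ifᵉ (test-comp p) (test-comp q) nilᵉ
  ; correct = λ e → go e
  }
  where
  go : ∀ e → ifᴰ (test p e) (test q e) nil ≢ nil ⇔ (P e × Q e)
  go e with test p e | correct p e
  ... | nil   | c = mk⇔ (λ t → ⊥-elim (t refl)) (λ (pe , _) _ → from c pe refl)
  ... | _ ∙ _ | c = mk⇔ (λ t → to c (λ ()) , to (correct q e) t) (λ (_ , qe) → from (correct q e) qe)

infixr 5 _⊎ᵉ_
_⊎ᵉ_ : {P Q : D → Set} → Decider P → Decider Q → Decider (λ e → P e ⊎ Q e)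
_⊎ᵉ_ {P} {Q} p q = record
  { test = λ e → ifᴰ (test p e) one (test q e)
  ; test-comp = ifᵉ (test-comp p) (constᵉ one) (test-comp q)
  ; correct = λ e → go e
  }
  where
  go : ∀ e → ifᴰ (test p e) one (test q e) ≢ nil ⇔ (P e ⊎ Q e)
  go e with test p e | correct p e
  ... | nil   | c = mk⇔ (λ t → inj₂ (to (correct q e) t))
                        (λ { (inj₁ pe) _ → from c pe refl ; (inj₂ qe) → from (correct q e) qe })
  ... | _ ∙ _ | c = mk⇔ (λ t → inj₁ (to c (λ ()))) (λ _ ())

⊥ᵉ : Decider (λ _ → ⊥)
⊥ᵉ = record { test = λ _ → nil ; test-comp = nilᵉ ; correct = λ _ → mk⇔ (λ t → t refl) (λ ()) }

-- Only the length of the right spine of `d` matters, so every tree selects a case or, beyond the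
-- last one, falsity. Conditions on codes thereby make sense for arbitrary trees.
Switch : D → List Set → Set
Switch d       []       = ⊥
Switch nil     (P ∷ Ps) = P
Switch (_ ∙ d) (P ∷ Ps) = Switch d Ps

retarget : {P Q : D → Set} → (∀ e → P e ⇔ Q e) → Decider P → Decider Q
retarget P⇔Q p = record
  { test = test p ; test-comp = test-comp p
  ; correct = λ e → mk⇔ (λ t → to (P⇔Q e) (to (correct p e) t))
                        (λ q → from (correct p e) (from (P⇔Q e) q)) }

infixr 5 _∷ᵉ_
data Deciders : List (D → Set) → Set₁ where
  []ᵉ  : Deciders []
  _∷ᵉ_ : ∀ {P Ps} → Decider P → Deciders Ps → Deciders (P ∷ Ps)

switchᵉ : ∀ {Ps} {f : D → D} → Comp f → Deciders Ps →
          Decider (λ e → Switch (f e) (map (λ P → P e) Ps))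
switchᵉ F []ᵉ = ⊥ᵉ
switchᵉ {Ps = P ∷ Ps} {f} F (p ∷ᵉ ps) = record
  { test = λ e → ifᴰ (f e) (test rest e) (test p e)
  ; test-comp = ifᵉ F (test-comp rest) (test-comp p)
  ; correct = λ e → go e
  }
  where
  rest : Decider (λ e → Switch (tail (f e)) (map (λ P → P e) Ps))
  rest = switchᵉ (tailᵉ ∘ᵉ F) ps

  go : ∀ e → ifᴰ (f e) (test rest e) (test p e) ≢ nil ⇔ Switch (f e) (P e ∷ map (λ P → P e) Ps)
  go e with f e | correct rest e
  ... | nil   | c = correct p e
  ... | _ ∙ _ | c = c

∃ᵉ : {P : D → Set} {l : D → D} → Comp l → Decider P →
     Decider (λ e → Some (l e) (λ y → P (y ∙ e)))
∃ᵉ {P} {l} L p = record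
  { test = λ e → foldᴰ (λ y a → ifᴰ (test p (y ∙ e)) one a) nil (l e)
  ; test-comp = foldᵉ⁺ (ifᵉ (test-comp p ∘ᵉ (headᵉ ∙ᵉ tailᵉ ∘ᵉ tailᵉ)) (constᵉ one) (varᵉ 1)) nilᵉ L
      (elem-const 3) (λ y a e → growth (test p (y ∙ e)) a)
  ; correct = λ e → mk⇔ (λ t → [ id , (λ t → ⊥-elim (t refl)) ]′ (forth e (l e) nil t))
                        (λ s → back e (l e) nil (inj₁ s))
  }
  where
  growth : ∀ d a → ⟪ ifᴰ d one a ⟫ ≤ ⟪ a ⟫ + 3
  growth nil     a = m≤m+n ⟪ a ⟫ 3
  growth (_ ∙ _) a = m≤n+m 3 ⟪ a ⟫

  f : D → D → D → D
  f e y a = ifᴰ (test p (y ∙ e)) one a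

  forth : ∀ e m a → foldᴰ (f e) a m ≢ nil → Some m (λ y → P (y ∙ e)) ⊎ a ≢ nil
  forth e nil     a t = inj₂ t
  forth e (y ∙ m) a t with forth e m _ t
  ... | inj₁ (z , z∈ , pz) = inj₁ (z , there z∈ , pz)
  ... | inj₂ t′ with test p (y ∙ e) | correct p (y ∙ e)
  ...   | nil   | c = inj₂ t′
  ...   | _ ∙ _ | c = inj₁ (y , here , to c (λ ()))

  back : ∀ e m a → Some m (λ y → P (y ∙ e)) ⊎ a ≢ nil → foldᴰ (f e) a m ≢ nil
  back e nil     a (inj₂ t) = t
  back e (y ∙ m) a (inj₁ (z , there z∈ , pz)) = back e m _ (inj₁ (z , z∈ , pz))
  back e (y ∙ m) a (inj₁ (_ , here , py)) = back e m _ (inj₂ now′)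
    where
    now′ : f e y a ≢ nil
    now′ with test p (y ∙ e) | correct p (y ∙ e)
    ... | nil   | c = ⊥-elim (from c py refl)
    ... | _ ∙ _ | c = λ ()
  back e (y ∙ m) a (inj₂ t) = back e m _ (inj₂ later′)
    where
    later′ : f e y a ≢ nil
    later′ with test p (y ∙ e)
    ... | nil   = t
    ... | _ ∙ _ = λ ()

∀ᵉ : {P : D → Set} {l : D → D} → Comp l → Decider P →
     Decider (λ e → All (l e) (λ y → P (y ∙ e)))
∀ᵉ {P} L p = retarget
  (λ e → mk⇔ (λ none y y∈ → stable e y (λ np → none (y , y∈ , np)))
             (λ all (y , y∈ , np) → np (all y y∈)))
  (¬ᵉ ∃ᵉ L (¬ᵉ p))
  where
  stable : ∀ e y → ¬ ¬ P (y ∙ e) → P (y ∙ e)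
  stable e y = decidable-stable (decide p (y ∙ e))

filt : {P : D → Set} → Decider P → D → D → D
filt p e l = foldᴰ (λ y a → ifᴰ (test p (y ∙ e)) (y ∙ a) a) nil l

filtᵉ : {P : D → Set} (p : Decider P) {l : D → D} → Comp l → Comp (λ e → filt p e (l e))
filtᵉ p {l} L = foldᵉ⁺
  (ifᵉ (test-comp p ∘ᵉ (headᵉ ∙ᵉ tailᵉ ∘ᵉ tailᵉ)) (headᵉ ∙ᵉ varᵉ 1) (varᵉ 1)) nilᵉ L
  elem-size (λ y a e → growth (test p (y ∙ e)) y a e)
  where
  growth : ∀ d y a e → ⟪ ifᴰ d (y ∙ a) a ⟫ ≤ ⟪ a ⟫ + ⟪ y ∙ e ⟫
  growth nil     y a e = m≤m+n ⟪ a ⟫ _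
  growth (_ ∙ _) y a e = cons-growth y a e

-- Sublists

select : (D → D) → D → D → D
select b a l = foldᴰ (λ y a → ifᴰ (b y) (y ∙ a) a) a l

∈-select⁻ : ∀ b a l {z} → z ∈ᴰ select b a l → z ∈ᴰ l × b z ≢ nil ⊎ z ∈ᴰ a
∈-select⁻ b a nil     z∈ = inj₂ z∈
∈-select⁻ b a (y ∙ l) z∈ with ∈-select⁻ b _ l z∈
... | inj₁ (z∈l , bz) = inj₁ (there z∈l , bz)
... | inj₂ z∈a with b y in eq
...   | nil = inj₂ z∈a
...   | _ ∙ _ with z∈a
...     | here       = inj₁ (here , λ eq′ → case trans (sym eq) eq′ of λ ())
...     | there z∈a′ = inj₂ z∈a′

∈-selectʳ : ∀ b a l {z} → z ∈ᴰ a → z ∈ᴰ select b a l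
∈-selectʳ b a nil     z∈ = z∈
∈-selectʳ b a (y ∙ l) z∈ with b y
... | nil   = ∈-selectʳ b a l z∈
... | _ ∙ _ = ∈-selectʳ b (y ∙ a) l (there z∈)

∈-select : ∀ b a l {z} → z ∈ᴰ l → b z ≢ nil → z ∈ᴰ select b a l
∈-select b a (y ∙ l) (there z∈) bz = ∈-select b _ l z∈ bz
∈-select b a (y ∙ l) here       bz with b y
... | nil   = ⊥-elim (bz refl)
... | _ ∙ _ = ∈-selectʳ b (y ∙ a) l here

-- The sets that the procedure compares are sublists of a common list in a common order. Subsets
-- with the same elements are then equal trees, and equations between sets can be tested by `≡ᵉ`.
select-ext : ∀ b b′ a l → (∀ y → y ∈ᴰ l → b y ≢ nil ⇔ b′ y ≢ nil) → select b a l ≡ select b′ a l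
select-ext b b′ a nil     ext = refl
select-ext b b′ a (y ∙ l) ext
  with b y | b′ y | ext y here | (λ z z∈ → ext z (there z∈))
... | nil   | nil   | c | ext′ = select-ext b b′ _ l ext′
... | nil   | _ ∙ _ | c | ext′ = ⊥-elim (from c (λ ()) refl)
... | _ ∙ _ | nil   | c | ext′ = ⊥-elim (to c (λ ()) refl)
... | _ ∙ _ | _ ∙ _ | c | ext′ = select-ext b b′ _ l ext′

module _ {P : D → Set} (p : Decider P) where

  ∈-filt⁻ : ∀ {e l z} → z ∈ᴰ filt p e l → z ∈ᴰ l × P (z ∙ e)
  ∈-filt⁻ {e} {l} {z} z∈ with ∈-select⁻ (λ y → test p (y ∙ e)) nil l z∈
  ... | inj₁ (z∈l , t) = z∈l , to (correct p (z ∙ e)) t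

  ∈-filt : ∀ {e l z} → z ∈ᴰ l → P (z ∙ e) → z ∈ᴰ filt p e l
  ∈-filt {e} {l} {z} z∈ pz = ∈-select _ nil l z∈ (from (correct p (z ∙ e)) pz)

-- A record, so that the tree can be inferred from the type.
record SizeAtMost (x : D) (m : ℕ) : Set where
  constructor sized
  field size≤ : ⟪ x ⟫ ≤ m

open SizeAtMost

size-refl : ∀ {x} → SizeAtMost x ⟪ x ⟫
size-refl = sized ≤-refl

size-head : ∀ {x m} → SizeAtMost x m → SizeAtMost (head x) m
size-head {x} (sized x≤) = sized (≤-trans (size-head≤ x) x≤)

size-tail : ∀ {x m} → SizeAtMost x m → SizeAtMost (tail x) m
size-tail {x} (sized x≤) = sized (≤-trans (size-tail≤ x) x≤)

size-ifᴰ : ∀ d {x y m n} → SizeAtMost x m → SizeAtMost y n → SizeAtMost (ifᴰ d x y) (m + n)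
size-ifᴰ nil     {m = m} _ (sized y≤) = sized (≤-trans y≤ (m≤n+m _ m))
size-ifᴰ (_ ∙ _) {n = n} (sized x≤) _ = sized (≤-trans x≤ (m≤m+n _ n))

size-∙ : ∀ {x y m n} → SizeAtMost x m → SizeAtMost y n → SizeAtMost (x ∙ y) (suc (m + n))
size-∙ (sized x≤) (sized y≤) = sized (s≤s (+-mono-≤ x≤ y≤))

size-double : ∀ a → SizeAtMost (push a a) (⟪ a ⟫ + ⟪ a ⟫)
size-double a = sized (size-push a a)

linear : ∀ c d {x s} → 1 ≤ s → x ≤ c + s * d → x ≤ s * (c + d)
linear c d {x} {s} 1≤s x≤ = begin
  x                ≤⟨ x≤ ⟩
  c + s * d        ≡⟨ cong (_+ s * d) (sym (*-identityˡ c)) ⟩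
  1 * c + s * d    ≤⟨ +-monoˡ-≤ (s * d) (*-monoˡ-≤ c 1≤s) ⟩
  s * c + s * d    ≡⟨ sym (*-distribˡ-+ s c d) ⟩
  s * (c + d)      ∎
  where open ≤-Reasoning

iterate-+ : ∀ f m n x → iterate f (m + n) x ≡ iterate f n (iterate f m x)
iterate-+ f zero    n x = refl
iterate-+ f (suc m) n x = iterate-+ f m n (f x)

size-iterate : ∀ f c → (∀ x → ⟪ f x ⟫ ≤ ⟪ x ⟫ * c) → ∀ j x → ⟪ iterate f j x ⟫ ≤ ⟪ x ⟫ * c ^ j
size-iterate f c f≤ zero    x = ≤-reflexive (sym (*-identityʳ ⟪ x ⟫))
size-iterate f c f≤ (suc j) x = begin
  ⟪ iterate f j (f x) ⟫   ≤⟨ size-iterate f c f≤ j (f x) ⟩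
  ⟪ f x ⟫ * c ^ j         ≤⟨ *-monoˡ-≤ (c ^ j) (f≤ x) ⟩
  ⟪ x ⟫ * c * c ^ j       ≡⟨ *-assoc ⟪ x ⟫ c (c ^ j) ⟩
  ⟪ x ⟫ * c ^ suc j       ∎
  where open ≤-Reasoning

-- A list whose entries are ignored serves as the counter of a loop.
foldᴰ-const : ∀ f s l → foldᴰ (λ _ → f) s l ≡ iterate f (len l) s
foldᴰ-const f s nil     = refl
foldᴰ-const f s (_ ∙ l) = foldᴰ-const f (f s) l

-- Subterms

addSubs : D → D → D
addSubs nil     acc = nil ∙ acc
addSubs (a ∙ b) acc = addSubs b (addSubs a ((a ∙ b) ∙ acc))

subs : D → D
subs x = addSubs x nil

len-addSubs : ∀ x acc → len (addSubs x acc) ≡ ⟪ x ⟫ + len acc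
len-addSubs nil     acc = refl
len-addSubs (a ∙ b) acc = begin
  len (addSubs b (addSubs a ((a ∙ b) ∙ acc)))  ≡⟨ len-addSubs b _ ⟩
  ⟪ b ⟫ + len (addSubs a ((a ∙ b) ∙ acc))      ≡⟨ cong (⟪ b ⟫ +_) (len-addSubs a _) ⟩
  ⟪ b ⟫ + (⟪ a ⟫ + suc (len acc))              ≡⟨ lemma (⟪ a ⟫) (⟪ b ⟫) (len acc) ⟩
  suc (⟪ a ⟫ + ⟪ b ⟫) + len acc                ∎
  where
  open ≡-Reasoning
  lemma : ∀ a b c → b + (a + suc c) ≡ suc (a + b) + c
  lemma = solve-∀

len-subs : ∀ x → len (subs x) ≡ ⟪ x ⟫
len-subs x = trans (len-addSubs x nil) (+-identityʳ _)

∈-addSubsʳ : ∀ x acc {z} → z ∈ᴰ acc → z ∈ᴰ addSubs x acc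
∈-addSubsʳ nil     acc z∈ = there z∈
∈-addSubsʳ (a ∙ b) acc z∈ = ∈-addSubsʳ b _ (∈-addSubsʳ a _ (there z∈))

∈-addSubs-self : ∀ x acc → x ∈ᴰ addSubs x acc
∈-addSubs-self nil     acc = here
∈-addSubs-self (a ∙ b) acc = ∈-addSubsʳ b _ (∈-addSubsʳ a _ here)

-- This includes `nil`, whose head and tail are `nil`. The local truth conditions can therefore
-- refer to the components of any subterm without leaving the set.
∈-subs-closed : ∀ x {z} → z ∈ᴰ subs x → (head z ∈ᴰ subs x) × (tail z ∈ᴰ subs x)
∈-subs-closed x z∈ with go x nil z∈
  where
  go : ∀ x acc {z} → z ∈ᴰ addSubs x acc →
       ((head z ∈ᴰ addSubs x acc) × (tail z ∈ᴰ addSubs x acc)) ⊎ (z ∈ᴰ acc)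
  go nil     acc here       = inj₁ (here , here)
  go nil     acc (there z∈) = inj₂ z∈
  go (a ∙ b) acc z∈ with go b _ z∈
  ... | inj₁ p = inj₁ p
  ... | inj₂ z∈a with go a _ z∈a
  ...   | inj₁ (h , t)    = inj₁ (∈-addSubsʳ b _ h , ∈-addSubsʳ b _ t)
  ...   | inj₂ here       = inj₁ (∈-addSubsʳ b _ (∈-addSubs-self a _) , ∈-addSubs-self b _)
  ...   | inj₂ (there z∈) = inj₂ z∈
... | inj₁ p = p

-- The recursion of `addSubs` is run on an explicit stack of trees still to be visited. Each round
-- disposes of one node, so the stack is empty after `⟪ f e ⟫` rounds; the factor 10 is the sum of
-- the coefficients in `next≤`.
subsᵉ : {f : D → D} → Comp f → Comp (subs ∘ f)
subsᵉ {f} F = comp-≗ (λ e → cong tail (result (f e) nil nil))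
  (tailᵉ ∘ᵉ whileᵉ ((F ∙ᵉ nilᵉ) ∙ᵉ nilᵉ) nextᵉ (λ e → ⟪ f e ⟫) (λ e → ⟪ (f e ∙ nil) ∙ nil ⟫ * 10 ^ ⟪ f e ⟫)
    (size-elem F)
    (elem-* (size-elem ((F ∙ᵉ nilᵉ) ∙ᵉ nilᵉ)) (elem-^ (elem-const 10) (size-elem F)))
    (λ e j j< → nonstop j (f e ∙ nil) nil (≤-trans j< (m≤m+n _ _)))
    (λ e → cong head (result (f e) nil nil))
    (λ e j j≤ → ≤-trans (size-iterate next 10 next≤ j _) (*-monoʳ-≤ ⟪ (f e ∙ nil) ∙ nil ⟫ (^-monoʳ-≤ 10 j≤))))
  where
  top : D → D
  top s = head (head s)

  next : D → D
  next s = ifᴰ (top s) (head (top s) ∙ tail (top s) ∙ tail (head s)) (tail (head s)) ∙ top s ∙ tail s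

  nextᵉ : Comp next
  nextᵉ = ifᵉ t (headᵉ ∘ᵉ t ∙ᵉ tailᵉ ∘ᵉ t ∙ᵉ tailᵉ ∘ᵉ headᵉ) (tailᵉ ∘ᵉ headᵉ) ∙ᵉ t ∙ᵉ tailᵉ
    where t = headᵉ ∘ᵉ headᵉ

  next≤ : ∀ s → ⟪ next s ⟫ ≤ ⟪ s ⟫ * 10
  next≤ s = linear 4 6 1≤⟪ s ⟫ (≤-trans
    (size≤ (size-∙ (size-ifᴰ (top s) (size-∙ (size-head t) (size-∙ (size-tail t) r)) r)
                   (size-∙ t (size-tail size-refl))))
    (≤-reflexive (lemma ⟪ s ⟫)))
    where
    t : SizeAtMost (top s) ⟪ s ⟫
    t = size-head (size-head size-refl)
    r : SizeAtMost (tail (head s)) ⟪ s ⟫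
    r = size-tail (size-head size-refl)
    lemma : ∀ s → suc (suc (s + suc (s + s)) + s + suc (s + s)) ≡ 4 + s * 6
    lemma = solve-∀

  result : ∀ x st acc → iterate next ⟪ x ⟫ ((x ∙ st) ∙ acc) ≡ st ∙ addSubs x acc
  result nil     st acc = refl
  result (a ∙ b) st acc = begin
    iterate next (⟪ a ⟫ + ⟪ b ⟫) ((a ∙ b ∙ st) ∙ (a ∙ b) ∙ acc)
      ≡⟨ iterate-+ next ⟪ a ⟫ ⟪ b ⟫ _ ⟩
    iterate next ⟪ b ⟫ (iterate next ⟪ a ⟫ ((a ∙ b ∙ st) ∙ (a ∙ b) ∙ acc))
      ≡⟨ cong (iterate next ⟪ b ⟫) (result a (b ∙ st) _) ⟩
    iterate next ⟪ b ⟫ ((b ∙ st) ∙ addSubs a ((a ∙ b) ∙ acc))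
      ≡⟨ result b st _ ⟩
    st ∙ addSubs (a ∙ b) acc ∎
    where open ≡-Reasoning

  weight : D → ℕ
  weight nil      = 0
  weight (y ∙ st) = ⟪ y ⟫ + weight st

  nonstop : ∀ j st acc → j < weight st → head (iterate next j (st ∙ acc)) ≢ nil
  nonstop zero    (y ∙ st)         acc j< ()
  nonstop (suc j) (nil ∙ st)       acc (s≤s j<) = nonstop j st _ j<
  nonstop (suc j) ((a ∙ b) ∙ st)   acc (s≤s j<) =
    nonstop j (a ∙ b ∙ st) _ (≤-trans j< (≤-reflexive (+-assoc (⟪ a ⟫) (⟪ b ⟫) (weight st))))

-- Equality

∙-injectiveˡ : ∀ {a b c d} → a ∙ b ≡ c ∙ d → a ≡ c
∙-injectiveˡ refl = refl

∙-injectiveʳ : ∀ {a b c d} → a ∙ b ≡ c ∙ d → b ≡ d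
∙-injectiveʳ refl = refl

-- Both trees are traversed in parallel, with a stack of pairs still to be
-- compared; the machine falls into the state nil at the first difference.
≡ᵉ : {f g : D → D} → Comp f → Comp g → Decider (λ e → f e ≡ g e)
≡ᵉ {f} {g} F G = record
  { test = λ e → foldᴰ (λ _ → compare) (((f e ∙ g e) ∙ nil) ∙ one) (subs (f e))
  -- A successful comparison takes one round per node of `f e`, which is the length of `subs (f e)`.
  ; test-comp = foldᵉ (compareᵉ ∘ᵉ varᵉ 1) (((F ∙ᵉ G) ∙ᵉ nilᵉ) ∙ᵉ constᵉ one) (subsᵉ F)
      (elem-const 17) (λ y a e → compare≤ a)
  ; correct = λ e → subst (λ d → d ≢ nil ⇔ f e ≡ g e) (sym (trans (foldᴰ-const compare _ (subs (f e)))
      (cong (λ n → iterate compare n (((f e ∙ g e) ∙ nil) ∙ one)) (len-subs (f e)))))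
      (verdict (result (f e) (g e) nil))
  }
  where
  p a b r : D → D
  p s = head (head s)
  a s = head (p s)
  b s = tail (p s)
  r s = tail (head s)

  compare : D → D
  compare s = ifᴰ (tail s)
    (ifᴰ (a s)
      (ifᴰ (b s) (((head (a s) ∙ head (b s)) ∙ (tail (a s) ∙ tail (b s)) ∙ r s) ∙ tail s) nil)
      (ifᴰ (b s) nil (r s ∙ tail s)))
    nil

  compareᵉ : Comp compare
  compareᵉ = ifᵉ tailᵉ
    (ifᵉ A
      (ifᵉ B (((headᵉ ∘ᵉ A ∙ᵉ headᵉ ∘ᵉ B) ∙ᵉ (tailᵉ ∘ᵉ A ∙ᵉ tailᵉ ∘ᵉ B) ∙ᵉ R) ∙ᵉ tailᵉ) nilᵉ)
      (ifᵉ B nilᵉ (R ∙ᵉ tailᵉ)))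
    nilᵉ
    where
    A = headᵉ ∘ᵉ headᵉ ∘ᵉ headᵉ
    B = tailᵉ ∘ᵉ headᵉ ∘ᵉ headᵉ
    R = tailᵉ ∘ᵉ headᵉ

  compare≤ : ∀ s → ⟪ compare s ⟫ ≤ ⟪ s ⟫ * 17
  compare≤ s = linear 9 8 1≤⟪ s ⟫ (≤-trans
    (size≤ (size-ifᴰ (tail s)
      (size-ifᴰ (a s)
        (size-ifᴰ (b s)
          (size-∙ (size-∙ (size-∙ (size-head sa) (size-head sb))
                          (size-∙ (size-∙ (size-tail sa) (size-tail sb)) sr)) (size-tail size-refl))
          size-refl)
        (size-ifᴰ (b s) size-refl (size-∙ sr (size-tail size-refl))))
      size-refl))
    (≤-reflexive (lemma ⟪ s ⟫)))
    where
    sa : SizeAtMost (a s) ⟪ s ⟫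
    sa = size-head (size-head (size-head size-refl))
    sb : SizeAtMost (b s) ⟪ s ⟫
    sb = size-tail (size-head (size-head size-refl))
    sr : SizeAtMost (r s) ⟪ s ⟫
    sr = size-tail (size-head size-refl)
    lemma : ∀ s → suc (suc (suc (s + s) + suc (suc (s + s) + s)) + s) + 1 + (1 + suc (s + s)) + 1 ≡ 9 + s * 8
    lemma = solve-∀

  stuck : ∀ n → iterate compare n nil ≡ nil
  stuck zero    = refl
  stuck (suc n) = stuck n

  result : ∀ x y st → (x ≡ y × iterate compare ⟪ x ⟫ (((x ∙ y) ∙ st) ∙ one) ≡ st ∙ one)
                    ⊎ (x ≢ y × iterate compare ⟪ x ⟫ (((x ∙ y) ∙ st) ∙ one) ≡ nil)
  result nil       nil       st = inj₁ (refl , refl)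
  result nil       (_ ∙ _)   st = inj₂ ((λ ()) , refl)
  result (x ∙ x′)  nil       st = inj₂ ((λ ()) , stuck (⟪ x ⟫ + ⟪ x′ ⟫))
  result (x ∙ x′)  (y ∙ y′)  st with result x y ((x′ ∙ y′) ∙ st) | result x′ y′ st
  ... | inj₂ (x≢ , eq) | _ = inj₂ (x≢ ∘ ∙-injectiveˡ ,
    trans (iterate-+ compare ⟪ x ⟫ ⟪ x′ ⟫ _) (trans (cong (iterate compare ⟪ x′ ⟫) eq) (stuck ⟪ x′ ⟫)))
  ... | inj₁ (refl , eq) | inj₁ (refl , eq′) = inj₁ (refl ,
    trans (iterate-+ compare ⟪ x ⟫ ⟪ x′ ⟫ _) (trans (cong (iterate compare ⟪ x′ ⟫) eq) eq′))
  ... | inj₁ (_ , eq) | inj₂ (x′≢ , eq′) = inj₂ (x′≢ ∘ ∙-injectiveʳ ,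
    trans (iterate-+ compare ⟪ x ⟫ ⟪ x′ ⟫ _) (trans (cong (iterate compare ⟪ x′ ⟫) eq) eq′))

  verdict : ∀ {x y st d} → (x ≡ y × d ≡ st ∙ one) ⊎ (x ≢ y × d ≡ nil) → d ≢ nil ⇔ x ≡ y
  verdict (inj₁ (x≡y , refl)) = mk⇔ (λ _ → x≡y) (λ _ ())
  verdict (inj₂ (x≢y , refl)) = mk⇔ (λ t → ⊥-elim (t refl)) (λ x≡y _ → x≢y x≡y)

∈ᵉ : {f l : D → D} → Comp f → Comp l → Decider (λ e → f e ∈ᴰ l e)
∈ᵉ {f} F L = retarget
  (λ e → mk⇔ (λ (y , y∈ , y≡) → subst (_∈ᴰ _) y≡ y∈) (λ z∈ → f e , z∈ , refl))
  (∃ᵉ L (≡ᵉ headᵉ (F ∘ᵉ tailᵉ)))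

-- Sublists, pairs and tuples

size-map-cons : ∀ y r l → ⟪ foldᴰ (λ z a → (y ∙ z) ∙ a) r l ⟫ ≤ ⟪ r ⟫ + ⟪ l ⟫ * (2 + ⟪ y ⟫)
size-map-cons y r nil     = m≤m+n ⟪ r ⟫ _
size-map-cons y r (z ∙ l) = ≤-trans (size-map-cons y _ l) (begin
  suc (suc (⟪ y ⟫ + ⟪ z ⟫) + ⟪ r ⟫) + ⟪ l ⟫ * (2 + ⟪ y ⟫)
    ≤⟨ m≤m+n _ (⟪ z ⟫ * (1 + ⟪ y ⟫)) ⟩
  suc (suc (⟪ y ⟫ + ⟪ z ⟫) + ⟪ r ⟫) + ⟪ l ⟫ * (2 + ⟪ y ⟫) + ⟪ z ⟫ * (1 + ⟪ y ⟫)
    ≡⟨ lemma (⟪ y ⟫) (⟪ z ⟫) (⟪ r ⟫) (⟪ l ⟫) ⟩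
  ⟪ r ⟫ + suc (⟪ z ⟫ + ⟪ l ⟫) * (2 + ⟪ y ⟫) ∎)
  where
  open ≤-Reasoning
  lemma : ∀ y z r l → suc (suc (y + z) + r) + l * (2 + y) + z * (1 + y) ≡ r + suc (z + l) * (2 + y)
  lemma = solve-∀

pow : D → D
pow l = foldᴰ (λ y a → push a (mapᴰ (y ∙_) a)) (nil ∙ nil) l

powᵉ : {l : D → D} → Comp l → Comp (pow ∘ l)
powᵉ L = foldᵉ (pushᵉ (varᵉ 1) (mapᵉ {g = λ e → π 1 e ∙ head e} (varᵉ 1 ∙ᵉ headᵉ) (varᵉ 1)))
  (constᵉ (nil ∙ nil)) L
  (elem-+ (elem-const 4) elem-size) growth
  where
  open ≤-Reasoning
  growth : ∀ y a e → ⟪ push a (mapᴰ (y ∙_) a) ⟫ ≤ ⟪ a ⟫ * (4 + ⟪ y ∙ e ⟫)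
  growth y a e = linear 1 (3 + ⟪ y ∙ e ⟫) 1≤⟪ a ⟫ (begin
    ⟪ push a (mapᴰ (y ∙_) a) ⟫                ≤⟨ size-push a _ ⟩
    ⟪ a ⟫ + ⟪ mapᴰ (y ∙_) a ⟫                 ≤⟨ +-monoʳ-≤ ⟪ a ⟫ (size-map-cons y nil a) ⟩
    ⟪ a ⟫ + (1 + ⟪ a ⟫ * (2 + ⟪ y ⟫))         ≡⟨ lemma (⟪ a ⟫) (⟪ y ⟫) ⟩
    1 + ⟪ a ⟫ * (3 + ⟪ y ⟫)                   ≤⟨ s≤s (*-monoʳ-≤ ⟪ a ⟫ (+-monoʳ-≤ 3
                                                   (≤-trans (m≤m+n ⟪ y ⟫ ⟪ e ⟫) (m≤n⇒m≤1+n ≤-refl)))) ⟩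
    1 + ⟪ a ⟫ * (3 + ⟪ y ∙ e ⟫)               ∎)
    where
    lemma : ∀ a y → a + (1 + a * (2 + y)) ≡ 1 + a * (3 + y)
    lemma = solve-∀

-- Both folds prepend the retained entries from left to right, so the accumulator of `select` is at
-- every stage a member of that of `pow`: the very list occurs there, not merely one with the same
-- elements.
select∈pow : ∀ b l → select b nil l ∈ᴰ pow l
select∈pow b l = go nil (nil ∙ nil) l here
  where
  go : ∀ a A l → a ∈ᴰ A → select b a l ∈ᴰ foldᴰ (λ y a → push a (mapᴰ (y ∙_) a)) A l
  go a A nil     a∈ = a∈
  go a A (y ∙ l) a∈ with b y
  ... | nil   = go a _ l (∈-pushˡ _ a∈)
  ... | _ ∙ _ = go (y ∙ a) _ l (∈-pushʳ A (∈-map (y ∙_) a∈))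

filt∈pow : {P : D → Set} (p : Decider P) → ∀ e l → filt p e l ∈ᴰ pow l
filt∈pow p e l = select∈pow _ l

pairs : D → D → D
pairs l m = concatMapᴰ (λ a → mapᴰ (a ∙_) m) l

pairsᵉ : {l m : D → D} → Comp l → Comp m → Comp (λ e → pairs (l e) (m e))
pairsᵉ {l} {m} L M = concatMapᵉ {g = λ e → mapᴰ (head e ∙_) (m (tail e))}
  (mapᵉ {g = λ e → π 1 e ∙ head e} (varᵉ 1 ∙ᵉ headᵉ) (M ∘ᵉ tailᵉ)) L

∈-pairs : ∀ {l m a b} → a ∈ᴰ l → b ∈ᴰ m → a ∙ b ∈ᴰ pairs l m
∈-pairs {l} {m} {a} a∈ b∈ = ∈-concatMap (λ a → mapᴰ (a ∙_) m) a∈ (∈-map (a ∙_) b∈)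

∈-pairs⁻ : ∀ {l m z} → z ∈ᴰ pairs l m → Some l (λ a → Some m (λ b → z ≡ a ∙ b))
∈-pairs⁻ {l} {m} z∈ with ∈-concatMap⁻ (λ a → mapᴰ (a ∙_) m) l z∈
... | a , a∈ , z∈′ = a , a∈ , ∈-map⁻ (a ∙_) m z∈′

tuples : ℕ → D → D
tuples zero    l = nil ∙ nil
tuples (suc k) l = pairs l (tuples k l)

tuplesᵉ : ∀ k {l : D → D} → Comp l → Comp (λ e → tuples k (l e))
tuplesᵉ zero    L = constᵉ (nil ∙ nil)
tuplesᵉ (suc k) L = pairsᵉ L (tuplesᵉ k L)

tabulateᴰ : ∀ {k} → (Fin k → D) → D
tabulateᴰ {zero}  f = nil
tabulateᴰ {suc k} f = f zero ∙ tabulateᴰ (f ∘ suc)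

tabulateᴰ-cong : ∀ {k} {f g : Fin k → D} → (∀ c → f c ≡ g c) → tabulateᴰ f ≡ tabulateᴰ g
tabulateᴰ-cong {zero}  eq = refl
tabulateᴰ-cong {suc k} eq = cong₂ _∙_ (eq zero) (tabulateᴰ-cong (eq ∘ suc))

∈-tuples : ∀ {k} {f : Fin k → D} {l} → (∀ c → f c ∈ᴰ l) → tabulateᴰ f ∈ᴰ tuples k l
∈-tuples {zero}  f∈ = here
∈-tuples {suc k} {l = l} f∈ = ∈-pairs {l} {tuples k l} (f∈ zero) (∈-tuples (f∈ ∘ suc))

∈-tuples⁻ : ∀ k {l t} → t ∈ᴰ tuples k l → Σ[ f ∈ (Fin k → D) ] (∀ c → f c ∈ᴰ l) × t ≡ tabulateᴰ f
∈-tuples⁻ zero    here = (λ ()) , (λ ()) , refl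
∈-tuples⁻ (suc k) {l} t∈ with ∈-pairs⁻ {l} {tuples k l} t∈
... | a , a∈ , b , b∈ , refl with ∈-tuples⁻ k b∈
...   | f , f∈ , refl = (λ { zero → a ; (suc c) → f c }) , (λ { zero → a∈ ; (suc c) → f∈ c }) , refl

-- Numerals and bit lists

push-unary : ∀ m n → push (unary m) (unary n) ≡ unary (m + n)
push-unary zero    n = refl
push-unary (suc m) n = trans (push-unary m (suc n)) (cong unary (+-suc m n))

value : D → ℕ
value nil           = 0
value (nil ∙ b)     = 2 + (value b + value b)
value ((_ ∙ _) ∙ b) = 1 + (value b + value b)

-- Horner's scheme: the digits are stored with the least significant one first and are therefore
-- reversed, and `push a a` doubles.
unaryOf : D → D
unaryOf b = foldᴰ (λ y a → ifᴰ y (nil ∙ push a a) (nil ∙ nil ∙ push a a)) nil (push b nil)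

unaryOf≡ : ∀ b → unaryOf b ≡ unary (value b)
unaryOf≡ b = go b nil
  where
  go : ∀ b l → foldᴰ (λ y a → ifᴰ y (nil ∙ push a a) (nil ∙ nil ∙ push a a)) nil (push b l) ≡
               foldᴰ (λ y a → ifᴰ y (nil ∙ push a a) (nil ∙ nil ∙ push a a)) (unary (value b)) l
  go nil           l = refl
  go (nil ∙ b)     l rewrite go b (nil ∙ l) | push-unary (value b) (value b) = refl
  go ((c ∙ d) ∙ b) l rewrite go b ((c ∙ d) ∙ l) | push-unary (value b) (value b) = refl

unaryOfᵉ : {f : D → D} → Comp f → Comp (unaryOf ∘ f)
unaryOfᵉ F = foldᵉ
  (ifᵉ headᵉ (nilᵉ ∙ᵉ pushᵉ (varᵉ 1) (varᵉ 1)) (nilᵉ ∙ᵉ nilᵉ ∙ᵉ pushᵉ (varᵉ 1) (varᵉ 1)))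
  nilᵉ (pushᵉ F nilᵉ) (elem-const 10)
  (λ y a e → linear 6 4 1≤⟪ a ⟫ (≤-trans
    (size≤ (size-ifᴰ y (size-∙ size-refl (size-double a))
                       (size-∙ size-refl (size-∙ size-refl (size-double a)))))
    (≤-reflexive (lemma ⟪ a ⟫))))
  where
  lemma : ∀ a → suc (1 + (a + a)) + suc (1 + suc (1 + (a + a))) ≡ 6 + a * 4
  lemma = solve-∀

len-unary : ∀ n → len (unary n) ≡ n
len-unary zero    = refl
len-unary (suc n) = cong suc (len-unary n)

-- Beyond the end of the list, the entries are false.
Nth : D → ℕ → Set
Nth l n = head (iterate tail n l) ≢ nil

nthᵉ : {l f : D → D} → Comp l → Comp f → Decider (λ e → Nth (l e) (value (f e)))
nthᵉ {l} {f} L F = retarget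
  (λ e → subst (λ d → head d ≢ nil ⇔ Nth (l e) (value (f e)))
           (sym (trans (foldᴰ-const tail (l e) (unaryOf (f e)))
                       (cong (λ n → iterate tail n (l e))
                             (trans (cong len (unaryOf≡ (f e))) (len-unary (value (f e)))))))
           (mk⇔ id id))
  (nonnilᵉ (headᵉ ∘ᵉ foldᵉ⁺ (tailᵉ ∘ᵉ varᵉ 1) L (unaryOfᵉ F) (elem-const 0)
    (λ y a e → ≤-trans (size-tail≤ a) (m≤m+n ⟪ a ⟫ 0))))

data Bits : ℕ → D → Set where
  []   : Bits 0 nil
  off∷ : ∀ {n b} → Bits n b → Bits (suc n) (nil ∙ b)
  on∷  : ∀ {n b} → Bits n b → Bits (suc n) (one ∙ b)

bitLists : D → D
bitLists c = foldᴰ (λ _ a → push (mapᴰ (nil ∙_) a) (mapᴰ (one ∙_) a)) (nil ∙ nil) c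

bitListsᵉ : {c : D → D} → Comp c → Comp (bitLists ∘ c)
bitListsᵉ C = foldᵉ
  (pushᵉ (mapᵉ {g = λ e → nil ∙ head e} (nilᵉ ∙ᵉ headᵉ) (varᵉ 1))
         (mapᵉ {g = λ e → one ∙ head e} (constᵉ one ∙ᵉ headᵉ) (varᵉ 1)))
  (constᵉ (nil ∙ nil)) C (elem-const 10)
  (λ y a e → linear 2 8 1≤⟪ a ⟫ (≤-trans (size-push (mapᴰ (nil ∙_) a) _)
    (≤-trans (+-mono-≤ (size-map-cons nil nil a) (size-map-cons one nil a)) (≤-reflexive (lemma ⟪ a ⟫)))))
  where
  lemma : ∀ a → 1 + a * 3 + (1 + a * 5) ≡ 2 + a * 8
  lemma = solve-∀

∈-bitLists⇔ : ∀ c {b} → b ∈ᴰ bitLists c ⇔ Bits (len c) b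
∈-bitLists⇔ c {b} = subst (λ n → b ∈ᴰ bitLists c ⇔ Bits n b) (+-identityʳ (len c))
  (go c 0 (nil ∙ nil) (λ b → mk⇔ (λ { here → [] }) (λ { [] → here })) b)
  where
  go : ∀ c n A → (∀ b → b ∈ᴰ A ⇔ Bits n b) → ∀ b →
       b ∈ᴰ foldᴰ (λ _ a → push (mapᴰ (nil ∙_) a) (mapᴰ (one ∙_) a)) A c ⇔ Bits (len c + n) b
  go nil     n A A⇔ b = A⇔ b
  go (_ ∙ c) n A A⇔ b = subst (λ m → b ∈ᴰ bitLists′ ⇔ Bits m b) (+-suc (len c) n)
    (go c (suc n) _ (λ b → mk⇔ (forth b) (back b)) b)
    where
    bitLists′ : D
    bitLists′ = foldᴰ (λ _ a → push (mapᴰ (nil ∙_) a) (mapᴰ (one ∙_) a)) A (nil ∙ c)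

    forth : ∀ b → b ∈ᴰ push (mapᴰ (nil ∙_) A) (mapᴰ (one ∙_) A) → Bits (suc n) b
    forth b b∈ with ∈-push⁻ (mapᴰ (nil ∙_) A) b∈
    ... | inj₁ b∈′ with ∈-map⁻ _ A b∈′
    ...   | _ , z∈ , refl = off∷ (to (A⇔ _) z∈)
    forth b b∈ | inj₂ b∈′ with ∈-map⁻ _ A b∈′
    ...   | _ , z∈ , refl = on∷ (to (A⇔ _) z∈)

    back : ∀ b → Bits (suc n) b → b ∈ᴰ push (mapᴰ (nil ∙_) A) (mapᴰ (one ∙_) A)
    back _ (off∷ bs) = ∈-pushˡ _ (∈-map _ (from (A⇔ _) bs))
    back _ (on∷ bs)  = ∈-pushʳ (mapᴰ (nil ∙_) A) (∈-map _ (from (A⇔ _) bs))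

-- Quantifier prefixes: both encodeᵗ and encodeEQLTL mark a quantifier by
-- unary 1 and the end of the prefix by unary 0.

prefix : D → D → D
prefix c nil           = c
prefix c (nil ∙ d)     = c
prefix c ((_ ∙ _) ∙ d) = prefix (nil ∙ c) d

matrix : D → D
matrix nil           = nil
matrix (nil ∙ d)     = d
matrix ((_ ∙ _) ∙ d) = matrix d

-- The quantifier prefix is no longer than the right spine of `d`, so `d` itself can count the
-- rounds; once the end mark is reached, the state no longer changes.
strip : D → D
strip d = foldᴰ (λ _ a → ifᴰ (head (tail a)) ((nil ∙ head a) ∙ tail (tail a)) a) (nil ∙ d) d

stripᵉ : {f : D → D} → Comp f → Comp (strip ∘ f)
stripᵉ F = foldᵉ (ifᵉ (headᵉ ∘ᵉ tailᵉ ∘ᵉ a) ((nilᵉ ∙ᵉ headᵉ ∘ᵉ a) ∙ᵉ tailᵉ ∘ᵉ tailᵉ ∘ᵉ a) a)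
  (nilᵉ ∙ᵉ F) F (elem-const 6)
  (λ y a e → linear 3 3 1≤⟪ a ⟫ (≤-trans
    (size≤ (size-ifᴰ (head (tail a))
      (size-∙ (size-∙ size-refl (size-head {a} size-refl)) (size-tail (size-tail {a} size-refl))) size-refl))
    (≤-reflexive (lemma ⟪ a ⟫))))
  where
  a = varᵉ 1
  lemma : ∀ a → suc (suc (1 + a) + a) + a ≡ 3 + a * 3
  lemma = solve-∀

strip≡ : ∀ d → head (strip d) ≡ prefix nil d × tail (tail (strip d)) ≡ matrix d
strip≡ d = go d nil
  where
  f : D → D
  f a = ifᴰ (head (tail a)) ((nil ∙ head a) ∙ tail (tail a)) a

  stay : ∀ l c d → foldᴰ (λ _ → f) (c ∙ nil ∙ d) l ≡ c ∙ nil ∙ d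
  stay nil     c d = refl
  stay (_ ∙ l) c d = stay l c d

  go : ∀ d c → head (foldᴰ (λ _ → f) (c ∙ d) d) ≡ prefix c d ×
               tail (tail (foldᴰ (λ _ → f) (c ∙ d) d)) ≡ matrix d
  go nil           c = refl , refl
  go (nil ∙ d)     c rewrite stay d c d = refl , refl
  go ((_ ∙ _) ∙ d) c = go d (nil ∙ c)

prefixᵉ : {f : D → D} → Comp f → Comp (prefix nil ∘ f)
prefixᵉ {f} F = comp-≗ (λ e → proj₁ (strip≡ (f e))) (headᵉ ∘ᵉ stripᵉ F)

matrixᵉ : {f : D → D} → Comp f → Comp (matrix ∘ f)
matrixᵉ {f} F = comp-≗ (λ e → proj₂ (strip≡ (f e))) (tailᵉ ∘ᵉ tailᵉ ∘ᵉ stripᵉ F)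

⊤ᵉ : Decider (λ _ → ⊤)
⊤ᵉ = record { test = λ _ → one ; test-comp = constᵉ one ; correct = λ _ → mk⇔ _ (λ _ ()) }

infixr 4 _⇒ᵉ_
_⇒ᵉ_ : {P Q : D → Set} → Decider P → Decider Q → Decider (λ e → P e → Q e)
p ⇒ᵉ q = retarget (λ e → mk⇔ (λ { (inj₁ ¬pe) pe → ⊥-elim (¬pe pe) ; (inj₂ qe) _ → qe })
                             (λ f → case Decider.decide p e of λ { (yes pe) → inj₂ (f pe) ; (no ¬pe) → inj₁ ¬pe }))
         (¬ᵉ p ⊎ᵉ q)

-- The decision procedure

-- A path element is one ∙ d and a state element nil ∙ d, where d is a subterm
-- of the input, read as the code of a path formula or of a state formula.
elements : D → D
elements x = push (mapᴰ (nil ∙_) (subs x)) (mapᴰ (one ∙_) (subs x))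

elementsᵉ : {f : D → D} → Comp f → Comp (elements ∘ f)
elementsᵉ F = pushᵉ (mapᵉ {g = λ e → nil ∙ head e} (nilᵉ ∙ᵉ headᵉ) (subsᵉ F))
                    (mapᵉ {g = λ e → one ∙ head e} (constᵉ one ∙ᵉ headᵉ) (subsᵉ F))

-- The first move of a path: nil if the path ends, and otherwise
-- (nil ∙ unary c) ∙ v, where c is the direction and v the set of elements true
-- on the rest of the path.
IsStep : D → Set
IsStep m = head m ≢ nil

-- Local truth conditions at a node labelled lab, for a path with first move
-- m; Q is truth on this path, and E and A truth on some and on all paths.
module _ (lab m : D) (Q E A : D → Set) where

  LocalState : D → Set
  LocalState d = Switch (head d)
    ( Nth lab (value (tail d))
    ∷ (¬ Q (nil ∙ tail d))
    ∷ (Q (nil ∙ head (tail d)) × Q (nil ∙ tail (tail d)))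
    ∷ E (one ∙ tail d)
    ∷ A (one ∙ tail d)
    ∷ [])

  LocalPath : D → Set
  LocalPath d = Switch (head d)
    ( Q (nil ∙ tail d)
    ∷ (¬ Q (one ∙ tail d))
    ∷ (Q (one ∙ head (tail d)) × Q (one ∙ tail (tail d)))
    ∷ (Q (one ∙ tail (tail d)) ⊎ (Q (one ∙ head (tail d)) × IsStep m × one ∙ d ∈ᴰ tail m))
    ∷ (IsStep m × one ∙ tail d ∈ᴰ tail m)
    ∷ (IsStep m × tail (head m) ≡ head (tail d) × one ∙ tail (tail d) ∈ᴰ tail m)
    ∷ [])

  Local : D → Set
  Local u = Switch (head u) (LocalState (tail u) ∷ LocalPath (tail u) ∷ [])

-- Θ collects the truth sets v of all paths from a node.
SomeIn AllIn : D → D → Set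
SomeIn Θ u = Some Θ (u ∈ᴰ_)
AllIn  Θ u = All Θ (u ∈ᴰ_)

localᵉ : Decider (λ e → Local (π 3 e) (π 4 e) (_∈ᴰ π 1 e) (SomeIn (π 2 e)) (AllIn (π 2 e)) (π 0 e))
localᵉ = switchᵉ (headᵉ ∘ᵉ u)
  ( switchᵉ (headᵉ ∘ᵉ d)
      ( nthᵉ (varᵉ 3) (tailᵉ ∘ᵉ d)
      ∷ᵉ ¬ᵉ ∈ᵉ (state∙ (tailᵉ ∘ᵉ d)) v
      ∷ᵉ ∈ᵉ (state∙ (headᵉ ∘ᵉ tailᵉ ∘ᵉ d)) v ×ᵉ ∈ᵉ (state∙ (tailᵉ ∘ᵉ tailᵉ ∘ᵉ d)) v
      ∷ᵉ ∃ᵉ (varᵉ 2) (∈ᵉ (path∙ (tailᵉ ∘ᵉ tailᵉ ∘ᵉ varᵉ 1)) headᵉ)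
      ∷ᵉ ∀ᵉ (varᵉ 2) (∈ᵉ (path∙ (tailᵉ ∘ᵉ tailᵉ ∘ᵉ varᵉ 1)) headᵉ)
      ∷ᵉ []ᵉ)
  ∷ᵉ switchᵉ (headᵉ ∘ᵉ d)
      ( ∈ᵉ (state∙ (tailᵉ ∘ᵉ d)) v
      ∷ᵉ ¬ᵉ ∈ᵉ (path∙ (tailᵉ ∘ᵉ d)) v
      ∷ᵉ ∈ᵉ (path∙ (headᵉ ∘ᵉ tailᵉ ∘ᵉ d)) v ×ᵉ ∈ᵉ (path∙ (tailᵉ ∘ᵉ tailᵉ ∘ᵉ d)) v
      ∷ᵉ (∈ᵉ (path∙ (tailᵉ ∘ᵉ tailᵉ ∘ᵉ d)) v ⊎ᵉ
          ∈ᵉ (path∙ (headᵉ ∘ᵉ tailᵉ ∘ᵉ d)) v ×ᵉ stepᵉ ×ᵉ ∈ᵉ (path∙ d) (tailᵉ ∘ᵉ varᵉ 4))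
      ∷ᵉ stepᵉ ×ᵉ ∈ᵉ (path∙ (tailᵉ ∘ᵉ d)) (tailᵉ ∘ᵉ varᵉ 4)
      ∷ᵉ stepᵉ ×ᵉ ≡ᵉ (tailᵉ ∘ᵉ headᵉ ∘ᵉ varᵉ 4) (headᵉ ∘ᵉ tailᵉ ∘ᵉ d) ×ᵉ
         ∈ᵉ (path∙ (tailᵉ ∘ᵉ tailᵉ ∘ᵉ d)) (tailᵉ ∘ᵉ varᵉ 4)
      ∷ᵉ []ᵉ)
  ∷ᵉ []ᵉ)
  where
  u = varᵉ 0
  d = tailᵉ ∘ᵉ varᵉ 0
  v = varᵉ 1
  state∙ : {f : D → D} → Comp f → Comp (λ e → nil ∙ f e)
  state∙ F = nilᵉ ∙ᵉ F
  path∙ : {f : D → D} → Comp f → Comp (λ e → one ∙ f e)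
  path∙ F = constᵉ one ∙ᵉ F
  stepᵉ : Decider (λ e → IsStep (π 4 e))
  stepᵉ = nonnilᵉ (headᵉ ∘ᵉ varᵉ 4)

-- An equation for `v` in place of a recursion on formulas. Apart from the references to `Θ` and to
-- the move, membership of an element depends only on elements with smaller codes, or on the state
-- element of the same code when `nil` is read as a path formula.
Consistent : D → D → D → D → D → Set
Consistent v m Θ lab x = v ≡ filt localᵉ (v ∙ Θ ∙ lab ∙ m ∙ x ∙ nil) (elements x)

consistentᵉ : {v m Θ lab x : D → D} → Comp v → Comp m → Comp Θ → Comp lab → Comp x →
              Decider (λ e → Consistent (v e) (m e) (Θ e) (lab e) (x e))
consistentᵉ cv cm cΘ cl cx =
  ≡ᵉ cv (filtᵉ localᵉ (elementsᵉ (varᵉ 4)) ∘ᵉ (cv ∙ᵉ cΘ ∙ᵉ cl ∙ᵉ cm ∙ᵉ cx ∙ᵉ nilᵉ))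

module Procedure (k′ : ℕ) where

  k : ℕ
  k = suc k′

  -- A son is nil if absent, and otherwise one ∙ y with y its type.
  anySon : ℕ → D → D
  anySon zero    θ = nil
  anySon (suc j) θ = ifᴰ (head θ) one (anySon j (tail θ))

  anySonᵉ : ∀ j {f : D → D} → Comp f → Comp (anySon j ∘ f)
  anySonᵉ zero    F = nilᵉ
  anySonᵉ (suc j) F = ifᵉ (headᵉ ∘ᵉ F) (constᵉ one) (anySonᵉ j (tailᵉ ∘ᵉ F))

  movesFrom : ℕ → ℕ → D → D
  movesFrom zero    c θ = nil
  movesFrom (suc j) c θ =
    push (ifᴰ (head θ) (mapᴰ ((nil ∙ unary c) ∙_) (tail (head θ))) nil) (movesFrom j (suc c) (tail θ))

  movesFromᵉ : ∀ j c {f : D → D} → Comp f → Comp (movesFrom j c ∘ f)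
  movesFromᵉ zero    c F = nilᵉ
  movesFromᵉ (suc j) c F =
    pushᵉ (ifᵉ (headᵉ ∘ᵉ F) (mapᵉ {g = λ e → (nil ∙ unary c) ∙ head e} (constᵉ (nil ∙ unary c) ∙ᵉ headᵉ) (tailᵉ ∘ᵉ headᵉ ∘ᵉ F)) nilᵉ)
          (movesFromᵉ j (suc c) (tailᵉ ∘ᵉ F))

  -- A node without sons has exactly one path, which ends there. Its move is `nil`, so the list of
  -- moves is then a singleton and not empty.
  moves : D → D
  moves θ = ifᴰ (anySon k θ) (movesFrom k 0 θ) (nil ∙ nil)

  movesᵉ : {f : D → D} → Comp f → Comp (moves ∘ f)
  movesᵉ F = ifᵉ (anySonᵉ k F) (movesFromᵉ k 0 F) (constᵉ (nil ∙ nil))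

  -- The condition that Θ is the set of truth sets of the paths from a node
  -- labelled lab, if θ lists those of its sons.  It is an equation for Θ, since
  -- the truth of E and A formulas at the node depends on Θ itself.
  someMoveᵉ : Decider (λ e → Some (moves (π 3 e)) λ m → Consistent (π 0 e) m (π 1 e) (π 2 e) (π 4 e))
  someMoveᵉ = ∃ᵉ (movesᵉ (varᵉ 3)) (consistentᵉ (varᵉ 1) (varᵉ 0) (varᵉ 2) (varᵉ 3) (varᵉ 5))

  pathSets : D → D
  pathSets x = pow (elements x)

  pathSetsᵉ : {f : D → D} → Comp f → Comp (pathSets ∘ f)
  pathSetsᵉ F = powᵉ (elementsᵉ F)

  IsTruth : D → D → D → D → Set
  IsTruth Θ lab θ x =
    Θ ≡ filt someMoveᵉ (Θ ∙ lab ∙ θ ∙ x ∙ nil) (pathSets x) ×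
    All (moves θ) λ m → Some Θ λ v → Consistent v m Θ lab x

  isTruthᵉ : Decider (λ e → IsTruth (π 0 e) (π 1 e) (π 2 e) (π 3 e))
  isTruthᵉ =
    ≡ᵉ headᵉ (filtᵉ someMoveᵉ (pathSetsᵉ (varᵉ 3)) ∘ᵉ (varᵉ 0 ∙ᵉ varᵉ 1 ∙ᵉ varᵉ 2 ∙ᵉ varᵉ 3 ∙ᵉ nilᵉ)) ×ᵉ
    ∀ᵉ (movesᵉ (varᵉ 2))
      (∃ᵉ (varᵉ 1) (consistentᵉ (varᵉ 0) (varᵉ 1) (varᵉ 2) (varᵉ 3) (varᵉ 5)))

  -- The type of a tree is a set of pairs α ∙ Θ, where α is the code of an EQCTL*
  -- formula and Θ the set of truth sets for some labelling by the letters
  -- quantified in α.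
  Match : ℕ → D → D → D → Set
  Match zero    α σ θ = ⊤
  Match (suc j) α σ θ =
    (head σ ≡ nil × head θ ≡ nil ⊎ head σ ≢ nil × head θ ≢ nil × α ∙ tail (head θ) ∈ᴰ tail (head σ)) ×
    Match j α (tail σ) (tail θ)

  matchᵉ : ∀ j {α σ θ : D → D} → Comp α → Comp σ → Comp θ → Decider (λ e → Match j (α e) (σ e) (θ e))
  matchᵉ zero    a s t = ⊤ᵉ
  matchᵉ (suc j) a s t =
    (≡ᵉ (headᵉ ∘ᵉ s) nilᵉ ×ᵉ ≡ᵉ (headᵉ ∘ᵉ t) nilᵉ ⊎ᵉ
     nonnilᵉ (headᵉ ∘ᵉ s) ×ᵉ nonnilᵉ (headᵉ ∘ᵉ t) ×ᵉ ∈ᵉ (a ∙ᵉ tailᵉ ∘ᵉ headᵉ ∘ᵉ t) (tailᵉ ∘ᵉ headᵉ ∘ᵉ s)) ×ᵉ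
    matchᵉ j a (tailᵉ ∘ᵉ s) (tailᵉ ∘ᵉ t)

  truthSets : D → D
  truthSets x = pow (pathSets x)

  truthSetsᵉ : {f : D → D} → Comp f → Comp (truthSets ∘ f)
  truthSetsᵉ F = powᵉ (pathSetsᵉ F)

  sonOptions : D → D
  sonOptions x = nil ∙ mapᴰ (one ∙_) (truthSets x)

  typePairs : D → D
  typePairs x = pairs (subs x) (truthSets x)

  types : D → D
  types x = pow (typePairs x)

  typesᵉ : {f : D → D} → Comp f → Comp (types ∘ f)
  typesᵉ F = powᵉ (pairsᵉ (subsᵉ F) (truthSetsᵉ F))

  -- A labelling by the quantified letters consists of independent choices at the root and in the
  -- subtrees of the sons. Hence `θ` may combine arbitrary members of the types of the sons,
  -- provided that they belong to the same `α`.
  TypePair : D → D → D → D → D → Set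
  TypePair α Θ lab σ x =
    Some (bitLists (prefix nil α)) λ b → Some (tuples k (sonOptions x)) λ θ →
      Match k α σ θ × IsTruth Θ (push b lab) θ x

  typePairᵉ : Decider (λ e → TypePair (head (π 0 e)) (tail (π 0 e)) (π 1 e) (π 2 e) (π 3 e))
  typePairᵉ =
    ∃ᵉ (bitListsᵉ (prefixᵉ (headᵉ ∘ᵉ varᵉ 0)))
      (∃ᵉ (tuplesᵉ k (nilᵉ ∙ᵉ mapᵉ {g = λ e → one ∙ head e} (constᵉ one ∙ᵉ headᵉ) (truthSetsᵉ (varᵉ 4))))
        (matchᵉ k (headᵉ ∘ᵉ varᵉ 2) (varᵉ 4) (varᵉ 0) ×ᵉ
         isTruthᵉ $ᵉ (tailᵉ ∘ᵉ varᵉ 2 ∙ᵉ pushᵉ (varᵉ 1) (varᵉ 3) ∙ᵉ varᵉ 0 ∙ᵉ varᵉ 5 ∙ᵉ nilᵉ)))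

  opaque
    typeOf : D → D → D → D
    typeOf lab σ x = filt typePairᵉ (lab ∙ σ ∙ x ∙ nil) (typePairs x)

    typeOfᵉ : {lab σ x : D → D} → Comp lab → Comp σ → Comp x →
              Comp (λ e → typeOf (lab e) (σ e) (x e))
    typeOfᵉ L S F = filtᵉ typePairᵉ (pairsᵉ (subsᵉ (varᵉ 2)) (truthSetsᵉ (varᵉ 2))) ∘ᵉ (L ∙ᵉ S ∙ᵉ F ∙ᵉ nilᵉ)

  -- The encoded input does not contain the number of letters. The length of this list exceeds
  -- `value d` for every subterm `d`, hence every letter that occurs, so labels can be cut to this
  -- length.
  letterCount : D → D
  letterCount x = concatMapᴰ (λ d → nil ∙ unaryOf d) (subs x)

  reachableᵉ : Decider (λ e → Some (bitLists (letterCount (π 2 e))) λ lab → Some (π 1 e) λ σ →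
                              π 0 e ≡ typeOf lab σ (π 2 e))
  reachableᵉ =
    ∃ᵉ (bitListsᵉ (concatMapᵉ {g = λ e → nil ∙ unaryOf (head e)} (nilᵉ ∙ᵉ unaryOfᵉ headᵉ) (subsᵉ (varᵉ 2))))
      (∃ᵉ (varᵉ 2) (≡ᵉ (varᵉ 2) (typeOfᵉ (varᵉ 1) (varᵉ 0) (varᵉ 4))))

  -- The types of the trees whose sons have types in one of the tuples of l.
  opaque
    typesOver : D → D → D
    typesOver l x = filt reachableᵉ (l ∙ x ∙ nil) (types x)

    typesOverᵉ : {l x : D → D} → Comp l → Comp x → Comp (λ e → typesOver (l e) (x e))
    typesOverᵉ L F = filtᵉ reachableᵉ (typesᵉ (varᵉ 1)) ∘ᵉ (L ∙ᵉ F ∙ᵉ nilᵉ)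

  leafSons : D
  leafSons = tabulateᴰ {k} (λ _ → nil) ∙ nil

  fullSons almostSons : D → D
  fullSons   S = tuples k (mapᴰ (one ∙_) S)
  almostSons S = mapᴰ (nil ∙_) (tuples k′ (mapᴰ (one ∙_) S))

  someᵉ : {f : D → D} → Comp f → Comp (λ e → mapᴰ (one ∙_) (f e))
  someᵉ = mapᵉ {g = λ e → one ∙ head e} (constᵉ one ∙ᵉ headᵉ)

  -- The linear part.  A stage is a triple S ∙ T ∙ p: the types S of the complete
  -- trees of some height i, the type T of g(i), and the set p of the subterms
  -- that are, read as codes of PLTL formulas, true at i.
  module _ (Q Q′ : D → Set) (T : D) where

    LocalLinear : D → Set
    LocalLinear u = Switch (head u)
      ( Switch (head (tail u))
          -- A letter bound by an outer quantifier is subject to no condition: the stage guesses its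
          -- truth value.
          ( Q u
          ∷ Some T (λ w → head w ≡ tail (tail u) × Some (tail w) (nil ∙ matrix (tail (tail u)) ∈ᴰ_))
          ∷ [])
      ∷ (¬ Q (tail u))
      ∷ (Q (head (tail u)) × Q (tail (tail u)))
      ∷ Q′ (tail u)
      ∷ (Q (tail (tail u)) ⊎ (Q (head (tail u)) × Q′ u))
      ∷ [])

  localLinearᵉ : Decider (λ e → LocalLinear (_∈ᴰ π 1 e) (_∈ᴰ π 2 e) (π 3 e) (π 0 e))
  localLinearᵉ = switchᵉ (headᵉ ∘ᵉ u)
    ( switchᵉ (headᵉ ∘ᵉ tailᵉ ∘ᵉ u)
        ( ∈ᵉ u p
        ∷ᵉ ∃ᵉ (varᵉ 3) (≡ᵉ (headᵉ ∘ᵉ varᵉ 0) (tailᵉ ∘ᵉ tailᵉ ∘ᵉ varᵉ 1) ×ᵉ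
             ∃ᵉ (tailᵉ ∘ᵉ varᵉ 0) (∈ᵉ (nilᵉ ∙ᵉ matrixᵉ (tailᵉ ∘ᵉ tailᵉ ∘ᵉ varᵉ 2)) (varᵉ 0)))
        ∷ᵉ []ᵉ)
    ∷ᵉ ¬ᵉ ∈ᵉ (tailᵉ ∘ᵉ u) p
    ∷ᵉ ∈ᵉ (headᵉ ∘ᵉ tailᵉ ∘ᵉ u) p ×ᵉ ∈ᵉ (tailᵉ ∘ᵉ tailᵉ ∘ᵉ u) p
    ∷ᵉ ∈ᵉ (tailᵉ ∘ᵉ u) p′
    ∷ᵉ (∈ᵉ (tailᵉ ∘ᵉ tailᵉ ∘ᵉ u) p ⊎ᵉ (∈ᵉ (headᵉ ∘ᵉ tailᵉ ∘ᵉ u) p ×ᵉ ∈ᵉ u p′))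
    ∷ᵉ []ᵉ)
    where
    u  = varᵉ 0
    p  = varᵉ 1
    p′ = varᵉ 2

  opaque
    -- The codes in subs x that are true at an instant with tree type T, if p is the
    -- set of those and p′ the corresponding set at the next instant.
    linearSet : D → D → D → D → D
    linearSet p p′ T x = filt localLinearᵉ (p ∙ p′ ∙ T ∙ x ∙ nil) (subs x)

    linearSetᵉ : {p p′ T x : D → D} → Comp p → Comp p′ → Comp T → Comp x →
                 Comp (λ e → linearSet (p e) (p′ e) (T e) (x e))
    linearSetᵉ cp cp′ cT cx = filtᵉ localLinearᵉ (subsᵉ (varᵉ 3)) ∘ᵉ (cp ∙ᵉ cp′ ∙ᵉ cT ∙ᵉ cx ∙ᵉ nilᵉ)

  stages : D → D
  stages x = pairs (pow (types x)) (pairs (types x) (pow (subs x)))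

  stagesᵉ : {f : D → D} → Comp f → Comp (stages ∘ f)
  stagesᵉ F = pairsᵉ (powᵉ (typesᵉ F)) (pairsᵉ (typesᵉ F) (powᵉ (subsᵉ F)))

  stageS stageT stageP : D → D
  stageS s = head s
  stageT s = head (tail s)
  stageP s = tail (tail s)

  Initial : D → D → Set
  Initial s x =
    stageS s ≡ typesOver leafSons x ×
    stageT s ∈ᴰ stageS s ×
    matrix x ∈ᴰ stageP s

  initialᵉ : Decider (λ e → Initial (π 0 e) (π 1 e))
  initialᵉ =
    ≡ᵉ (headᵉ ∘ᵉ varᵉ 0) (typesOverᵉ (constᵉ leafSons) (varᵉ 1)) ×ᵉ
    ∈ᵉ (headᵉ ∘ᵉ tailᵉ ∘ᵉ varᵉ 0) (headᵉ ∘ᵉ varᵉ 0) ×ᵉ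
    ∈ᵉ (matrixᵉ (varᵉ 1)) (tailᵉ ∘ᵉ tailᵉ ∘ᵉ varᵉ 0)

  Edge : D → D → D → Set
  Edge s s′ x =
    stageS s′ ≡ typesOver (fullSons (stageS s)) x ×
    stageT s′ ∈ᴰ typesOver (almostSons (stageS s)) x ×
    stageP s ≡ linearSet (stageP s) (stageP s′) (stageT s) x

  edgeᵉ : {s s′ x : D → D} → Comp s → Comp s′ → Comp x → Decider (λ e → Edge (s e) (s′ e) (x e))
  edgeᵉ f f′ fx =
    (≡ᵉ (headᵉ ∘ᵉ varᵉ 1) (typesOverᵉ (tuplesᵉ k (someᵉ (headᵉ ∘ᵉ varᵉ 0))) (varᵉ 2)) ×ᵉ
     ∈ᵉ (headᵉ ∘ᵉ tailᵉ ∘ᵉ varᵉ 1)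
        (typesOverᵉ (mapᵉ {g = λ e → nil ∙ head e} (nilᵉ ∙ᵉ headᵉ) (tuplesᵉ k′ (someᵉ (headᵉ ∘ᵉ varᵉ 0)))) (varᵉ 2)) ×ᵉ
     ≡ᵉ (P (varᵉ 0)) (linearSetᵉ (P (varᵉ 0)) (P (varᵉ 1)) (headᵉ ∘ᵉ tailᵉ ∘ᵉ varᵉ 0) (varᵉ 2)))
    $ᵉ (f ∙ᵉ f′ ∙ᵉ fx ∙ᵉ nilᵉ)
    where
    P : {f : D → D} → Comp f → Comp (stageP ∘ f)
    P F = tailᵉ ∘ᵉ tailᵉ ∘ᵉ F

  -- Z contains all stages of G from which u, the code of an until formula, is
  -- fulfilled by a path in G.
  Closed : D → D → D → D → Set
  Closed Z u G x = All G λ s →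
    (tail (tail u) ∈ᴰ stageP s ⊎ (Some G λ s′ → Edge s s′ x × s′ ∈ᴰ Z)) → s ∈ᴰ Z

  closedᵉ : Decider (λ e → Closed (π 0 e) (π 1 e) (π 3 e) (π 4 e))
  closedᵉ = ∀ᵉ (varᵉ 3)
    ((∈ᵉ (tailᵉ ∘ᵉ tailᵉ ∘ᵉ varᵉ 2) (tailᵉ ∘ᵉ tailᵉ ∘ᵉ varᵉ 0) ⊎ᵉ
      ∃ᵉ (varᵉ 4) (edgeᵉ (varᵉ 1) (varᵉ 0) (varᵉ 6) ×ᵉ ∈ᵉ (varᵉ 0) (varᵉ 2)))
     ⇒ᵉ ∈ᵉ (varᵉ 0) (varᵉ 1))

  untilCode : D
  untilCode = unary 4

  Good : D → D → Set
  Good G x =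
    (Some G λ s → Initial s x) ×
    (All G λ s → Some G λ s′ → Edge s s′ x) ×
    (All G λ s → All (subs x) λ u → head u ≡ untilCode → u ∈ᴰ stageP s →
      All (pow G) λ Z → Closed Z u G x → s ∈ᴰ Z)

  goodᵉ : Decider (λ e → Good (π 0 e) (π 1 e))
  goodᵉ =
    ∃ᵉ (varᵉ 0) (initialᵉ $ᵉ (varᵉ 0 ∙ᵉ varᵉ 2 ∙ᵉ nilᵉ)) ×ᵉ
    ∀ᵉ (varᵉ 0) (∃ᵉ (varᵉ 1) (edgeᵉ (varᵉ 1) (varᵉ 0) (varᵉ 3))) ×ᵉ
    ∀ᵉ (varᵉ 0) (∀ᵉ (subsᵉ (varᵉ 2))
      (≡ᵉ (headᵉ ∘ᵉ varᵉ 0) (constᵉ untilCode) ⇒ᵉ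
       ∈ᵉ (varᵉ 0) (tailᵉ ∘ᵉ tailᵉ ∘ᵉ varᵉ 1) ⇒ᵉ
       ∀ᵉ (powᵉ (varᵉ 2))
         (closedᵉ $ᵉ (varᵉ 0 ∙ᵉ varᵉ 1 ∙ᵉ varᵉ 2 ∙ᵉ varᵉ 3 ∙ᵉ varᵉ 4 ∙ᵉ nilᵉ) ⇒ᵉ ∈ᵉ (varᵉ 2) (varᵉ 0))))

  Accepts : D → Set
  Accepts x = Some (pow (stages x)) λ G → Good G x

  acceptsᵉ : Decider Accepts
  acceptsᵉ = ∃ᵉ (powᵉ (stagesᵉ idᵉ)) (goodᵉ $ᵉ (headᵉ ∙ᵉ tailᵉ ∙ᵉ nilᵉ))

-- Equivalences, decidability and sublists given by decidable properties

⇔-trans : {A B C : Set} → A ⇔ B → B ⇔ C → A ⇔ C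
⇔-trans p q = mk⇔ (to q ∘ to p) (from p ∘ from q)

⇔-sym : {A B : Set} → A ⇔ B → B ⇔ A
⇔-sym p = mk⇔ (from p) (to p)

≡⇒⇔ : {A B : Set} → A ≡ B → A ⇔ B
≡⇒⇔ refl = mk⇔ id id

⇔-refl : {A : Set} → A ⇔ A
⇔-refl = mk⇔ id id

⇔-¬ : {A B : Set} → A ⇔ B → (¬ A) ⇔ (¬ B)
⇔-¬ p = mk⇔ (λ ¬a b → ¬a (from p b)) (λ ¬b a → ¬b (to p a))

⇔-× : {A B C E : Set} → A ⇔ B → C ⇔ E → (A × C) ⇔ (B × E)
⇔-× p q = mk⇔ (λ (a , c) → to p a , to q c) (λ (b , e) → from p b , from q e)

⇔-⊎ : {A B C E : Set} → A ⇔ B → C ⇔ E → (A ⊎ C) ⇔ (B ⊎ E)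
⇔-⊎ p q = mk⇔ [ inj₁ ∘ to p , inj₂ ∘ to q ]′ [ inj₁ ∘ from p , inj₂ ∘ from q ]′

infix 4 _≟ᴰ_
_≟ᴰ_ : (a b : D) → Dec (a ≡ b)
nil     ≟ᴰ nil     = yes refl
nil     ≟ᴰ (_ ∙ _) = no λ ()
(_ ∙ _) ≟ᴰ nil     = no λ ()
(a ∙ b) ≟ᴰ (c ∙ d) = map′ (λ { (refl , refl) → refl }) (λ { refl → refl , refl })
                          ((a ≟ᴰ c) ×-dec (b ≟ᴰ d))

some? : ∀ l {P : D → Set} → (∀ y → Dec (P y)) → Dec (Some l P)
some? nil     P? = no λ { (_ , () , _) }
some? (y ∙ l) P? with P? y | some? l P?
... | yes py | _                   = yes (y , here , py)
... | no _   | yes (z , z∈ , pz)   = yes (z , there z∈ , pz)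
... | no ¬py | no none             = no λ { (_ , here , py) → ¬py py ; (z , there z∈ , pz) → none (z , z∈ , pz) }

all? : ∀ l {P : D → Set} → (∀ y → Dec (P y)) → Dec (All l P)
all? nil     P? = yes λ _ ()
all? (y ∙ l) P? with P? y | all? l P?
... | yes py | yes ps = yes λ { _ here → py ; z (there z∈) → ps z z∈ }
... | no ¬py | _      = no λ ps → ¬py (ps y here)
... | _      | no ¬ps = no λ ps → ¬ps λ z z∈ → ps z (there z∈)

_∈ᴰ?_ : ∀ z l → Dec (z ∈ᴰ l)
z ∈ᴰ? l = map′ (λ { (_ , z∈ , refl) → z∈ }) (λ z∈ → z , z∈ , refl) (some? l (z ≟ᴰ_))

≢nil? : ∀ d → Dec (d ≢ nil)
≢nil? d = ¬? (d ≟ᴰ nil)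

⟨_⟩? : {A : Set} → Dec A → D
⟨ yes _ ⟩? = one
⟨ no _  ⟩? = nil

⟨⟩?⇔ : {A : Set} (A? : Dec A) → ⟨ A? ⟩? ≢ nil ⇔ A
⟨⟩?⇔ (yes a) = mk⇔ (λ _ → a) (λ _ ())
⟨⟩?⇔ (no ¬a) = mk⇔ (λ t → ⊥-elim (t refl)) (λ a _ → ¬a a)

-- The counterpart of `filt` for properties that are decided without a program; `pick-filt`
-- identifies the two lists.
pick : {P : D → Set} → (∀ y → Dec (P y)) → D → D
pick P? l = select (λ y → ⟨ P? y ⟩?) nil l

module _ {P : D → Set} (P? : ∀ y → Dec (P y)) where

  ∈-pick⁻ : ∀ l {z} → z ∈ᴰ pick P? l → z ∈ᴰ l × P z
  ∈-pick⁻ l {z} z∈ with ∈-select⁻ _ nil l z∈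
  ... | inj₁ (z∈l , t) = z∈l , to (⟨⟩?⇔ (P? z)) t

  ∈-pick : ∀ {l z} → z ∈ᴰ l → P z → z ∈ᴰ pick P? l
  ∈-pick {l} {z} z∈ pz = ∈-select _ nil l z∈ (from (⟨⟩?⇔ (P? z)) pz)

  pick∈pow : ∀ l → pick P? l ∈ᴰ pow l
  pick∈pow l = select∈pow _ l

  pick-filt : {Q : D → Set} (q : Decider Q) → ∀ e l →
              (∀ y → y ∈ᴰ l → P y ⇔ Q (y ∙ e)) → pick P? l ≡ filt q e l
  pick-filt q e l ext = select-ext _ _ nil l λ y y∈ →
    ⇔-trans (⟨⟩?⇔ (P? y)) (⇔-trans (ext y y∈) (⇔-sym (Decider.correct q _)))

data Switches : List Set → List Set → Set₁ where
  []  : Switches [] []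
  _∷_ : ∀ {P Q Ps Qs} → P ⇔ Q → Switches Ps Qs → Switches (P ∷ Ps) (Q ∷ Qs)

switch-cong : ∀ d {Ps Qs} → Switches Ps Qs → Switch d Ps ⇔ Switch d Qs
switch-cong nil     []       = ⇔-refl
switch-cong (_ ∙ _) []       = ⇔-refl
switch-cong nil     (p ∷ ps) = p
switch-cong (_ ∙ d) (p ∷ ps) = switch-cong d ps

data Decs : List Set → Set₁ where
  []  : Decs []
  _∷_ : ∀ {P Ps} → Dec P → Decs Ps → Decs (P ∷ Ps)

switch? : ∀ d {Ps} → Decs Ps → Dec (Switch d Ps)
switch? d       []       = no λ ()
switch? nil     (p ∷ ps) = p
switch? (_ ∙ d) (p ∷ ps) = switch? d ps

-- Induction on codes, whose subformulas are at e, head e and tail e.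
D-ind : (C : D → Set) → C nil → (∀ op e → C e → C (head e) → C (tail e) → C (op ∙ e)) → ∀ d → C d
D-ind C base ind d = proj₁ (go d)
  where
  go : ∀ d → C d × C (head d) × C (tail d)
  go nil      = base , base , base
  go (op ∙ e) with go op | go e
  ... | op′ , _ | e′ , h , t = ind op e e′ h t , op′ , e′

-- Existence and uniqueness of truth sets

local-cong : ∀ lab m {Q E A Q′ E′ A′ : D → Set} x →
             (∀ u → u ∈ᴰ elements x → Q u ⇔ Q′ u) →
             (∀ u → u ∈ᴰ elements x → E u ⇔ E′ u) →
             (∀ u → u ∈ᴰ elements x → A u ⇔ A′ u) →
             ∀ u → u ∈ᴰ elements x → Local lab m Q E A u ⇔ Local lab m Q′ E′ A′ u
local-cong lab m x q e a u u∈ = switch-cong (head u)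
  ( switch-cong (head d)
      ( ⇔-refl
      ∷ ⇔-¬ (q _ (st t∈))
      ∷ ⇔-× (q _ (st (proj₁ (cl t∈)))) (q _ (st (proj₂ (cl t∈))))
      ∷ e _ (pa t∈)
      ∷ a _ (pa t∈)
      ∷ [])
  ∷ switch-cong (head d)
      ( q _ (st t∈)
      ∷ ⇔-¬ (q _ (pa t∈))
      ∷ ⇔-× (q _ (pa (proj₁ (cl t∈)))) (q _ (pa (proj₂ (cl t∈))))
      ∷ ⇔-⊎ (q _ (pa (proj₂ (cl t∈)))) (⇔-× (q _ (pa (proj₁ (cl t∈)))) ⇔-refl)
      ∷ ⇔-refl
      ∷ ⇔-refl
      ∷ [])
  ∷ [])
  where
  d = tail u
  cl : ∀ {z} → z ∈ᴰ subs x → (head z ∈ᴰ subs x) × (tail z ∈ᴰ subs x)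
  cl = ∈-subs-closed x

  d∈ : d ∈ᴰ subs x
  d∈ with ∈-push⁻ (mapᴰ (nil ∙_) (subs x)) u∈
  ... | inj₁ z with ∈-map⁻ (nil ∙_) (subs x) z
  ...   | _ , y∈ , refl = y∈
  d∈ | inj₂ z with ∈-map⁻ (one ∙_) (subs x) z
  ...   | _ , y∈ , refl = y∈

  t∈ : tail d ∈ᴰ subs x
  t∈ = proj₂ (cl d∈)

  st : ∀ {z} → z ∈ᴰ subs x → nil ∙ z ∈ᴰ elements x
  st z∈ = ∈-pushˡ _ (∈-map (nil ∙_) z∈)

  pa : ∀ {z} → z ∈ᴰ subs x → one ∙ z ∈ᴰ elements x
  pa z∈ = ∈-pushʳ (mapᴰ (nil ∙_) (subs x)) (∈-map (one ∙_) z∈)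

-- The intended solution of the equations. Truth is defined by recursion on codes, `S` at the node
-- and `P m` on a path with first move `m`; the path quantifiers range over the moves `ms` and not
-- over `Θ`, which removes the circularity.
module Truth (lab ms x : D) where

  record Value : Set₁ where
    field
      S  : Set
      S? : Dec S
      P  : D → Set
      P? : ∀ m → Dec (P m)

  open Value

  module _ (op e : D) (V Vₕ Vₜ : Value) where

    isStep? : ∀ m → Dec (IsStep m)
    isStep? m = ≢nil? (head m)

    valueOf : Value
    valueOf .S = Switch op
      (Nth lab (value e) ∷ (¬ S V) ∷ (S Vₕ × S Vₜ) ∷ Some ms (P V) ∷ All ms (P V) ∷ [])
    valueOf .S? = switch? op
      (≢nil? _ ∷ ¬? (S? V) ∷ (S? Vₕ ×-dec S? Vₜ) ∷ some? ms (P? V) ∷ all? ms (P? V) ∷ [])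
    valueOf .P m = Switch op
      ( S V ∷ (¬ P V m) ∷ (P Vₕ m × P Vₜ m)
      ∷ (P Vₜ m ⊎ (P Vₕ m × IsStep m × one ∙ op ∙ e ∈ᴰ tail m))
      ∷ (IsStep m × one ∙ e ∈ᴰ tail m)
      ∷ (IsStep m × tail (head m) ≡ head e × one ∙ tail e ∈ᴰ tail m)
      ∷ [])
    valueOf .P? m = switch? op
      ( S? V ∷ ¬? (P? V m) ∷ (P? Vₕ m ×-dec P? Vₜ m)
      ∷ (P? Vₜ m ⊎-dec (P? Vₕ m ×-dec isStep? m ×-dec (_ ∈ᴰ? _)))
      ∷ (isStep? m ×-dec (_ ∈ᴰ? _))
      ∷ (isStep? m ×-dec (_ ≟ᴰ _) ×-dec (_ ∈ᴰ? _))
      ∷ [])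

  -- As `head nil` and `tail nil` are `nil`, the tree `nil` reads as the letter 0 when taken as a
  -- state formula, and as that state formula when taken as a path formula.
  nilValue : Value
  nilValue = record { S = Nth lab 0 ; S? = ≢nil? _ ; P = λ _ → Nth lab 0 ; P? = λ _ → ≢nil? _ }

  val : D → Value
  -- The value of `op ∙ e` uses those of `e`, `head e` and `tail e`; computing the three together
  -- makes the recursion structural.
  val₃ : D → Value × Value × Value

  val nil      = nilValue
  val (op ∙ e) = valueOf op e (proj₁ (val₃ e)) (proj₁ (proj₂ (val₃ e))) (proj₂ (proj₂ (val₃ e)))

  val₃ nil      = nilValue , nilValue , nilValue
  val₃ (op ∙ e) = val (op ∙ e) , val op , val e

  val₃≡ : ∀ e → val₃ e ≡ (val e , val (head e) , val (tail e))
  val₃≡ nil     = refl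
  val₃≡ (_ ∙ _) = refl

  Val : D → D → Set
  Val m u = Switch (head u) (S (val (tail u)) ∷ P (val (tail u)) m ∷ [])

  val? : ∀ m u → Dec (Val m u)
  val? m u = switch? (head u) (S? (val (tail u)) ∷ P? (val (tail u)) m ∷ [])

  SomeVal AllVal : D → Set
  SomeVal u = Some ms λ m → Val m u
  AllVal  u = All  ms λ m → Val m u

  valS-local : ∀ m d → S (val d) ≡ LocalState lab m (Val m) SomeVal AllVal d
  valS-local m nil      = refl
  valS-local m (op ∙ e) rewrite val₃≡ e = refl

  valP-local : ∀ m d → P (val d) m ≡ LocalPath lab m (Val m) SomeVal AllVal d
  valP-local m nil      = refl
  valP-local m (op ∙ e) rewrite val₃≡ e = refl

  val-local : ∀ m u → Val m u ⇔ Local lab m (Val m) SomeVal AllVal u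
  val-local m u = switch-cong (head u)
    (≡⇒⇔ (valS-local m (tail u)) ∷ ≡⇒⇔ (valP-local m (tail u)) ∷ [])

  vset : D → D
  vset m = pick (val? m) (elements x)

  ∈-vset⇔ : ∀ m {u} → u ∈ᴰ elements x → u ∈ᴰ vset m ⇔ Val m u
  ∈-vset⇔ m {u} u∈ = mk⇔ (proj₂ ∘ ∈-pick⁻ (val? m) (elements x)) (∈-pick (val? m) u∈)

  truth : D
  truth = pick (λ v → some? ms λ m → v ≟ᴰ vset m) (pow (elements x))

  ∈-truth⁻ : ∀ {v} → v ∈ᴰ truth → Some ms λ m → v ≡ vset m
  ∈-truth⁻ v∈ = proj₂ (∈-pick⁻ (λ v → some? ms λ m → v ≟ᴰ vset m) (pow (elements x)) v∈)

  ∈-truth : ∀ {m} → m ∈ᴰ ms → vset m ∈ᴰ truth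
  ∈-truth {m} m∈ = ∈-pick (λ v → some? ms λ m → v ≟ᴰ vset m)
    (pick∈pow (val? m) (elements x)) (m , m∈ , refl)

  vset-consistent : ∀ m → Consistent (vset m) m truth lab x
  vset-consistent m = pick-filt (val? m) localᵉ (vset m ∙ truth ∙ lab ∙ m ∙ x ∙ nil) (elements x) λ u u∈ →
    ⇔-trans (val-local m u) (local-cong lab m
      {Val m} {SomeVal} {AllVal} {_∈ᴰ vset m} {SomeIn truth} {AllIn truth} x
      (λ u′ u′∈ → ⇔-sym (∈-vset⇔ m u′∈))
      (λ u′ u′∈ → mk⇔ (λ (m′ , m′∈ , p) → vset m′ , ∈-truth m′∈ , from (∈-vset⇔ m′ u′∈) p)
                      (λ (v , v∈ , q) → case ∈-truth⁻ v∈ of λ { (m′ , m′∈ , refl) →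
                                          m′ , m′∈ , to (∈-vset⇔ m′ u′∈) q }))
      (λ u′ u′∈ → mk⇔ (λ ps v v∈ → case ∈-truth⁻ v∈ of λ { (m′ , m′∈ , refl) →
                                      from (∈-vset⇔ m′ u′∈) (ps m′ m′∈) })
                      (λ qs m′ m′∈ → to (∈-vset⇔ m′ u′∈) (qs _ (∈-truth m′∈))))
      u u∈)

  module _ (Θ : D)
           (sound    : ∀ w → w ∈ᴰ Θ → Some ms λ m → Consistent w m Θ lab x)
           (complete : ∀ m → m ∈ᴰ ms → Some Θ λ w → Consistent w m Θ lab x) where

    private
      closed : ∀ {z} → z ∈ᴰ subs x → (head z ∈ᴰ subs x) × (tail z ∈ᴰ subs x)
      closed = ∈-subs-closed x

      Claim : D → Set
      Claim d = d ∈ᴰ subs x → ∀ v m → Consistent v m Θ lab x →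
                (nil ∙ d ∈ᴰ v ⇔ S (val d)) × (one ∙ d ∈ᴰ v ⇔ P (val d) m)

      unfoldS : ∀ {d} v m → d ∈ᴰ subs x → Consistent v m Θ lab x →
                nil ∙ d ∈ᴰ v ⇔ LocalState lab m (_∈ᴰ v) (SomeIn Θ) (AllIn Θ) d
      unfoldS {d} v m d∈ c = mk⇔
        (λ z → proj₂ (∈-filt⁻ localᵉ {v ∙ Θ ∙ lab ∙ m ∙ x ∙ nil} {elements x} (subst (nil ∙ d ∈ᴰ_) c z)))
        (λ l → subst (nil ∙ d ∈ᴰ_) (sym c)
                 (∈-filt localᵉ {v ∙ Θ ∙ lab ∙ m ∙ x ∙ nil} {elements x} (∈-pushˡ _ (∈-map (nil ∙_) d∈)) l))

      unfoldP : ∀ {d} v m → d ∈ᴰ subs x → Consistent v m Θ lab x →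
                one ∙ d ∈ᴰ v ⇔ LocalPath lab m (_∈ᴰ v) (SomeIn Θ) (AllIn Θ) d
      unfoldP {d} v m d∈ c = mk⇔
        (λ z → proj₂ (∈-filt⁻ localᵉ {v ∙ Θ ∙ lab ∙ m ∙ x ∙ nil} {elements x} (subst (one ∙ d ∈ᴰ_) c z)))
        (λ l → subst (one ∙ d ∈ᴰ_) (sym c)
                 (∈-filt localᵉ {v ∙ Θ ∙ lab ∙ m ∙ x ∙ nil} {elements x}
                   (∈-pushʳ (mapᴰ (nil ∙_) (subs x)) (∈-map (one ∙_) d∈)) l))

      -- By `sound` and `complete`, quantifying over `Θ` amounts to quantifying over the moves. The
      -- claim ranges over all `v` and `m` because the cases of path quantifiers need the induction
      -- hypothesis at the other members `w` of `Θ`.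
      claim : ∀ d → Claim d
      claim = D-ind Claim
        (λ d∈ v m c → unfoldS v m d∈ c , ⇔-trans (unfoldP v m d∈ c) (unfoldS v m d∈ c))
        (λ op e ie ih it d∈ v m c →
          let e∈ = proj₂ (closed d∈) ; h∈ = proj₁ (closed e∈) ; t∈ = proj₂ (closed e∈)
              se = proj₁ (ie e∈ v m c) ; pe = proj₂ (ie e∈ v m c) in
          ⇔-trans (unfoldS v m d∈ c) (⇔-trans (switch-cong op
            ( ⇔-refl
            ∷ ⇔-¬ se
            ∷ ⇔-× (proj₁ (ih h∈ v m c)) (proj₁ (it t∈ v m c))
            ∷ mk⇔ (λ (w , w∈ , z) → case sound w w∈ of λ (m′ , m′∈ , c′) →
                      m′ , m′∈ , to (proj₂ (ie e∈ w m′ c′)) z)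
                  (λ (m′ , m′∈ , z) → case complete m′ m′∈ of λ (w , w∈ , c′) →
                      w , w∈ , from (proj₂ (ie e∈ w m′ c′)) z)
            ∷ mk⇔ (λ zs m′ m′∈ → case complete m′ m′∈ of λ (w , w∈ , c′) →
                      to (proj₂ (ie e∈ w m′ c′)) (zs w w∈))
                  (λ zs w w∈ → case sound w w∈ of λ (m′ , m′∈ , c′) →
                      from (proj₂ (ie e∈ w m′ c′)) (zs m′ m′∈))
            ∷ [])) (⇔-sym (≡⇒⇔ (valS-local m (op ∙ e))))) ,
          ⇔-trans (unfoldP v m d∈ c) (⇔-trans (switch-cong op
            ( se
            ∷ ⇔-¬ pe
            ∷ ⇔-× (proj₂ (ih h∈ v m c)) (proj₂ (it t∈ v m c))
            ∷ ⇔-⊎ (proj₂ (it t∈ v m c)) (⇔-× (proj₂ (ih h∈ v m c)) ⇔-refl)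
            ∷ ⇔-refl
            ∷ ⇔-refl
            ∷ [])) (⇔-sym (≡⇒⇔ (valP-local m (op ∙ e))))))

    consistent-unique : ∀ v m → Consistent v m Θ lab x → v ≡ vset m
    consistent-unique v m c = trans c (sym (pick-filt (val? m) localᵉ (v ∙ Θ ∙ lab ∙ m ∙ x ∙ nil) (elements x) λ u u∈ →
      ⇔-trans (is-val u u∈) (mk⇔
        (λ z → proj₂ (∈-filt⁻ localᵉ {v ∙ Θ ∙ lab ∙ m ∙ x ∙ nil} {elements x} (subst (u ∈ᴰ_) c z)))
        (λ l → subst (u ∈ᴰ_) (sym c) (∈-filt localᵉ {v ∙ Θ ∙ lab ∙ m ∙ x ∙ nil} {elements x} u∈ l)))))
      where
      is-val : ∀ u → u ∈ᴰ elements x → Val m u ⇔ u ∈ᴰ v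
      is-val u u∈ with ∈-push⁻ (mapᴰ (nil ∙_) (subs x)) u∈
      ... | inj₁ z with ∈-map⁻ (nil ∙_) (subs x) z
      ...   | d , d∈ , refl = ⇔-sym (proj₁ (claim d d∈ v m c))
      is-val u u∈ | inj₂ z with ∈-map⁻ (one ∙_) (subs x) z
      ...   | d , d∈ , refl = ⇔-sym (proj₂ (claim d d∈ v m c))

module _ (k′ : ℕ) (lab θ x : D) where
  open Procedure k′
  open Truth lab (moves θ) x

  private
    sound : ∀ w → w ∈ᴰ truth → Some (moves θ) λ m → Consistent w m truth lab x
    sound w w∈ with ∈-truth⁻ w∈
    ... | m , m∈ , refl = m , m∈ , vset-consistent m

    complete : ∀ m → m ∈ᴰ moves θ → Some truth λ w → Consistent w m truth lab x
    complete m m∈ = vset m , ∈-truth m∈ , vset-consistent m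

  truth-isTruth : IsTruth truth lab θ x
  truth-isTruth =
    pick-filt (λ v → some? (moves θ) λ m → v ≟ᴰ vset m) someMoveᵉ (truth ∙ lab ∙ θ ∙ x ∙ nil) (pathSets x) (λ v v∈ → mk⇔
      (λ { (m , m∈ , refl) → m , m∈ , vset-consistent m })
      (λ (m , m∈ , c) → m , m∈ , consistent-unique truth sound complete v m c)) ,
    complete

  -- The sets consistent relative to `Θ` are again the sets `vset m`. Hence `Θ` and `truth` are
  -- selected from `pathSets x` by equivalent tests and coincide as lists.
  isTruth-unique : ∀ {Θ} → IsTruth Θ lab θ x → Θ ≡ truth
  isTruth-unique {Θ} (eq , complete′) = trans eq
    (sym (pick-filt (λ v → some? (moves θ) λ m → v ≟ᴰ vset m) someMoveᵉ (Θ ∙ lab ∙ θ ∙ x ∙ nil) (pathSets x) λ v v∈ → mk⇔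
      (λ { (m , m∈ , refl) → case complete′ m m∈ of λ (w , w∈ , c) →
             m , m∈ , subst (λ v → Consistent v m Θ lab x) (unique w m c) c })
      (λ (m , m∈ , c) → m , m∈ , unique v m c)))
    where
    sound′ : ∀ w → w ∈ᴰ Θ → Some (moves θ) λ m → Consistent w m Θ lab x
    sound′ w w∈ = proj₂ (∈-filt⁻ someMoveᵉ {Θ ∙ lab ∙ θ ∙ x ∙ nil} {pathSets x} (subst (w ∈ᴰ_) eq w∈))

    unique : ∀ v m → Consistent v m Θ lab x → v ≡ vset m
    unique = consistent-unique Θ sound′ complete′

-- Membership in the computed sets

module Membership (k′ : ℕ) (x : D) where
  open Procedure k′

  truthFrom : D → (Fin k → D) → D
  truthFrom lab f = Truth.truth lab (moves (tabulateᴰ f)) x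

  truthFrom∈ : ∀ lab f → truthFrom lab f ∈ᴰ truthSets x
  truthFrom∈ lab f = pick∈pow _ (pathSets x)

  TypeWitness : D → D → D → D → Set
  TypeWitness α Θ lab σ =
    Σ[ b ∈ D ] Bits (len (prefix nil α)) b × Σ[ f ∈ (Fin k → D) ]
      (∀ c → f c ∈ᴰ sonOptions x) × Match k α σ (tabulateᴰ f) × Θ ≡ truthFrom (push b lab) f

  opaque
    unfolding typeOf

    typeOf∈types : ∀ lab σ → typeOf lab σ x ∈ᴰ types x
    typeOf∈types lab σ = filt∈pow typePairᵉ (lab ∙ σ ∙ x ∙ nil) (typePairs x)

    typeOf-pair : ∀ {lab σ w} → w ∈ᴰ typeOf lab σ x → Some (subs x) λ α → Some (truthSets x) λ Θ → w ≡ α ∙ Θ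
    typeOf-pair {lab} {σ} w∈ =
      ∈-pairs⁻ {subs x} {truthSets x} (proj₁ (∈-filt⁻ typePairᵉ {lab ∙ σ ∙ x ∙ nil} {typePairs x} w∈))

    typeOf⁻ : ∀ {α Θ lab σ} → α ∙ Θ ∈ᴰ typeOf lab σ x → TypeWitness α Θ lab σ
    typeOf⁻ {α} {Θ} {lab} {σ} w∈ =
      convert (proj₂ (∈-filt⁻ typePairᵉ {lab ∙ σ ∙ x ∙ nil} {typePairs x} w∈))
      where
      convert′ : ∀ {b θ} → b ∈ᴰ bitLists (prefix nil α) → Match k α σ θ → IsTruth Θ (push b lab) θ x →
                 Σ[ f ∈ (Fin k → D) ] (∀ c → f c ∈ᴰ sonOptions x) × θ ≡ tabulateᴰ f → TypeWitness α Θ lab σ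
      convert′ {b} b∈ matched isTruth (f , f∈ , refl) =
        b , to (∈-bitLists⇔ (prefix nil α)) b∈ , f , f∈ , matched ,
        isTruth-unique k′ (push b lab) (tabulateᴰ f) x isTruth

      convert : TypePair α Θ lab σ x → TypeWitness α Θ lab σ
      convert (b , b∈ , θ , θ∈ , matched , isTruth) =
        convert′ b∈ matched isTruth (∈-tuples⁻ k {sonOptions x} θ∈)

    typeOf⁺ : ∀ {α lab σ} b f → α ∈ᴰ subs x → Bits (len (prefix nil α)) b → (∀ c → f c ∈ᴰ sonOptions x) →
              Match k α σ (tabulateᴰ f) → α ∙ truthFrom (push b lab) f ∈ᴰ typeOf lab σ x
    typeOf⁺ {α} {lab} {σ} b f α∈ bits f∈ matched =
      ∈-filt typePairᵉ {lab ∙ σ ∙ x ∙ nil} {typePairs x}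
        (∈-pairs α∈ (truthFrom∈ (push b lab) f))
        (b , from (∈-bitLists⇔ (prefix nil α)) bits , tabulateᴰ f , ∈-tuples f∈ , matched ,
         truth-isTruth k′ (push b lab) (tabulateᴰ f) x)

  opaque
    unfolding typesOver

    typesOver∈ : ∀ l → typesOver l x ∈ᴰ pow (types x)
    typesOver∈ l = filt∈pow reachableᵉ (l ∙ x ∙ nil) (types x)

    typesOver⊆types : ∀ {l T} → T ∈ᴰ typesOver l x → T ∈ᴰ types x
    typesOver⊆types {l} T∈ = proj₁ (∈-filt⁻ reachableᵉ {l ∙ x ∙ nil} {types x} T∈)

    typesOver⁺ : ∀ {l lab σ} → Bits (len (letterCount x)) lab → σ ∈ᴰ l → typeOf lab σ x ∈ᴰ typesOver l x
    typesOver⁺ {l} {lab} {σ} bits σ∈ = ∈-filt reachableᵉ {l ∙ x ∙ nil} {types x}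
      (typeOf∈types lab σ) (lab , from (∈-bitLists⇔ (letterCount x)) bits , σ , σ∈ , refl)

    typesOver⁻ : ∀ {l T} → T ∈ᴰ typesOver l x →
                 Σ[ lab ∈ D ] Bits (len (letterCount x)) lab × Some l λ σ → T ≡ typeOf lab σ x
    typesOver⁻ {l} {T} T∈ = convert (proj₂ (∈-filt⁻ reachableᵉ {l ∙ x ∙ nil} {types x} T∈))
      where
      convert : (Some (bitLists (letterCount x)) λ lab → Some l λ σ → T ≡ typeOf lab σ x) →
                Σ[ lab ∈ D ] Bits (len (letterCount x)) lab × Some l λ σ → T ≡ typeOf lab σ x
      convert (lab , lab∈ , w) = lab , to (∈-bitLists⇔ (letterCount x)) lab∈ , w

  opaque
    unfolding linearSet

    ∈-linearSet⇔ : ∀ {p p′ T u} → u ∈ᴰ subs x →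
                   u ∈ᴰ linearSet p p′ T x ⇔ LocalLinear (_∈ᴰ p) (_∈ᴰ p′) T u
    ∈-linearSet⇔ {p} {p′} {T} u∈ = mk⇔
      (λ z → proj₂ (∈-filt⁻ localLinearᵉ {p ∙ p′ ∙ T ∙ x ∙ nil} {subs x} z))
      (∈-filt localLinearᵉ {p ∙ p′ ∙ T ∙ x ∙ nil} {subs x} u∈)

    select≡linearSet : ∀ b p p′ T →
                       (∀ u → u ∈ᴰ subs x → b u ≢ nil ⇔ LocalLinear (_∈ᴰ p) (_∈ᴰ p′) T u) →
                       select b nil (subs x) ≡ linearSet p p′ T x
    select≡linearSet b p p′ T ok = select-ext b _ nil (subs x) λ u u∈ →
      ⇔-trans (ok u u∈) (⇔-sym (Decider.correct localLinearᵉ (u ∙ p ∙ p′ ∙ T ∙ x ∙ nil)))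

-- Truth sets of trees

value-binary : ∀ b → value (binary b) ≡ toℕᵇ b
value-binary zeroᵇ     = refl
value-binary 2[1+ b ] = trans (cong (λ n → 2 + (n + n)) (value-binary b)) (lemma (toℕᵇ b))
  where
  lemma : ∀ n → 2 + (n + n) ≡ 2 * suc n
  lemma = solve-∀
value-binary 1+[2 b ] = trans (cong (λ n → 1 + (n + n)) (value-binary b)) (lemma (toℕᵇ b))
  where
  lemma : ∀ n → 1 + (n + n) ≡ suc (2 * n)
  lemma = solve-∀

value-encodeFin : ∀ {n} (p : Fin n) → value (encodeFin p) ≡ toℕ p
value-encodeFin p = trans (value-binary (fromℕ (toℕ p))) (toℕ-fromℕ (toℕ p))

len-push : ∀ m l → len (push m l) ≡ len m + len l
len-push nil     l = refl
len-push (y ∙ m) l = trans (len-push m (y ∙ l)) (+-suc (len m) (len l))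

≤len-concatMap : ∀ g {l d} → d ∈ᴰ l → len (g d) ≤ len (concatMapᴰ g l)
≤len-concatMap g {l} d∈ = go l nil d∈
  where
  f : D → D → D
  f y a = push (g y) a

  old : ∀ l a → len a ≤ len (foldᴰ f a l)
  old nil     a = ≤-refl
  old (y ∙ l) a = ≤-trans (≤-trans (m≤n+m (len a) (len (g y))) (≤-reflexive (sym (len-push (g y) a)))) (old l _)

  go : ∀ l a {d} → d ∈ᴰ l → len (g d) ≤ len (foldᴰ f a l)
  go (y ∙ l) a here       = ≤-trans (≤-trans (m≤m+n (len (g y)) (len a)) (≤-reflexive (sym (len-push (g y) a)))) (old l _)
  go (y ∙ l) a (there d∈) = go l _ d∈

unary-injective : ∀ {m n} → unary m ≡ unary n → m ≡ n
unary-injective {zero}  {zero}  eq = refl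
unary-injective {suc m} {suc n} eq = cong suc (unary-injective (∙-injectiveʳ eq))

module Trees (k′ : ℕ) (x : D) where
  open Procedure k′

  letterBound : ℕ
  letterBound = len (letterCount x)

  value<letterBound : ∀ {d} → d ∈ᴰ subs x → value d < letterBound
  value<letterBound {d} d∈ = subst (_≤ letterBound)
    (cong suc (trans (cong len (unaryOf≡ d)) (len-unary (value d))))
    (≤len-concatMap (λ d → nil ∙ unaryOf d) d∈)

  closed : ∀ {z} → z ∈ᴰ subs x → (head z ∈ᴰ subs x) × (tail z ∈ᴰ subs x)
  closed = ∈-subs-closed x

  stateElement : ∀ {d} → d ∈ᴰ subs x → nil ∙ d ∈ᴰ elements x
  stateElement d∈ = ∈-pushˡ _ (∈-map (nil ∙_) d∈)

  pathElement : ∀ {d} → d ∈ᴰ subs x → one ∙ d ∈ᴰ elements x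
  pathElement d∈ = ∈-pushʳ (mapᴰ (nil ∙_) (subs x)) (∈-map (one ∙_) d∈)

  movesFrom⁻ : ∀ j c (σ : Fin j → D) {m} → m ∈ᴰ movesFrom j c (tabulateᴰ σ) →
               Σ[ i ∈ Fin j ] Σ[ v ∈ D ] σ i ≢ nil × v ∈ᴰ tail (σ i) × m ≡ (nil ∙ unary (c + toℕ i)) ∙ v
  movesFrom⁻ (suc j) c σ m∈
    with σ zero in eq | ∈-push⁻ (ifᴰ (σ zero) (mapᴰ ((nil ∙ unary c) ∙_) (tail (σ zero))) nil) m∈
  ... | s ∙ l | inj₁ m∈₀ with ∈-map⁻ ((nil ∙ unary c) ∙_) l m∈₀
  ...   | v , v∈ , refl = zero , v , (λ eq′ → case trans (sym eq) eq′ of λ ())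
                        , subst (λ d → v ∈ᴰ tail d) (sym eq) v∈
                        , cong (λ n → (nil ∙ unary n) ∙ v) (sym (+-identityʳ c))
  movesFrom⁻ (suc j) c σ m∈ | nil | inj₁ m∈₀ = case m∈₀ of λ ()
  movesFrom⁻ (suc j) c σ m∈ | _ | inj₂ m∈′ with movesFrom⁻ j (suc c) (σ ∘ suc) m∈′
  ... | i , v , s≢ , v∈ , refl = suc i , v , s≢ , v∈ , cong (λ n → (nil ∙ unary n) ∙ v) (sym (+-suc c (toℕ i)))

  movesFrom⁺ : ∀ j c (σ : Fin j → D) i {v} → σ i ≢ nil → v ∈ᴰ tail (σ i) →
               (nil ∙ unary (c + toℕ i)) ∙ v ∈ᴰ movesFrom j c (tabulateᴰ σ)
  movesFrom⁺ (suc j) c σ zero {v} s≢ v∈ = ∈-pushˡ _ (found (σ zero) s≢ v∈)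
    where
    found : ∀ s → s ≢ nil → v ∈ᴰ tail s →
            (nil ∙ unary (c + 0)) ∙ v ∈ᴰ ifᴰ s (mapᴰ ((nil ∙ unary c) ∙_) (tail s)) nil
    found nil     s≢ v∈ = ⊥-elim (s≢ refl)
    found (_ ∙ l) s≢ v∈ rewrite +-identityʳ c = ∈-map ((nil ∙ unary c) ∙_) v∈
  movesFrom⁺ (suc j) c σ (suc i) {v} s≢ v∈ =
    ∈-pushʳ (ifᴰ (σ zero) (mapᴰ ((nil ∙ unary c) ∙_) (tail (σ zero))) nil)
      (subst (λ n → (nil ∙ unary n) ∙ v ∈ᴰ movesFrom j (suc c) (tabulateᴰ (σ ∘ suc))) (sym (+-suc c (toℕ i)))
        (movesFrom⁺ j (suc c) (σ ∘ suc) i s≢ v∈))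

  anySon-none : ∀ j (σ : Fin j → D) → (∀ c → σ c ≡ nil) → anySon j (tabulateᴰ σ) ≡ nil
  anySon-none zero    σ none = refl
  anySon-none (suc j) σ none rewrite none zero = anySon-none j (σ ∘ suc) (none ∘ suc)

  anySon-none⁻ : ∀ j (σ : Fin j → D) → anySon j (tabulateᴰ σ) ≡ nil → ∀ c → σ c ≡ nil
  anySon-none⁻ (suc j) σ eq c with σ zero in eq₀
  anySon-none⁻ (suc j) σ eq zero    | nil = eq₀
  anySon-none⁻ (suc j) σ eq (suc c) | nil = anySon-none⁻ j (σ ∘ suc) eq c

  moves⁻ : ∀ (σ : Fin k → D) {m} → m ∈ᴰ moves (tabulateᴰ σ) →
           ((∀ c → σ c ≡ nil) × m ≡ nil) ⊎
           (Σ[ c ∈ Fin k ] Σ[ v ∈ D ] σ c ≢ nil × v ∈ᴰ tail (σ c) × m ≡ (nil ∙ unary (toℕ c)) ∙ v)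
  moves⁻ σ m∈ with anySon k (tabulateᴰ σ) in eq
  moves⁻ σ here | nil   = inj₁ (anySon-none⁻ k σ eq , refl)
  moves⁻ σ m∈   | _ ∙ _ = inj₂ (movesFrom⁻ k 0 σ m∈)

  moves-leaf : ∀ (σ : Fin k → D) → (∀ c → σ c ≡ nil) → nil ∈ᴰ moves (tabulateᴰ σ)
  moves-leaf σ none with anySon k (tabulateᴰ σ) | anySon-none k σ none
  ... | nil | refl = here

  moves-step : ∀ (σ : Fin k → D) c {v} → σ c ≢ nil → v ∈ᴰ tail (σ c) →
               (nil ∙ unary (toℕ c)) ∙ v ∈ᴰ moves (tabulateᴰ σ)
  moves-step σ c s≢ v∈ with anySon k (tabulateᴰ σ) in eq
  ... | nil   = ⊥-elim (s≢ (anySon-none⁻ k σ eq c))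
  ... | _ ∙ _ = movesFrom⁺ k 0 σ c s≢ v∈

  -- Trees as the procedure sees them: labels are bit lists, so one type serves for any number of
  -- letters and a relabelling just lengthens the labels.
  data RTree : Set where
    rnode : (lab : D) (sons : Fin k → Maybe RTree) → RTree

  mutual
    truthOf : RTree → D
    truthOf (rnode lab sons) = Truth.truth lab (moves (tabulateᴰ (λ c → truthSon (sons c)))) x

    truthSon : Maybe RTree → D
    truthSon nothing  = nil
    truthSon (just r) = one ∙ truthOf r

  -- Letters beyond the bound B do not occur in the input.
  data Agree {n} (B : ℕ) : Tree k n → RTree → Set where
    agree : ∀ {l lab sons rsons} →
            (∀ p → toℕ p < B → p ∈ l ⇔ Nth lab (toℕ p)) →
            (∀ c → Pointwise (Agree B) (sons c) (rsons c)) →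
            Agree B (node l sons) (rnode lab rsons)

  Describes : ∀ {n} {t : Tree k n} → Path t → D → Set
  Describes {n} {t} π v =
    (∀ ψ → encodeᵖ ψ ∈ᴰ subs x → (π ⊨ᵖ ψ) ⇔ one ∙ encodeᵖ ψ ∈ᴰ v) ×
    (∀ φ → encodeˢ φ ∈ᴰ subs x → (t ⊨ˢ φ) ⇔ nil ∙ encodeˢ φ ∈ᴰ v)

  Described : ∀ {n} → Tree k n → RTree → Set
  Described t r = (∀ (π : Path t) → Some (truthOf r) (Describes π)) ×
                  (∀ v → v ∈ᴰ truthOf r → Σ[ π ∈ Path t ] Describes π v)

  module _ {n B : ℕ} (N≤B : letterBound ≤ B) {l : Subset n} {lab : D}
           {sons : Fin k → Maybe (Tree k n)} {rsons : Fin k → Maybe RTree}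
           (letters : ∀ p → toℕ p < B → p ∈ l ⇔ Nth lab (toℕ p))
           (below : ∀ c → Pointwise Described (sons c) (rsons c)) where

    private
      σ : Fin k → D
      σ c = truthSon (rsons c)

      t : Tree k n
      t = node l sons

      -- All paths that leave in the same direction and whose remainders are described by the same
      -- truth set share a move; truth at the node and along the path depends on this move only.
      Matched : Path t → D → Set
      Matched (end _)      m = m ≡ nil
      Matched (step c _ π) m = Σ[ v ∈ D ] m ≡ (nil ∙ unary (toℕ c)) ∙ v × Describes π v

      open Truth lab (moves (tabulateᴰ σ)) x
      open Value

      match : ∀ π → Some (moves (tabulateᴰ σ)) (Matched π)
      match (end none) = nil , moves-leaf σ (λ c → σ-nil c (none c)) , refl
        where
        σ-nil : ∀ c → sons c ≡ nothing → σ c ≡ nil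
        σ-nil c eq with sons c | rsons c | below c
        ... | nothing | nothing | nothing = refl
      match (step {t = s} c e π) with sons c | rsons c in eq | below c
      match (step {t = s} c refl π) | just s | just r | just d with proj₁ d π
      ... | v , v∈ , desc = _ ,
        moves-step σ c (λ σ≡ → case trans (sym (cong truthSon eq)) σ≡ of λ ())
          (subst (λ r → v ∈ᴰ tail (truthSon r)) (sym eq) v∈) ,
        v , refl , desc

      match⁻ : ∀ m → m ∈ᴰ moves (tabulateᴰ σ) → Σ[ π ∈ Path t ] Matched π m
      match⁻ m m∈ with moves⁻ σ m∈
      ... | inj₁ (none , refl) = end (λ c → σ-nil⁻ c (none c)) , refl
        where
        σ-nil⁻ : ∀ c → σ c ≡ nil → sons c ≡ nothing
        σ-nil⁻ c eq with sons c | rsons c | below c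
        ... | nothing | nothing | nothing = refl
      ... | inj₂ (c , v , s≢ , v∈ , refl) with sons c in eq | rsons c | below c
      ...   | nothing | nothing | nothing = ⊥-elim (s≢ refl)
      ...   | just s  | just r  | just d  with proj₂ d v v∈
      ...     | π , desc = step c eq π , v , refl , desc

      -- The truth of a state formula does not depend on the move; `nil` is an arbitrary choice.
      viaS : ∀ {A : Set} d → A ⇔ LocalState lab nil (Val nil) SomeVal AllVal d → A ⇔ S (val d)
      viaS d e = ⇔-trans e (⇔-sym (≡⇒⇔ (valS-local nil d)))

      viaP : ∀ {A : Set} m d → A ⇔ LocalPath lab m (Val m) SomeVal AllVal d → A ⇔ P (val d) m
      viaP m d e = ⇔-trans e (⇔-sym (≡⇒⇔ (valP-local m d)))

      left right : ∀ {op a b} → op ∙ a ∙ b ∈ᴰ subs x → _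
      left  d∈ = proj₁ (closed (proj₂ (closed d∈)))
      right d∈ = proj₂ (closed (proj₂ (closed d∈)))

      mutual
        state⇔ : ∀ φ → encodeˢ φ ∈ᴰ subs x → (t ⊨ˢ φ) ⇔ S (val (encodeˢ φ))
        state⇔ (letter p) d∈ = viaS (encodeˢ {k} (letter p))
          (subst (λ m → p ∈ l ⇔ Nth lab m) (sym (value-encodeFin p))
            (letters p (≤-trans (subst (_< letterBound) (value-encodeFin p)
              (value<letterBound (proj₂ (closed d∈)))) N≤B)))
        state⇔ (¬̇ φ)   d∈ = viaS (encodeˢ (¬̇ φ)) (⇔-¬ (state⇔ φ (proj₂ (closed d∈))))
        state⇔ (φ ∧̇ χ) d∈ = viaS (encodeˢ (φ ∧̇ χ)) (⇔-× (state⇔ φ (left d∈)) (state⇔ χ (right d∈)))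
        state⇔ (𝐄 ψ)   d∈ = viaS (encodeˢ (𝐄 ψ)) (mk⇔
          (λ (π , h) → case match π of λ (m , m∈ , π~m) →
             m , m∈ , to (path⇔ ψ (proj₂ (closed d∈)) π m π~m) h)
          (λ (m , m∈ , h) → case match⁻ m m∈ of λ (π , π~m) →
             π , from (path⇔ ψ (proj₂ (closed d∈)) π m π~m) h))
        state⇔ (𝐀 ψ)   d∈ = viaS (encodeˢ (𝐀 ψ)) (mk⇔
          (λ h m m∈ → case match⁻ m m∈ of λ (π , π~m) →
             to (path⇔ ψ (proj₂ (closed d∈)) π m π~m) (h π))
          (λ h π → case match π of λ (m , m∈ , π~m) →
             from (path⇔ ψ (proj₂ (closed d∈)) π m π~m) (h m m∈)))

        path⇔ : ∀ ψ → encodeᵖ ψ ∈ᴰ subs x → ∀ π m → Matched π m → (π ⊨ᵖ ψ) ⇔ P (val (encodeᵖ ψ)) m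
        path⇔ (state φ) d∈ π m π~m = viaP m (encodeᵖ (state φ)) (state⇔ φ (proj₂ (closed d∈)))
        path⇔ (¬̇ ψ)   d∈ π m π~m = viaP m (encodeᵖ (¬̇ ψ)) (⇔-¬ (path⇔ ψ (proj₂ (closed d∈)) π m π~m))
        path⇔ (ψ ∧̇ χ) d∈ π m π~m =
          viaP m (encodeᵖ (ψ ∧̇ χ)) (⇔-× (path⇔ ψ (left d∈) π m π~m) (path⇔ χ (right d∈) π m π~m))
        path⇔ (ψ U χ) d∈ π@(end _) m refl = viaP m (encodeᵖ (ψ U χ)) (mk⇔
          (λ { (now h) → inj₁ (to (path⇔ χ (right d∈) π m refl) h) })
          (λ { (inj₁ h) → now (from (path⇔ χ (right d∈) π m refl) h)
             ; (inj₂ (_ , s , _)) → ⊥-elim (s refl) }))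
        path⇔ (ψ U χ) d∈ π@(step c e π′) m π~m@(v , refl , desc) = viaP m (encodeᵖ (ψ U χ)) (mk⇔
          (λ { (now h) → inj₁ (to (path⇔ χ (right d∈) π m π~m) h)
             ; (later h u) → inj₂ (to (path⇔ ψ (left d∈) π m π~m) h , (λ ()) , to (proj₁ desc (ψ U χ) d∈) u) })
          (λ { (inj₁ h) → now (from (path⇔ χ (right d∈) π m π~m) h)
             ; (inj₂ (h , _ , u)) → later (from (path⇔ ψ (left d∈) π m π~m) h) (from (proj₁ desc (ψ U χ) d∈) u) }))
        path⇔ (X ψ) d∈ (end _) m refl = viaP m (encodeᵖ (X ψ)) (mk⇔ (λ ()) (λ (s , _) → s refl))
        path⇔ (X ψ) d∈ (step c e π′) m (v , refl , desc) = viaP m (encodeᵖ (X ψ)) (mk⇔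
          (λ h → (λ ()) , to (proj₁ desc ψ (proj₂ (closed d∈))) h)
          (λ (_ , h) → from (proj₁ desc ψ (proj₂ (closed d∈))) h))
        path⇔ (X[ i ] ψ) d∈ (end _) m refl = viaP m (encodeᵖ (X[ i ] ψ)) (mk⇔ (λ ()) (λ (s , _) → s refl))
        path⇔ (X[ i ] ψ) d∈ (step c e π′) m (v , refl , desc) = viaP m (encodeᵖ (X[ i ] ψ)) (mk⇔
          (λ { (refl , h) → (λ ()) , refl , to (proj₁ desc ψ (right d∈)) h })
          (λ (_ , c≡ , h) → toℕ-injective (unary-injective c≡) , from (proj₁ desc ψ (right d∈)) h))

      describes : ∀ π m → Matched π m → Describes π (vset m)
      describes π m π~m =
        (λ ψ d∈ → ⇔-trans (path⇔ ψ d∈ π m π~m) (⇔-sym (∈-vset⇔ m (pathElement d∈)))) ,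
        (λ φ d∈ → ⇔-trans (state⇔ φ d∈) (⇔-sym (∈-vset⇔ m (stateElement d∈))))

    described-node : Described (node l sons) (rnode lab rsons)
    described-node =
      (λ π → case match π of λ (m , m∈ , π~m) → vset m , ∈-truth m∈ , describes π m π~m) ,
      (λ v v∈ → case ∈-truth⁻ v∈ of λ { (m , m∈ , refl) →
         case match⁻ m m∈ of λ (π , π~m) → π , describes π m π~m })

  module _ {n B : ℕ} (N≤B : letterBound ≤ B) where

    mutual
      described : ∀ {t : Tree k n} {r} → Agree B t r → Described t r
      described (agree letters below) = described-node N≤B letters (λ c → describedMaybe (below c))

      describedMaybe : ∀ {t : Maybe (Tree k n)} {r} → Pointwise (Agree B) t r → Pointwise Described t r
      describedMaybe nothing  = nothing
      describedMaybe (just a) = just (described a)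

  first-just : ∀ {A : Set} j (f : Fin j → Maybe A) →
               (∀ c → f c ≡ nothing) ⊎ (Σ[ c ∈ Fin j ] Σ[ a ∈ A ] f c ≡ just a)
  first-just zero    f = inj₁ λ ()
  first-just (suc j) f with f zero in eq | first-just j (f ∘ suc)
  ... | just a  | _                  = inj₂ (zero , a , eq)
  ... | nothing | inj₂ (c , a , eq′) = inj₂ (suc c , a , eq′)
  ... | nothing | inj₁ none          = inj₁ λ { zero → eq ; (suc c) → none c }

  PathMaybe : ∀ {n} → Maybe (Tree k n) → Set
  PathMaybe nothing  = ⊤
  PathMaybe (just t) = Path t

  mutual
    -- Ensures that `truthOf` is never empty, so that the state formulas true at the root can be
    -- read off one of its members.
    somePath : ∀ {n} (t : Tree k n) → Path t
    somePath (node l sons) with first-just k sons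
    ... | inj₁ none         = end none
    ... | inj₂ (c , t , eq) = step c eq (subst PathMaybe {y = just t} eq (somePathMaybe (sons c)))

    somePathMaybe : ∀ {n} (t : Maybe (Tree k n)) → PathMaybe t
    somePathMaybe nothing  = tt
    somePathMaybe (just t) = somePath t

  -- All truth sets of the paths of a tree contain the same state elements.
  state-described : ∀ {n B} → letterBound ≤ B → {t : Tree k n} {r : RTree} → Agree B t r →
                    ∀ φ → encodeˢ φ ∈ᴰ subs x → (t ⊨ˢ φ) ⇔ SomeIn (truthOf r) (nil ∙ encodeˢ φ)
  state-described N≤B {t} a φ d∈ = mk⇔
    (λ h → case proj₁ (described N≤B a) (somePath t) of λ (v , v∈ , desc) → v , v∈ , to (proj₂ desc φ d∈) h)
    (λ (v , v∈ , h) → case proj₂ (described N≤B a) v v∈ of λ (_ , desc) → from (proj₂ desc φ d∈) h)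

-- Types of trees

module Types (k′ : ℕ) (x : D) where
  open Procedure k′
  open Trees k′ x
  open Membership k′ x

  mutual
    typ : RTree → D
    typ (rnode lab sons) = typeOf lab (tabulateᴰ (λ c → typSon (sons c))) x

    typSon : Maybe RTree → D
    typSon nothing  = nil
    typSon (just r) = one ∙ typ r

  -- `push` leaves the last bit of `b` in front, so the innermost quantifier owns letter zero, just
  -- as after nested uses of `relabel`.
  data Ext (q : ℕ) : RTree → RTree → Set where
    ext : ∀ {lab sons sons′} b → Bits q b → (∀ c → Pointwise (Ext q) (sons c) (sons′ c)) →
          Ext q (rnode lab sons) (rnode (push b lab) sons′)

  MatchSon : D → D → D → Set
  MatchSon α s t = s ≡ nil × t ≡ nil ⊎ s ≢ nil × t ≢ nil × α ∙ tail t ∈ᴰ tail s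

  match-tabulate : ∀ {j α} {f g : Fin j → D} →
                   Match j α (tabulateᴰ f) (tabulateᴰ g) ⇔ (∀ c → MatchSon α (f c) (g c))
  match-tabulate = mk⇔ forth back
    where
    forth : ∀ {j α} {f g : Fin j → D} → Match j α (tabulateᴰ f) (tabulateᴰ g) → ∀ c → MatchSon α (f c) (g c)
    forth (m , ms) zero    = m
    forth (m , ms) (suc c) = forth ms c

    back : ∀ {j α} {f g : Fin j → D} → (∀ c → MatchSon α (f c) (g c)) → Match j α (tabulateᴰ f) (tabulateᴰ g)
    back {zero}  ms = tt
    back {suc j} ms = ms zero , back (ms ∘ suc)

  truthOf∈ : ∀ r → truthOf r ∈ᴰ truthSets x
  truthOf∈ (rnode lab sons) = pick∈pow _ (pathSets x)

  truthSon∈ : ∀ r → truthSon r ∈ᴰ sonOptions x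
  truthSon∈ nothing  = here
  truthSon∈ (just r) = there (∈-map (one ∙_) (truthOf∈ r))

  quantifiers : D → ℕ
  quantifiers α = len (prefix nil α)

  mutual
    -- The choices made at the root and, recursively, in the sons are assembled into one extension
    -- of the whole tree. Together with `typ⁺` this shows that a type lists exactly the truth sets
    -- of the extensions.
    typ⁻ : ∀ r {α Θ} → α ∙ Θ ∈ᴰ typ r →
           Σ[ r′ ∈ RTree ] Ext (quantifiers α) r r′ × Θ ≡ truthOf r′
    typ⁻ (rnode lab sons) {α} {Θ} w∈ = convert (typeOf⁻ w∈)
      where
      convert : TypeWitness α Θ lab (tabulateᴰ (λ c → typSon (sons c))) →
                Σ[ r′ ∈ RTree ] Ext (quantifiers α) (rnode lab sons) r′ × Θ ≡ truthOf r′
      convert (b , bits , f , f∈ , matched , eq) =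
        rnode (push b lab) (λ c → proj₁ (son′ c)) ,
        ext b bits (λ c → proj₁ (proj₂ (son′ c))) ,
        trans eq (cong (λ θ → Truth.truth (push b lab) (moves θ) x)
                       (tabulateᴰ-cong (λ c → proj₂ (proj₂ (son′ c)))))
        where
        son′ : ∀ c → Σ[ r′ ∈ Maybe RTree ] Pointwise (Ext (quantifiers α)) (sons c) r′ × f c ≡ truthSon r′
        son′ c = typSon⁻ (sons c) (f∈ c) (to (match-tabulate {f = λ c → typSon (sons c)} {f}) matched c)

    typSon⁻ : ∀ r {α s} → s ∈ᴰ sonOptions x → MatchSon α (typSon r) s →
              Σ[ r′ ∈ Maybe RTree ] Pointwise (Ext (quantifiers α)) r r′ × s ≡ truthSon r′
    typSon⁻ nothing  s∈ (inj₁ (_ , refl))     = nothing , nothing , refl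
    typSon⁻ nothing  s∈ (inj₂ (s≢ , _))       = ⊥-elim (s≢ refl)
    typSon⁻ (just r) s∈ (inj₂ (_ , s≢ , w∈)) with s∈
    ... | here       = ⊥-elim (s≢ refl)
    ... | there s∈′ with ∈-map⁻ (one ∙_) (truthSets x) s∈′
    ...   | Θ , _ , refl with typ⁻ r w∈
    ...     | r′ , e , refl = just r′ , just e , refl

  mutual
    typ⁺ : ∀ {α r r′} → α ∈ᴰ subs x → Ext (quantifiers α) r r′ → α ∙ truthOf r′ ∈ᴰ typ r
    typ⁺ {r = rnode _ sons} {rnode _ sons′} α∈ (ext b bits below) =
      typeOf⁺ b (λ c → truthSon (sons′ c)) α∈ bits (λ c → truthSon∈ (sons′ c))
        (from (match-tabulate {f = λ c → typSon (sons c)} {λ c → truthSon (sons′ c)})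
          (λ c → typSon⁺ α∈ (below c)))

    typSon⁺ : ∀ {α r r′} → α ∈ᴰ subs x → Pointwise (Ext (quantifiers α)) r r′ →
              MatchSon α (typSon r) (truthSon r′)
    typSon⁺ α∈ nothing  = inj₁ (refl , refl)
    typSon⁺ α∈ (just e) = inj₂ ((λ ()) , (λ ()) , typ⁺ α∈ e)

  bit : Side → D
  bit true  = one
  bit false = nil

  mutual
    rrelabel : (List (Fin k) → Side) → RTree → RTree
    rrelabel S (rnode lab sons) = rnode (bit (S []) ∙ lab) (λ c → rrelabelMaybe (S ∘ (c ∷_)) (sons c))

    rrelabelMaybe : (List (Fin k) → Side) → Maybe RTree → Maybe RTree
    rrelabelMaybe S nothing  = nothing
    rrelabelMaybe S (just r) = just (rrelabel S r)

  agree-cons : ∀ {n B s} {l : Subset n} {lab} →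
               (∀ p → toℕ p < B → p ∈ l ⇔ Nth lab (toℕ p)) →
               ∀ p → toℕ p < suc B → p ∈ s ∷ l ⇔ Nth (bit s ∙ lab) (toℕ p)
  agree-cons {s = true}  a zero    p< = mk⇔ (λ _ ()) (λ _ → here)
  agree-cons {s = false} a zero    p< = mk⇔ (λ ()) (λ t → ⊥-elim (t refl))
  agree-cons             a (suc p) (s≤s p<) =
    ⇔-trans (mk⇔ (λ { (there q) → q }) there) (a p p<)

  mutual
    agree-relabel : ∀ {n B} S {t : Tree k n} {r} → Agree B t r → Agree (suc B) (relabel S t) (rrelabel S r)
    agree-relabel S (agree a below) =
      agree (agree-cons a) (λ c → agree-relabelMaybe (S ∘ (c ∷_)) (below c))

    agree-relabelMaybe : ∀ {n B} S {t : Maybe (Tree k n)} {r} → Pointwise (Agree B) t r →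
                         Pointwise (Agree (suc B)) (relabelMaybe S t) (rrelabelMaybe S r)
    agree-relabelMaybe S nothing  = nothing
    agree-relabelMaybe S (just a) = just (agree-relabel S a)

  mutual
    ext-refl : ∀ r → Ext 0 r r
    ext-refl (rnode lab sons) = ext nil [] (λ c → ext-reflMaybe (sons c))

    ext-reflMaybe : ∀ r → Pointwise (Ext 0) r r
    ext-reflMaybe nothing  = nothing
    ext-reflMaybe (just r) = just (ext-refl r)

  mutual
    -- Sons are given by functions, so an extension by no bits is equal to the tree only pointwise;
    -- agreement is transported along it instead.
    agree-ext : ∀ {n B} {t : Tree k n} {r r′} → Agree B t r → Ext 0 r r′ → Agree B t r′
    agree-ext (agree a below) (ext nil [] below′) =
      agree a (λ c → agree-extMaybe (below c) (below′ c))

    agree-extMaybe : ∀ {n B} {t : Maybe (Tree k n)} {r r′} → Pointwise (Agree B) t r →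
                     Pointwise (Ext 0) r r′ → Pointwise (Agree B) t r′
    agree-extMaybe nothing  nothing  = nothing
    agree-extMaybe (just a) (just e) = just (agree-ext a e)

  bits-cons : ∀ {q b} s → Bits q b → Bits (suc q) (bit s ∙ b)
  bits-cons true  bs = on∷ bs
  bits-cons false bs = off∷ bs

  mutual
    ext-relabel : ∀ {q} S r {r′} → Ext q (rrelabel S r) r′ → Ext (suc q) r r′
    ext-relabel S (rnode lab sons) (ext b bits below) =
      ext (bit (S []) ∙ b) (bits-cons (S []) bits) (λ c → ext-relabelMaybe (S ∘ (c ∷_)) (sons c) (below c))

    ext-relabelMaybe : ∀ {q} S r {r′} → Pointwise (Ext q) (rrelabelMaybe S r) r′ → Pointwise (Ext (suc q)) r r′
    ext-relabelMaybe S nothing  nothing  = nothing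
    ext-relabelMaybe S (just r) (just e) = just (ext-relabel S r e)

  mutual
    ext-relabel⁻ : ∀ {q r r′} → Ext (suc q) r r′ → Σ[ S ∈ (List (Fin k) → Side) ] Ext q (rrelabel S r) r′
    ext-relabel⁻ (ext (_ ∙ b) (on∷ bits) below) =
      (λ { [] → true ; (c ∷ cs) → proj₁ (ext-relabelMaybe⁻ (below c)) cs }) ,
      ext b bits (λ c → proj₂ (ext-relabelMaybe⁻ (below c)))
    ext-relabel⁻ (ext (_ ∙ b) (off∷ bits) below) =
      (λ { [] → false ; (c ∷ cs) → proj₁ (ext-relabelMaybe⁻ (below c)) cs }) ,
      ext b bits (λ c → proj₂ (ext-relabelMaybe⁻ (below c)))

    ext-relabelMaybe⁻ : ∀ {q r r′} → Pointwise (Ext (suc q)) r r′ →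
                        Σ[ S ∈ (List (Fin k) → Side) ] Pointwise (Ext q) (rrelabelMaybe S r) r′
    ext-relabelMaybe⁻ nothing  = (λ _ → false) , nothing
    ext-relabelMaybe⁻ (just e) = proj₁ (ext-relabel⁻ e) , just (proj₂ (ext-relabel⁻ e))

  prenex : ∀ {n} → EQCTL* k n → ℕ
  prenex (ctl* φ) = 0
  prenex (∃̇ α)    = suc (prenex α)

  prenex≡ : ∀ {n} (α : EQCTL* k n) c → len (prefix c (encodeᵗ α)) ≡ prenex α + len c
  prenex≡ (ctl* φ) c = refl
  prenex≡ (∃̇ α)    c = trans (prenex≡ α (nil ∙ c)) (+-suc (prenex α) (len c))

  matrix∈ : ∀ α → α ∈ᴰ subs x → matrix α ∈ᴰ subs x
  matrix∈ nil           α∈ = α∈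
  matrix∈ (nil ∙ d)     α∈ = proj₂ (closed α∈)
  matrix∈ ((_ ∙ _) ∙ d) α∈ = matrix∈ d (proj₂ (closed α∈))

  module _ {n : ℕ} where

    TruthAfterExt : EQCTL* k n → RTree → Set
    TruthAfterExt α r =
      Σ[ r′ ∈ RTree ] Ext (prenex α) r r′ × SomeIn (truthOf r′) (nil ∙ matrix (encodeᵗ α))

  -- Induction on the prefix. Each quantifier shifts the letters by one and raises the bound of
  -- agreement by one, whence the general `B` above `letterBound`.
  quantified⇔ : ∀ {n B} → letterBound ≤ B → {t : Tree k n} {r : RTree} → Agree B t r →
                ∀ α → matrix (encodeᵗ α) ∈ᴰ subs x → (t ⊨ᵗ α) ⇔ TruthAfterExt α r
  quantified⇔ N≤B {r = r} a (ctl* φ) m∈ = mk⇔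
    (λ h → r , ext-refl r , to (state-described N≤B a φ m∈) h)
    (λ (r′ , e , h) → from (state-described N≤B (agree-ext a e) φ m∈) h)
  quantified⇔ N≤B {r = r} a (∃̇ α) m∈ = mk⇔
    (λ (S , h) → case to (quantified⇔ (m≤n⇒m≤1+n N≤B) (agree-relabel S a) α m∈) h of λ (r′ , e , h′) →
       r′ , ext-relabel S r e , h′)
    (λ (r′ , e , h) → case ext-relabel⁻ e of λ (S , e′) →
       S , from (quantified⇔ (m≤n⇒m≤1+n N≤B) (agree-relabel S a) α m∈) (r′ , e′ , h))

  HoldsIn : D → D → Set
  HoldsIn α T = Some T λ w → head w ≡ α × Some (tail w) (nil ∙ matrix α ∈ᴰ_)

  typ-pair : ∀ r {w} → w ∈ᴰ typ r → Some (subs x) λ α → Some (truthSets x) λ Θ → w ≡ α ∙ Θ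
  typ-pair (rnode lab sons) w∈ = typeOf-pair w∈

  holds⇔ : ∀ {n} {t : Tree k n} {r : RTree} → Agree letterBound t r →
           ∀ α → encodeᵗ α ∈ᴰ subs x → (t ⊨ᵗ α) ⇔ HoldsIn (encodeᵗ α) (typ r)
  holds⇔ {r = r} a α α∈ = ⇔-trans (quantified⇔ ≤-refl a α (matrix∈ (encodeᵗ α) α∈)) (mk⇔
    (λ (r′ , e , h) → encodeᵗ α ∙ truthOf r′ ,
       typ⁺ α∈ (subst (λ q → Ext q r r′) (sym count) e) , refl , h)
    back)
    where
    count : quantifiers (encodeᵗ α) ≡ prenex α
    count = trans (prenex≡ α nil) (+-identityʳ (prenex α))

    back : HoldsIn (encodeᵗ α) (typ r) → TruthAfterExt α r
    back (w , w∈ , eq , h) with typ-pair r w∈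
    back (w , w∈ , refl , h) | _ , _ , _ , _ , refl with typ⁻ r w∈
    ... | r′ , e , refl = r′ , subst (λ q → Ext q r r′) count e , h

-- Layered structures

divMod-unique : ∀ {k} q a (r c : Fin k) → toℕ r + q * k ≡ toℕ c + a * k → q ≡ a × r ≡ c
divMod-unique {k} zero    zero    r c eq =
  refl , toℕ-injective (trans (sym (+-identityʳ (toℕ r))) (trans eq (+-identityʳ (toℕ c))))
divMod-unique {k} zero    (suc a) r c eq = ⊥-elim (<⇒≱ (toℕ<n r) (begin
  k                        ≤⟨ m≤m+n k (a * k) ⟩
  k + a * k                ≤⟨ m≤n+m _ (toℕ c) ⟩
  toℕ c + (k + a * k)      ≡⟨ sym eq ⟩
  toℕ r + 0                ≡⟨ +-identityʳ (toℕ r) ⟩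
  toℕ r                    ∎))
  where open ≤-Reasoning
divMod-unique {k} (suc q) zero    r c eq = ⊥-elim (<⇒≱ (toℕ<n c) (begin
  k                        ≤⟨ m≤m+n k (q * k) ⟩
  k + q * k                ≤⟨ m≤n+m _ (toℕ r) ⟩
  toℕ r + (k + q * k)      ≡⟨ eq ⟩
  toℕ c + 0                ≡⟨ +-identityʳ (toℕ c) ⟩
  toℕ c                    ∎))
  where open ≤-Reasoning
divMod-unique {k} (suc q) (suc a) r c eq with divMod-unique q a r c
  (+-cancelˡ-≡ k _ _ (trans (swap (toℕ r) (q * k)) (trans eq (sym (swap (toℕ c) (a * k))))))
  where
  swap : ∀ r m → k + (r + m) ≡ r + (k + m)
  swap r m = lemma k r m
    where
    lemma : ∀ k r m → k + (r + m) ≡ r + (k + m)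
    lemma = solve-∀
... | refl , refl = refl , refl

module Layers (k″ : ℕ) (x : D) where

  k′ : ℕ
  k′ = suc k″

  open Procedure k′
  open Trees k′ x
  open Membership k′ x
  open Types k′ x

  almost : {A : Set} → (Fin k′ → A) → Fin k → Maybe A
  almost rs zero    = nothing
  almost rs (suc c) = just (rs c)

  data Full : ℕ → RTree → Set where
    leaf   : ∀ {lab} → Bits letterBound lab → Full 0 (rnode lab (λ _ → nothing))
    branch : ∀ {i lab} → Bits letterBound lab → (rs : Fin k → RTree) → (∀ c → Full i (rs c)) →
             Full (suc i) (rnode lab (λ c → just (rs c)))

  data Almost : ℕ → RTree → Set where
    leaf   : ∀ {lab} → Bits letterBound lab → Almost 0 (rnode lab (λ _ → nothing))
    branch : ∀ {i lab} → Bits letterBound lab → (rs : Fin k′ → RTree) → (∀ c → Full i (rs c)) →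
             Almost (suc i) (rnode lab (almost rs))

  fullTypes almostTypes : ℕ → D
  fullTypes zero    = typesOver leafSons x
  fullTypes (suc i) = typesOver (fullSons (fullTypes i)) x
  almostTypes zero    = typesOver leafSons x
  almostTypes (suc i) = typesOver (almostSons (fullTypes i)) x

  sons∈ : ∀ {j l} (rs : Fin j → RTree) → (∀ c → typ (rs c) ∈ᴰ l) →
          tabulateᴰ (λ c → one ∙ typ (rs c)) ∈ᴰ tuples j (mapᴰ (one ∙_) l)
  sons∈ rs rs∈ = ∈-tuples (λ c → ∈-map (one ∙_) (rs∈ c))

  sons∈⁻ : ∀ j {l σ} {P : RTree → Set} → σ ∈ᴰ tuples j (mapᴰ (one ∙_) l) →
           (∀ {T} → T ∈ᴰ l → Σ[ r ∈ RTree ] P r × T ≡ typ r) →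
           Σ[ rs ∈ (Fin j → RTree) ] (∀ c → P (rs c)) × σ ≡ tabulateᴰ (λ c → one ∙ typ (rs c))
  sons∈⁻ j {l} {P = P} σ∈ realize with ∈-tuples⁻ j {mapᴰ (one ∙_) l} σ∈
  ... | f , f∈ , refl = (λ c → proj₁ (son c)) , (λ c → proj₁ (proj₂ (son c))) ,
                        tabulateᴰ-cong (λ c → proj₂ (proj₂ (son c)))
    where
    son : ∀ c → Σ[ r ∈ RTree ] P r × f c ≡ one ∙ typ r
    son c with ∈-map⁻ (one ∙_) l (f∈ c)
    ... | T , T∈ , eq with realize T∈
    ...   | r , p , refl = r , p , eq

  fullTypes⁺ : ∀ {i r} → Full i r → typ r ∈ᴰ fullTypes i
  fullTypes⁺ (leaf bits)           = typesOver⁺ bits here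
  fullTypes⁺ (branch bits rs full) = typesOver⁺ bits (sons∈ rs (λ c → fullTypes⁺ (full c)))

  fullTypes⁻ : ∀ i {T} → T ∈ᴰ fullTypes i → Σ[ r ∈ RTree ] Full i r × T ≡ typ r
  fullTypes⁻ zero    T∈ with typesOver⁻ T∈
  ... | lab , bits , _ , here , refl = _ , leaf bits , refl
  fullTypes⁻ (suc i) T∈ with typesOver⁻ T∈
  ... | lab , bits , σ , σ∈ , refl with sons∈⁻ k σ∈ (fullTypes⁻ i)
  ...   | rs , full , refl = _ , branch bits rs full , refl

  almostTypes⁺ : ∀ {i r} → Almost i r → typ r ∈ᴰ almostTypes i
  almostTypes⁺ (leaf bits)           = typesOver⁺ bits here
  almostTypes⁺ (branch bits rs full) =
    typesOver⁺ bits (∈-map (nil ∙_) (sons∈ rs (λ c → fullTypes⁺ (full c))))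

  almostTypes⁻ : ∀ i {T} → T ∈ᴰ almostTypes i → Σ[ r ∈ RTree ] Almost i r × T ≡ typ r
  almostTypes⁻ zero    T∈ with typesOver⁻ T∈
  ... | lab , bits , _ , here , refl = _ , leaf bits , refl
  almostTypes⁻ (suc i) T∈ with typesOver⁻ T∈
  ... | lab , bits , σ , σ∈ , refl
    with ∈-map⁻ (nil ∙_) (tuples k′ (mapᴰ (one ∙_) (fullTypes i))) σ∈
  ...   | σ′ , σ′∈ , refl with sons∈⁻ k′ σ′∈ (fullTypes⁻ i)
  ...     | rs , full , refl = _ , branch bits rs full , refl

  module _ {n : ℕ} where

    -- The number of letters may lie on either side of `letterBound`: excess letters are cut off and
    -- missing ones are filled with false.
    pad : ∀ {n} → ℕ → Subset n → D
    pad zero    l       = nil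
    pad (suc N) []      = nil ∙ pad N []
    pad (suc N) (s ∷ l) = bit s ∙ pad N l

    pad-bits : ∀ {n} N (l : Subset n) → Bits N (pad N l)
    pad-bits zero    l       = []
    pad-bits (suc N) []      = off∷ (pad-bits N [])
    pad-bits (suc N) (s ∷ l) = bits-cons s (pad-bits N l)

    pad-agree : ∀ {n} N (l : Subset n) p → toℕ p < N → p ∈ l ⇔ Nth (pad N l) (toℕ p)
    pad-agree (suc N) (s ∷ l) = agree-cons (pad-agree N l)

    unpad : ∀ n → D → Subset n
    unpad zero    d = []
    unpad (suc n) d = does (≢nil? (head d)) ∷ unpad n (tail d)

    unpad-agree : ∀ n d p → p ∈ unpad n d ⇔ Nth d (toℕ p)
    unpad-agree (suc n) d zero with head d
    ... | nil   = mk⇔ (λ ()) (λ t → ⊥-elim (t refl))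
    ... | _ ∙ _ = mk⇔ (λ _ ()) (λ _ → here)
    unpad-agree (suc n) d (suc p) = ⇔-trans (mk⇔ (λ { (there q) → q }) there) (unpad-agree n (tail d) p)

    module _ (M : UULS k n) where

      rawSubtree : ∀ {i} → T i → RTree
      rawSubtree {zero}  y = rnode (pad letterBound (labelling M y)) (λ _ → nothing)
      rawSubtree {suc i} y = rnode (pad letterBound (labelling M y)) (λ c → just (rawSubtree (↓ c y)))

      rawSubtree-full : ∀ {i} (y : T i) → Full i (rawSubtree y)
      rawSubtree-full {zero}  y = leaf (pad-bits letterBound (labelling M y))
      rawSubtree-full {suc i} y =
        branch (pad-bits letterBound (labelling M y)) _ (λ c → rawSubtree-full (↓ c y))

      rawSubtree-agree : ∀ {i} (y : T i) → Agree letterBound (subtree M y) (rawSubtree y)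
      rawSubtree-agree {zero}  y = agree (pad-agree letterBound (labelling M y)) (λ _ → nothing)
      rawSubtree-agree {suc i} y =
        agree (pad-agree letterBound (labelling M y)) (λ c → just (rawSubtree-agree (↓ c y)))

      rawTreeAt : ℕ → RTree
      rawTreeAt zero    = rnode (pad letterBound (labelling M {0} (pt 0))) (λ _ → nothing)
      rawTreeAt (suc i) = rnode (pad letterBound (labelling M {suc i} (pt 0)))
                                (almost (λ c → rawSubtree {i} (↓ (suc c) (pt 0))))

      rawTreeAt-almost : ∀ i → Almost i (rawTreeAt i)
      rawTreeAt-almost zero    = leaf (pad-bits letterBound _)
      rawTreeAt-almost (suc i) = branch (pad-bits letterBound _) _ (λ c → rawSubtree-full _)

      rawTreeAt-agree : ∀ i → Agree letterBound (treeAt M i) (rawTreeAt i)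
      rawTreeAt-agree zero    = agree (pad-agree letterBound (labelling M {0} (pt 0))) (λ _ → nothing)
      rawTreeAt-agree (suc i) = agree (pad-agree letterBound (labelling M {suc i} (pt 0)))
        λ { zero → nothing ; (suc c) → just (rawSubtree-agree _) }

  -- Conversely, any sequence of almost complete trees is the sequence of a UULS:
  -- the point jᵢ lies in the tree number h and is reached there by the path π if
  -- locate i j is (h , π).
  snoc : ℕ × List (Fin k) → Fin k → ℕ × List (Fin k)
  snoc (h , π) c = h , π ++ c ∷ []

  -- For positive `j`, the point is the son, with the remainder of `j` modulo `k` as its index, of
  -- the point on the next layer whose index is the quotient. As `k` is at least 2, the quotient is
  -- smaller than `j`, so `j` is enough fuel, and the ascent ends at a leftmost point, the root of a
  -- tree of the sequence.
  locateFuel : ℕ → ℕ → ℕ → ℕ × List (Fin k)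
  locateFuel f       i zero    = i , []
  locateFuel zero    i (suc j) = i , []
  locateFuel (suc f) i (suc j) =
    snoc (locateFuel f (suc i) (DivMod.quotient (suc j divMod k))) (DivMod.remainder (suc j divMod k))

  locate : ℕ → ℕ → ℕ × List (Fin k)
  locate i j = locateFuel j i j

  quotient≤ : ∀ q (r : Fin k) j → suc j ≡ toℕ r + q * k → q ≤ j
  quotient≤ zero    r j eq = z≤n
  quotient≤ (suc q) r j eq = ≤-pred (begin
    suc (suc q)                ≤⟨ s≤s (m≤m+n (suc q) q) ⟩
    suc (suc q + q)            ≡⟨ lemma q ⟩
    suc q * 2                  ≤⟨ *-monoʳ-≤ (suc q) (s≤s (s≤s z≤n)) ⟩
    suc q * k                  ≤⟨ m≤n+m _ (toℕ r) ⟩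
    toℕ r + suc q * k          ≡⟨ sym eq ⟩
    suc j                      ∎)
    where
    open ≤-Reasoning
    lemma : ∀ q → suc (suc q + q) ≡ suc q * 2
    lemma = solve-∀

  locateFuel-irrelevant : ∀ f f′ i j → j ≤ f → j ≤ f′ → locateFuel f i j ≡ locateFuel f′ i j
  locateFuel-irrelevant f       f′       i zero    _        _         = refl
  locateFuel-irrelevant (suc f) (suc f′) i (suc j) (s≤s j≤f) (s≤s j≤f′) =
    cong (λ p → snoc p (remainder dm)) (locateFuel-irrelevant f f′ (suc i) (quotient dm)
      (≤-trans q≤j j≤f) (≤-trans q≤j j≤f′))
    where
    open DivMod
    dm = suc j divMod k
    q≤j : quotient dm ≤ j
    q≤j = quotient≤ (quotient dm) (remainder dm) j (property dm)

  locate-snoc : ∀ i a (c : Fin k) j → j ≡ a * k + toℕ c → j ≢ 0 → locate i j ≡ snoc (locate (suc i) a) c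
  locate-snoc i a c zero    eq j≢0 = ⊥-elim (j≢0 refl)
  locate-snoc i a c (suc j) eq j≢0 = begin
    snoc (locateFuel j (suc i) q) r
      ≡⟨ cong (λ p → snoc p r) (locateFuel-irrelevant j q (suc i) q (quotient≤ q r j property) ≤-refl) ⟩
    snoc (locate (suc i) q) r
      ≡⟨ cong₂ (λ q r → snoc (locate (suc i) q) r) (proj₁ unique) (proj₂ unique) ⟩
    snoc (locate (suc i) a) c ∎
    where
    open ≡-Reasoning
    open DivMod (suc j divMod k) renaming (quotient to q; remainder to r)
    unique = divMod-unique q a r c (trans (sym property) (trans eq (+-comm (a * k) (toℕ c))))

  mutual
    subtreeAt : RTree → List (Fin k) → Maybe RTree
    subtreeAt r                []      = just r
    subtreeAt (rnode lab sons) (c ∷ π) = subtreeAtMaybe (sons c) π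

    subtreeAtMaybe : Maybe RTree → List (Fin k) → Maybe RTree
    subtreeAtMaybe nothing  π = nothing
    subtreeAtMaybe (just r) π = subtreeAt r π

  sonOf : Fin k → Maybe RTree → Maybe RTree
  sonOf c nothing                = nothing
  sonOf c (just (rnode lab sons)) = sons c

  subtreeAt-snoc : ∀ r π c → subtreeAt r (π ++ c ∷ []) ≡ sonOf c (subtreeAt r π)
  subtreeAt-snoc (rnode lab sons) [] c with sons c
  ... | nothing = refl
  ... | just r  = refl
  subtreeAt-snoc (rnode lab sons) (d ∷ π) c with sons d
  ... | nothing = refl
  ... | just r  = subtreeAt-snoc r π c

  rootLabel : Maybe RTree → D
  rootLabel nothing               = nil
  rootLabel (just (rnode lab _)) = lab

  module Glue (n : ℕ) (r : ℕ → RTree) (r-almost : ∀ i → Almost i (r i)) where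

    rawAt : ℕ × List (Fin k) → Maybe RTree
    rawAt (h , π) = subtreeAt (r h) π

    rawAt-snoc : ∀ p c → rawAt (snoc p c) ≡ sonOf c (rawAt p)
    rawAt-snoc (h , π) c = subtreeAt-snoc (r h) π c

    model : UULS k n
    labelling model {i} (pt j) = unpad {n} n (rootLabel (rawAt (locate i j)))

    ↓-nonzero : ∀ j c → j ≢ 0 → j * k + toℕ {k} c ≢ 0
    ↓-nonzero zero    c j≢0 _ = j≢0 refl
    ↓-nonzero (suc j) c j≢0 ()

    rootAgree : ∀ {m lab sons} → m ≡ just (rnode lab sons) →
                ∀ p → toℕ p < letterBound → p ∈ unpad {n} n (rootLabel m) ⇔ Nth lab (toℕ p)
    rootAgree {lab = lab} refl p _ = unpad-agree {n} n lab p

    -- Leftmost points are roots of trees of their own and are excluded. The descendants of a point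
    -- with nonzero index again have nonzero indices, so they stay in the same tree.
    subtree-agree : ∀ {i raw} → Full i raw → ∀ j → j ≢ 0 → rawAt (locate i j) ≡ just raw →
                    Agree letterBound (subtree {i = i} model (pt j)) raw
    subtree-agree (leaf bits) j j≢0 eq = agree (rootAgree eq) (λ _ → nothing)
    subtree-agree {suc i} (branch bits rs full) j j≢0 eq = agree (rootAgree eq) λ c →
      just (subtree-agree (full c) (j * k + toℕ c) (↓-nonzero j c j≢0)
        (trans (cong rawAt (locate-snoc i j c _ refl (↓-nonzero j c j≢0)))
          (trans (rawAt-snoc (locate (suc i) j) c) (cong (sonOf c) eq))))

    treeAt-agree′ : ∀ i {raw} → Almost i raw → r i ≡ raw → Agree letterBound (treeAt model i) raw
    treeAt-agree′ zero    (leaf bits) eq = agree (rootAgree (cong just eq)) (λ _ → nothing)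
    treeAt-agree′ (suc i) (branch bits rs full) eq = agree (rootAgree (cong just eq))
      λ { zero    → nothing
        ; (suc c) → just (subtree-agree (full c) (suc (toℕ c)) (λ ())
            (trans (cong rawAt (locate-snoc i 0 (suc c) _ refl (λ ())))
              (trans (rawAt-snoc (suc i , []) (suc c)) (cong (sonOf (suc c) ∘ just) eq)))) }

    treeAt-agree : ∀ i → Agree letterBound (treeAt model i) (r i)
    treeAt-agree i = treeAt-agree′ i (r-almost i) refl

-- Completeness

¬¬-map : {A B : Set} → (A → B) → ¬ ¬ A → ¬ ¬ B
¬¬-map f ¬¬a ¬b = ¬¬a (¬b ∘ f)

¬¬-dec : {A : Set} → ¬ ¬ Dec A
¬¬-dec ¬d = ¬d (no (λ a → ¬d (yes a)))

-- Double negation does not commute with quantification over all instants; this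
-- finite instance is enough, since only finitely many stages can be visited.
¬¬-test : (P : D → Set) → ∀ l → ¬ ¬ (Σ[ b ∈ (D → D) ] (∀ y → y ∈ᴰ l → b y ≢ nil ⇔ P y))
¬¬-test P nil     none = none ((λ _ → nil) , λ _ ())
¬¬-test P (y ∙ l) none = ¬¬-test P l λ (b , ok) → ¬¬-dec λ P? →
  none ((λ z → extend b P? z (z ≟ᴰ y)) , λ z z∈ → extended b ok P? z (z ≟ᴰ y) z∈)
  where
  extend : (D → D) → Dec (P y) → ∀ z → Dec (z ≡ y) → D
  extend b P? z (yes _) = ⟨ P? ⟩?
  extend b P? z (no _)  = b z

  extended : ∀ b → (∀ z → z ∈ᴰ l → b z ≢ nil ⇔ P z) → ∀ P? z z≟y → z ∈ᴰ y ∙ l →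
             extend b P? z z≟y ≢ nil ⇔ P z
  extended b ok P? z (yes refl) z∈         = ⟨⟩?⇔ P?
  extended b ok P? z (no z≢y)   here       = ⊥-elim (z≢y refl)
  extended b ok P? z (no z≢y)   (there z∈) = ok z z∈

switch-len : ∀ d {n} Ps → len d ≡ n → Switch d Ps ≡ Switch (unary n) Ps
switch-len nil     []       refl = refl
switch-len nil     (_ ∷ _)  refl = refl
switch-len (_ ∙ d) []       refl = refl
switch-len (_ ∙ d) (_ ∷ Ps) refl = switch-len d Ps refl

-- Here the equivalence for a case may assume that this case is selected. The letter and until cases
-- of the linear conditions require this: they mention the code `u` itself, whose truth unfolds only
-- when its tag is known.
data Switchesˡ (n : ℕ) : ℕ → List Set → List Set → Set₁ where
  []  : ∀ {j} → Switchesˡ n j [] []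
  _∷_ : ∀ {j P Q Ps Qs} → (n ≡ j → P ⇔ Q) → Switchesˡ n (suc j) Ps Qs → Switchesˡ n j (P ∷ Ps) (Q ∷ Qs)

switch-congˡ : ∀ d j {Ps Qs} → Switchesˡ (len d + j) j Ps Qs → Switch d Ps ⇔ Switch d Qs
switch-congˡ nil     j []       = ⇔-refl
switch-congˡ (_ ∙ d) j []       = ⇔-refl
switch-congˡ nil     j (p ∷ ps) = p refl
switch-congˡ (_ ∙ d) j {_ ∷ Ps} {_ ∷ Qs} (p ∷ ps) =
  switch-congˡ d (suc j) (subst (λ n → Switchesˡ n (suc j) Ps Qs) (sym (+-suc (len d) j)) ps)

-- The semantics of PLTL on codes, at instant i, with B for the quantified letters
-- and T for the types of the trees.
module Linear (k″ : ℕ) (x : D) (B : ℕ → ℕ → Set) (T : ℕ → D) where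
  open Layers k″ x
  open Procedure k′
  open Trees k′ x using (closed)
  open Types k′ x using (HoldsIn)

  Letter : D → ℕ → Set
  Letter e i = Switch (head e) (B i (value (tail e)) ∷ HoldsIn (tail e) (T i) ∷ [])

  Until≥ : (ℕ → Set) → (ℕ → Set) → ℕ → Set
  Until≥ P Q i = Σ[ y ∈ ℕ ] i ≤ y × Q y × (∀ z → i ≤ z → z < y → P z)

  module _ (op e : D) (V Vₕ Vₜ : ℕ → Set) where

    truthAt : ℕ → Set
    truthAt i = Switch op
      ( Letter e i
      ∷ (¬ V i)
      ∷ (Vₕ i × Vₜ i)
      ∷ V (suc i)
      ∷ (¬ ¬ Until≥ Vₕ Vₜ i)
      ∷ [])

  True  : D → ℕ → Set
  True₃ : D → (ℕ → Set) × (ℕ → Set) × (ℕ → Set)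

  True nil      = Letter nil
  True (op ∙ e) = truthAt op e (proj₁ (True₃ e)) (proj₁ (proj₂ (True₃ e))) (proj₂ (proj₂ (True₃ e)))

  True₃ nil      = Letter nil , Letter nil , Letter nil
  True₃ (op ∙ e) = True (op ∙ e) , True op , True e

  True₃≡ : ∀ e → True₃ e ≡ (True e , True (head e) , True (tail e))
  True₃≡ nil     = refl
  True₃≡ (_ ∙ _) = refl

  cases : D → ℕ → List Set
  cases u i =
    ( Letter (tail u) i
    ∷ (¬ True (tail u) i)
    ∷ (True (head (tail u)) i × True (tail (tail u)) i)
    ∷ True (tail u) (suc i)
    ∷ (¬ ¬ Until≥ (True (head (tail u))) (True (tail (tail u))) i)
    ∷ [])

  True≡ : ∀ u i → True u i ≡ Switch (head u) (cases u i)
  True≡ nil      i = refl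
  True≡ (op ∙ e) i rewrite True₃≡ e = refl

  True-case : ∀ u i {n} → len (head u) ≡ n → True u i ≡ Switch (unary n) (cases u i)
  True-case u i eq = trans (True≡ u i) (switch-len (head u) (cases u i) eq)

  -- The expansion law of until. A disjunction cannot be extracted from a double negation alone, so
  -- decisions of `P i` and `Q i` are supplied; they will come from membership in the list of true
  -- codes.
  until-unfold : ∀ {P Q : ℕ → Set} i → Dec (P i) → Dec (Q i) →
                 (¬ ¬ Until≥ P Q i) ⇔ (Q i ⊎ (P i × (¬ ¬ Until≥ P Q (suc i))))
  until-unfold {P} {Q} i P? Q? = mk⇔ (forth P? Q?) back
    where
    later′ : ¬ Q i → Until≥ P Q i → P i × Until≥ P Q (suc i)
    later′ ¬q (y , i≤y , q , ps) with m≤n⇒m<n∨m≡n i≤y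
    ... | inj₂ refl = ⊥-elim (¬q q)
    ... | inj₁ i<y  = ps i ≤-refl i<y , y , i<y , q , (λ z i<z z<y → ps z (<⇒≤ i<z) z<y)

    forth : Dec (P i) → Dec (Q i) → ¬ ¬ Until≥ P Q i → Q i ⊎ (P i × (¬ ¬ Until≥ P Q (suc i)))
    forth _       (yes q) _   = inj₁ q
    forth (yes p) (no ¬q) ¬¬u = inj₂ (p , ¬¬-map (proj₂ ∘ later′ ¬q) ¬¬u)
    forth (no ¬p) (no ¬q) ¬¬u = ⊥-elim (¬¬u (¬p ∘ proj₁ ∘ later′ ¬q))

    extend : P i → Until≥ P Q (suc i) → Until≥ P Q i
    extend p (y , i<y , q , ps) = y , <⇒≤ i<y , q , λ z i≤z z<y →
      [ (λ i<z → ps z i<z z<y) , (λ { refl → p }) ]′ (m≤n⇒m<n∨m≡n i≤z)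

    back : Q i ⊎ (P i × (¬ ¬ Until≥ P Q (suc i))) → ¬ ¬ Until≥ P Q i
    back (inj₁ q)         ¬u = ¬u (i , ≤-refl , q , λ z i≤z z<i → ⊥-elim (<⇒≱ z<i i≤z))
    back (inj₂ (p , ¬¬u)) ¬u = ¬¬u (¬u ∘ extend p)

  -- Truth at an instant has no decision procedure; `b` is a decision for the finitely many
  -- subterms, and its existence is shown up to double negation.
  Truthful : ℕ → D → Set
  Truthful i p = Σ[ b ∈ (D → D) ]
    p ≡ select b nil (subs x) × (∀ u → u ∈ᴰ subs x → b u ≢ nil ⇔ True u i)

  truthful⇔ : ∀ {i p u} → Truthful i p → u ∈ᴰ subs x → u ∈ᴰ p ⇔ True u i
  truthful⇔ {u = u} (b , refl , ok) u∈ = mk⇔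
    (λ u∈p → [ (λ (_ , bu) → to (ok u u∈) bu) , (λ ()) ]′ (∈-select⁻ b nil (subs x) u∈p))
    (λ t → ∈-select b nil (subs x) u∈ (from (ok u u∈) t))

  ¬¬-truthful : ∀ i → ¬ ¬ (Σ[ p ∈ D ] Truthful i p)
  ¬¬-truthful i = ¬¬-map (λ (b , ok) → _ , b , refl , ok) (¬¬-test (λ u → True u i) (subs x))

  truthful-local : ∀ {i p p′} → Truthful i p → Truthful (suc i) p′ → ∀ u → u ∈ᴰ subs x →
                   True u i ⇔ LocalLinear (_∈ᴰ p) (_∈ᴰ p′) (T i) u
  truthful-local {i} {p} {p′} tp tp′ u u∈ = ⇔-trans (≡⇒⇔ (True≡ u i)) (go u u∈)
    where
    p⇔ : ∀ {u} → u ∈ᴰ subs x → True u i ⇔ u ∈ᴰ p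
    p⇔ u∈ = ⇔-sym (truthful⇔ tp u∈)

    p′⇔ : ∀ {u} → u ∈ᴰ subs x → True u (suc i) ⇔ u ∈ᴰ p′
    p′⇔ u∈ = ⇔-sym (truthful⇔ tp′ u∈)

    true? : ∀ {u} → u ∈ᴰ subs x → Dec (True u i)
    true? {u} u∈ = map′ (from (p⇔ u∈)) (to (p⇔ u∈)) (u ∈ᴰ? p)

    +0 : ∀ {m n} → m + 0 ≡ n → m ≡ n
    +0 {m} eq = trans (sym (+-identityʳ m)) eq

    letter⇔ : ∀ u → u ∈ᴰ subs x → len (head u) ≡ 0 →
              Letter (tail u) i ⇔ Switch (head (tail u)) ((u ∈ᴰ p) ∷ HoldsIn (tail (tail u)) (T i) ∷ [])
    letter⇔ u u∈ eq = switch-congˡ (head (tail u)) 0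
      ( (λ eq′ → ⇔-trans (≡⇒⇔ (sym (trans (True-case u i eq) (switch-len (head (tail u)) (B i (value (tail (tail u))) ∷ HoldsIn (tail (tail u)) (T i) ∷ []) (+0 eq′))))) (p⇔ u∈))
      ∷ (λ _ → ⇔-refl)
      ∷ [])

    until⇔ : ∀ u → u ∈ᴰ subs x → len (head u) ≡ 4 →
             (¬ ¬ Until≥ (True (head (tail u))) (True (tail (tail u))) i) ⇔
             (tail (tail u) ∈ᴰ p ⊎ (head (tail u) ∈ᴰ p × u ∈ᴰ p′))
    until⇔ u u∈ eq = ⇔-trans (until-unfold i (true? h∈) (true? t∈))
      (⇔-⊎ (p⇔ t∈) (⇔-× (p⇔ h∈) (⇔-trans (≡⇒⇔ (sym (True-case u (suc i) eq))) (p′⇔ u∈))))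
      where
      h∈ = proj₁ (closed (proj₂ (closed u∈)))
      t∈ = proj₂ (closed (proj₂ (closed u∈)))

    go : ∀ u → u ∈ᴰ subs x → Switch (head u) (cases u i) ⇔ LocalLinear (_∈ᴰ p) (_∈ᴰ p′) (T i) u
    go u u∈ = switch-congˡ (head u) 0
      ( letter⇔ u u∈ ∘ +0
      ∷ (λ _ → ⇔-¬ (p⇔ e∈))
      ∷ (λ _ → ⇔-× (p⇔ (proj₁ (closed e∈))) (p⇔ (proj₂ (closed e∈))))
      ∷ (λ _ → p′⇔ e∈)
      ∷ until⇔ u u∈ ∘ +0
      ∷ [])
      where
      e∈ = proj₂ (closed u∈)

module Completeness (k″ n : ℕ) where

  private
    A : Set
    A = MonolithicEQCTL* (suc (suc k″)) n

  encodeMatrix : ∀ {m} → PLTL (Fin m ⊎ A) → D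
  encodeMatrix = encodePLTL encodeLetter

  stripHolds : ∀ {m} W (B : ℕ → Subset m) (φ : EQLTL A m) → Holds W B 0 φ →
               Σ[ m′ ∈ ℕ ] Σ[ ψ ∈ PLTL (Fin m′ ⊎ A) ] Σ[ B′ ∈ (ℕ → Subset m′) ]
                 (B′ ⊕ W , 0 ⊨ ψ) × matrix (encodeEQLTL φ) ≡ encodeMatrix ψ
  stripHolds W B (pltl ψ) h       = _ , ψ , B , h , refl
  stripHolds W B (∃̇ φ)    (Q , h) = stripHolds W (λ y → Q y ∷ B y) φ h

  module _ (x : D) (M : UULS (suc (suc k″)) n) {m} (B : ℕ → Subset m) where
    open Layers k″ x
    open Procedure k′
    open Trees k′ x
    open Membership k′ x
    open Types k′ x

    private
      W : ℕ → A → Set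
      W i (α , _) = treeAt M i ⊨ᵗ α

      typeAt : ℕ → D
      typeAt i = typ (rawTreeAt M i)

      open Linear k″ x (λ i j → Σ[ q ∈ Fin m ] toℕ q ≡ j × q ∈ B i) typeAt

    true⇔ : ∀ (ψ : PLTL (Fin m ⊎ A)) → encodeMatrix ψ ∈ᴰ subs x → ∀ i →
            (B ⊕ W , i ⊨ ψ) ⇔ True (encodeMatrix ψ) i
    true⇔ (letter (inj₁ q)) d∈ i = mk⇔
      (λ q∈ → q , sym (value-encodeFin q) , q∈)
      (λ (q′ , eq , q′∈) → subst (λ q → q ∈ B i) (toℕ-injective (trans eq (value-encodeFin q))) q′∈)
    true⇔ (letter (inj₂ (α , _))) d∈ i = holds⇔ (rawTreeAt-agree M i) α (proj₂ (closed (proj₂ (closed d∈))))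
    true⇔ (¬̇ ψ)   d∈ i = ⇔-trans (⇔-¬ (true⇔ ψ (proj₂ (closed d∈)) i))
                                 (⇔-sym (≡⇒⇔ (True≡ (encodeMatrix (¬̇ ψ)) i)))
    true⇔ (ψ ∧̇ χ) d∈ i = ⇔-× (true⇔ ψ (proj₁ (closed (proj₂ (closed d∈)))) i)
                             (true⇔ χ (proj₂ (closed (proj₂ (closed d∈)))) i)
    true⇔ (○ ψ)   d∈ i = ⇔-trans (true⇔ ψ (proj₂ (closed d∈)) (suc i))
                                 (⇔-sym (≡⇒⇔ (True≡ (encodeMatrix (○ ψ)) i)))
    true⇔ (ψ U χ) d∈ i = mk⇔
      (¬¬-map λ (y , i≤y , h , hs) → y , i≤y , to (χ⇔ y) h , λ z i≤z z<y → to (ψ⇔ z) (hs z i≤z z<y))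
      (¬¬-map λ (y , i≤y , h , hs) → y , i≤y , from (χ⇔ y) h , λ z i≤z z<y → from (ψ⇔ z) (hs z i≤z z<y))
      where
      ψ⇔ = true⇔ ψ (proj₁ (closed (proj₂ (closed d∈))))
      χ⇔ = true⇔ χ (proj₂ (closed (proj₂ (closed d∈))))

    private
      IsStage : ℕ → D → Set
      IsStage i s = Σ[ p ∈ D ] s ≡ fullTypes i ∙ typeAt i ∙ p × Truthful i p

      fullTypes∈ : ∀ i → fullTypes i ∈ᴰ pow (types x)
      fullTypes∈ zero    = typesOver∈ leafSons
      fullTypes∈ (suc i) = typesOver∈ (fullSons (fullTypes i))

      typeAt∈ : ∀ i → typeAt i ∈ᴰ almostTypes i
      typeAt∈ i = almostTypes⁺ (rawTreeAt-almost M i)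

      almostTypes⊆types : ∀ i {t} → t ∈ᴰ almostTypes i → t ∈ᴰ types x
      almostTypes⊆types zero    = typesOver⊆types
      almostTypes⊆types (suc i) = typesOver⊆types

      stage∈ : ∀ {i s} → IsStage i s → s ∈ᴰ stages x
      stage∈ {i} (p , refl , b , refl , _) =
        ∈-pairs (fullTypes∈ i) (∈-pairs (almostTypes⊆types i (typeAt∈ i)) (select∈pow b (subs x)))

      edge : ∀ {i s s′} → IsStage i s → IsStage (suc i) s′ → Edge s s′ x
      edge {i} (p , refl , tp@(b , eq , ok)) (p′ , refl , tp′) =
        refl , typeAt∈ (suc i) ,
        trans eq (select≡linearSet b p p′ (typeAt i) λ u u∈ → ⇔-trans (ok u u∈) (truthful-local tp tp′ u u∈))

      ¬¬-stage : ∀ i → ¬ ¬ (Σ[ s ∈ D ] IsStage i s)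
      ¬¬-stage i = ¬¬-map (λ (p , tp) → _ , p , refl , tp) (¬¬-truthful i)

      module _ (G : D) (stageOf : ∀ {s} → s ∈ᴰ G → Σ[ i ∈ ℕ ] IsStage i s)
               (∈G : ∀ {i s} → IsStage i s → s ∈ᴰ G) where

        initial : True (matrix x) 0 → Some G λ s → Initial s x
        initial h = decidable-stable (some? G λ s → Decider.decide initialᵉ (s ∙ x ∙ nil))
          (¬¬-map (λ { (s , st@(p , refl , tp)) → s , ∈G st , refl , typeAt∈ 0 ,
                         from (truthful⇔ tp (matrix∈ x (∈-addSubs-self x nil))) h })
                  (¬¬-stage 0))

        successor : All G λ s → Some G λ s′ → Edge s s′ x
        successor s s∈ = case stageOf s∈ of λ (i , st) →
          decidable-stable (some? G λ s′ →
              Decider.decide (edgeᵉ (varᵉ 0) (varᵉ 1) (varᵉ 2)) (s ∙ s′ ∙ x ∙ nil))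
            (¬¬-map (λ (s′ , st′) → s′ , ∈G st′ , edge st st′) (¬¬-stage (suc i)))

        -- Starting at an instant where the right argument of the until formula holds, closure puts
        -- the visited stages into `Z` one by one, back to `s`. Both that instant and the stages in
        -- between are known only up to double negation, but membership in `Z` is decidable.
        fulfilled : All G λ s → All (subs x) λ u → head u ≡ untilCode → u ∈ᴰ stageP s →
                    All (pow G) λ Z → Closed Z u G x → s ∈ᴰ Z
        fulfilled s s∈ u u∈ isUntil u∈p Z Z∈ closedZ with stageOf s∈
        ... | i , st@(p , refl , tp) =
          decidable-stable (s ∈ᴰ? Z) λ s∉ →
            subst id (True-case u i (cong len isUntil)) (to (truthful⇔ tp u∈) u∈p)
              λ (y , i≤y , h , _) →
                backwards (y ∸ i) i s st (subst (True (tail (tail u))) (sym (m+[n∸m]≡n i≤y)) h) s∉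
          where
          backwards : ∀ d i s → IsStage i s → True (tail (tail u)) (i + d) → ¬ ¬ (s ∈ᴰ Z)
          backwards zero i s st@(p , refl , tp) h s∉ = s∉ (closedZ s (∈G st) (inj₁
            (from (truthful⇔ tp (proj₂ (closed (proj₂ (closed u∈)))))
                  (subst (True (tail (tail u))) (+-identityʳ i) h))))
          backwards (suc d) i s st h s∉ = ¬¬-stage (suc i) λ (s′ , st′) →
            backwards d (suc i) s′ st′ (subst (True (tail (tail u))) (+-suc i d) h) λ s′∈ →
              s∉ (closedZ s (∈G st) (inj₂ (s′ , ∈G st′ , edge st st′ , s′∈)))

    ¬¬-accepts : True (matrix x) 0 → ¬ ¬ Accepts x
    ¬¬-accepts h = ¬¬-map accept (¬¬-test (λ s → Σ[ i ∈ ℕ ] IsStage i s) (stages x))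
      where
      accept : Σ[ b ∈ (D → D) ] (∀ s → s ∈ᴰ stages x → b s ≢ nil ⇔ (Σ[ i ∈ ℕ ] IsStage i s)) → Accepts x
      accept (b , ok) = G , select∈pow b (stages x) ,
        initial G stageOf ∈G h , successor G stageOf ∈G , fulfilled G stageOf ∈G
        where
        G : D
        G = select b nil (stages x)

        stageOf : ∀ {s} → s ∈ᴰ G → Σ[ i ∈ ℕ ] IsStage i s
        stageOf {s} s∈ = [ (λ (s∈′ , bs) → to (ok s s∈′) bs) , (λ ()) ]′ (∈-select⁻ b nil (stages x) s∈)

        ∈G : ∀ {i s} → IsStage i s → s ∈ᴰ G
        ∈G {i} {s} st = ∈-select b nil (stages x) (stage∈ st) (from (ok s (stage∈ st)) (i , st))

  complete : ∀ (φ : EQLTL[EQCTL*] (suc (suc k″)) n) → Satisfiable (n , φ) →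
             ¬ ¬ Procedure.Accepts (suc k″) (encodeEQLTL φ)
  complete φ (M , h) = case stripHolds _ (λ _ → []) φ h of λ (m , ψ , B , hψ , eq) →
    let x = encodeEQLTL φ
        matrixψ∈ = subst (_∈ᴰ subs x) eq (Types.matrix∈ (suc k″) x x (∈-addSubs-self x nil))
    in ¬¬-accepts x M B (subst (λ d → LinearTruth x M B d) (sym eq)
         (to (true⇔ x M B ψ matrixψ∈ 0) hψ))
    where
    LinearTruth : ∀ x M {m} (B : ℕ → Subset m) → D → Set
    LinearTruth x M {m} B d = Linear.True k″ x (λ i j → Σ[ q ∈ Fin m ] toℕ q ≡ j × q ∈ B i)
      (λ i → Types.typ (suc k″) x (Layers.rawTreeAt k″ x M i)) d 0

-- Soundness

count : {P : D → Set} → (∀ y → Dec (P y)) → D → ℕ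
count P? nil     = 0
count P? (y ∙ l) with P? y
... | yes _ = suc (count P? l)
... | no _  = count P? l

count-mono : {P Q : D → Set} (P? : ∀ y → Dec (P y)) (Q? : ∀ y → Dec (Q y)) → (∀ y → P y → Q y) →
             ∀ l → count P? l ≤ count Q? l
count-mono P? Q? P⊆Q nil     = z≤n
count-mono P? Q? P⊆Q (y ∙ l) with P? y | Q? y
... | yes py | yes qy = s≤s (count-mono P? Q? P⊆Q l)
... | yes py | no ¬qy = ⊥-elim (¬qy (P⊆Q y py))
... | no ¬py | yes qy = m≤n⇒m≤1+n (count-mono P? Q? P⊆Q l)
... | no ¬py | no ¬qy = count-mono P? Q? P⊆Q l

count-strict : {P Q : D → Set} (P? : ∀ y → Dec (P y)) (Q? : ∀ y → Dec (Q y)) → (∀ y → P y → Q y) →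
               ∀ {l z} → z ∈ᴰ l → ¬ P z → Q z → count P? l < count Q? l
count-strict P? Q? P⊆Q {y ∙ l} here ¬pz qz with P? y | Q? y
... | yes py | _      = ⊥-elim (¬pz py)
... | no _   | yes _  = s≤s (count-mono P? Q? P⊆Q l)
... | no _   | no ¬qy = ⊥-elim (¬qy qz)
count-strict P? Q? P⊆Q {y ∙ l} (there z∈) ¬pz qz with P? y | Q? y
... | yes py | yes qy = s≤s (count-strict P? Q? P⊆Q z∈ ¬pz qz)
... | yes py | no ¬qy = ⊥-elim (¬qy (P⊆Q y py))
... | no ¬py | yes qy = m≤n⇒m≤1+n (count-strict P? Q? P⊆Q z∈ ¬pz qz)
... | no ¬py | no ¬qy = count-strict P? Q? P⊆Q z∈ ¬pz qz

count≤len : {P : D → Set} (P? : ∀ y → Dec (P y)) → ∀ l → count P? l ≤ len l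
count≤len P? nil     = z≤n
count≤len P? (y ∙ l) with P? y
... | yes _ = s≤s (count≤len P? l)
... | no _  = m≤n⇒m≤1+n (count≤len P? l)

-- Each step that is not stationary on `l` raises the number of entries satisfying the predicate,
-- which never exceeds `len l`. The search keeps this number plus the fuel above `len l`, so it
-- cannot run out of fuel.
stationary : {P : ℕ → D → Set} → (∀ n y → Dec (P n y)) → (∀ n y → P n y → P (suc n) y) → ∀ l →
             Σ[ n ∈ ℕ ] All l λ y → P (suc n) y → P n y
stationary {P} P? increasing l = search (suc (len l)) 0 (m≤n+m _ _)
  where
  search : ∀ fuel n → suc (len l) ≤ count (P? n) l + fuel → Σ[ n ∈ ℕ ] All l λ y → P (suc n) y → P n y
  search zero n enough = ⊥-elim (<⇒≱ enough (≤-trans (≤-reflexive (+-identityʳ _)) (count≤len (P? n) l)))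
  search (suc fuel) n enough with some? l (λ y → P? (suc n) y ×-dec ¬? (P? n y))
  ... | yes (y , y∈ , new , ¬old) = search fuel (suc n) (≤-trans enough
    (≤-trans (≤-reflexive (+-suc _ fuel))
             (+-monoˡ-≤ fuel (count-strict (P? n) (P? (suc n)) (increasing n) y∈ ¬old new))))
  ... | no none = n , λ y y∈ new → decidable-stable (P? n y) λ ¬old → none (y , y∈ , new , ¬old)

zero∈ : ∀ {n} {P : Set} (P? : Dec P) {l : Subset n} → zero ∈ does P? ∷ l ⇔ P
zero∈ (yes p) = mk⇔ (λ _ → p) (λ _ → here)
zero∈ (no ¬p) = mk⇔ (λ ()) (λ p → ⊥-elim (¬p p))

module Run (k″ : ℕ) (x G : D) (good : Procedure.Good (suc k″) G x) where
  open Layers k″ x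
  open Procedure k′
  open Trees k′ x using (closed)
  open Membership k′ x

  Fulfils : D → D → Set
  Fulfils u s = tail (tail u) ∈ᴰ stageP s

  data Reach (u : D) : D → Set where
    done : ∀ {s} → Fulfils u s → Reach u s
    move : ∀ {s s′} → s′ ∈ᴰ G → Edge s s′ x → Reach u s′ → Reach u s

  edge? : ∀ s s′ → Dec (Edge s s′ x)
  edge? s s′ = Decider.decide (edgeᵉ (varᵉ 0) (varᵉ 1) (varᵉ 2)) (s ∙ s′ ∙ x ∙ nil)

  module _ (u : D) where

    Within : ℕ → D → Set
    Within zero    s = Fulfils u s
    Within (suc n) s = Within n s ⊎ Some G λ s′ → Edge s s′ x × Within n s′

    within? : ∀ n s → Dec (Within n s)
    within? zero    s = tail (tail u) ∈ᴰ? stageP s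
    within? (suc n) s = within? n s ⊎-dec some? G (λ s′ → edge? s s′ ×-dec within? n s′)

    within⇒reach : ∀ n {s} → Within n s → Reach u s
    within⇒reach zero    w                            = done w
    within⇒reach (suc n) (inj₁ w)                     = within⇒reach n w
    within⇒reach (suc n) (inj₂ (s′ , s′∈ , e , w))    = move s′∈ e (within⇒reach n w)

    fulfils⇒within : ∀ n {s} → Fulfils u s → Within n s
    fulfils⇒within zero    h = h
    fulfils⇒within (suc n) h = inj₁ (fulfils⇒within n h)

  Pending : D → D → Set
  Pending u s = u ∈ᴰ subs x × head u ≡ untilCode × u ∈ᴰ stageP s

  pending? : ∀ u s → Dec (Pending u s)
  pending? u s = (u ∈ᴰ? subs x) ×-dec (head u ≟ᴰ untilCode) ×-dec (u ∈ᴰ? stageP s)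

  -- Once the sets `Within u n` are stationary on `G`, the stages of `G` in them form a closed set.
  -- The acceptance condition for this particular `Z` puts `s` into it and thus yields an actual
  -- path.
  reach : ∀ {u s} → s ∈ᴰ G → Pending u s → Reach u s
  reach {u} {s} s∈ (u∈ , isUntil , u∈p) =
    within⇒reach u n (proj₂ (∈-pick⁻ (within? u n) G
      (proj₂ (proj₂ good) s s∈ u u∈ isUntil u∈p Z (pick∈pow (within? u n) G) closedZ)))
    where
    stable : Σ[ n ∈ ℕ ] All G λ y → Within u (suc n) y → Within u n y
    stable = stationary (within? u) (λ n y → inj₁) G

    n : ℕ
    n = proj₁ stable

    Z : D
    Z = pick (within? u n) G

    closedZ : Closed Z u G x
    closedZ s s∈ (inj₁ h) = ∈-pick (within? u n) s∈ (fulfils⇒within u n h)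
    closedZ s s∈ (inj₂ (s′ , s′∈ , e , s′∈Z)) = ∈-pick (within? u n) s∈
      (proj₂ stable s s∈ (inj₂ (s′ , s′∈ , e , proj₂ (∈-pick⁻ (within? u n) G s′∈Z))))

  -- The run serves the pending until formulas in turn: q lists those that are
  -- still to be served before the list starts again.
  data Conf : Set where
    ready : ∀ s → s ∈ᴰ G → (q : D) → Conf
    walk  : ∀ s → s ∈ᴰ G → (q u : D) → Reach u s → Conf

  stage : Conf → D
  stage (ready s _ _)    = s
  stage (walk s _ _ _ _) = s

  begin? : ∀ u (q : D) s → s ∈ᴰ G → Dec (Pending u s) → Conf
  begin? u q s s∈ (yes pending) = walk s s∈ q u (reach s∈ pending)
  begin? u q s s∈ (no _)        = ready s s∈ q

  start : ∀ u (q : D) s → s ∈ᴰ G → Conf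
  start u q s s∈ = begin? u q s s∈ (pending? u s)

  stage-begin? : ∀ u q s s∈ d → stage (begin? u q s s∈ d) ≡ s
  stage-begin? u q s s∈ (yes _) = refl
  stage-begin? u q s s∈ (no _)  = refl

  succ : ∀ s → s ∈ᴰ G → D
  succ s s∈ = proj₁ (proj₁ (proj₂ good) s s∈)

  succ∈ : ∀ s s∈ → succ s s∈ ∈ᴰ G
  succ∈ s s∈ = proj₁ (proj₂ (proj₁ (proj₂ good) s s∈))

  succ-edge : ∀ s s∈ → Edge s (succ s s∈) x
  succ-edge s s∈ = proj₂ (proj₂ (proj₁ (proj₂ good) s s∈))

  nextReady : ∀ s → s ∈ᴰ G → D → Conf
  nextReady s s∈ nil     = ready (succ s s∈) (succ∈ s s∈) (subs x)
  nextReady s s∈ (u ∙ q) = start u q (succ s s∈) (succ∈ s s∈)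

  next : Conf → Conf
  next (ready s s∈ q)                     = nextReady s s∈ q
  next (walk s s∈ q u (done _))           = nextReady s s∈ q
  next (walk s s∈ q u (move s′∈ e r))     = walk _ s′∈ q u r

  edge-nextReady : ∀ s s∈ q → Edge s (stage (nextReady s s∈ q)) x
  edge-nextReady s s∈ nil     = succ-edge s s∈
  edge-nextReady s s∈ (u ∙ q) = subst (λ s′ → Edge s s′ x)
    (sym (stage-begin? u q (succ s s∈) (succ∈ s s∈) (pending? u (succ s s∈)))) (succ-edge s s∈)

  edge-next : ∀ c → Edge (stage c) (stage (next c)) x
  edge-next (ready s s∈ q)                   = edge-nextReady s s∈ q
  edge-next (walk s s∈ q u (done _))         = edge-nextReady s s∈ q
  edge-next (walk s s∈ q u (move s′∈ e r))   = e

  data Eventually (P : Conf → Set) : Conf → Set where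
    at    : ∀ {c} → P c → Eventually P c
    after : ∀ {c} → Eventually P (next c) → Eventually P c

  eventually-bind : ∀ {P Q c} → Eventually P c → (∀ {c} → P c → Eventually Q c) → Eventually Q c
  eventually-bind (at p)    f = f p
  eventually-bind (after e) f = after (eventually-bind e f)

  -- Stated through `next` in order to cover both a `ready` configuration and a `walk` that has just
  -- arrived.
  Ready : D → Conf → Set
  Ready q c = Σ[ s ∈ D ] Σ[ s∈ ∈ s ∈ᴰ G ] next c ≡ nextReady s s∈ q

  walk-ready : ∀ {s s∈ q u} (r : Reach u s) → Eventually (Ready q) (walk s s∈ q u r)
  walk-ready (done _)         = at (_ , _ , refl)
  walk-ready (move s′∈ e r)   = after (walk-ready r)

  begin?-ready : ∀ u q s s∈ d → Eventually (Ready q) (begin? u q s s∈ d)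
  begin?-ready u q s s∈ (yes p) = walk-ready (reach s∈ p)
  begin?-ready u q s s∈ (no _)  = at (_ , _ , refl)

  eventually-ready : ∀ c → Σ[ q ∈ D ] Eventually (Ready q) c
  eventually-ready (ready s s∈ q)    = q , at (_ , _ , refl)
  eventually-ready (walk s s∈ q u r) = q , walk-ready r

  drain : ∀ q {c} → Ready q c → Eventually (Ready nil) c
  drain nil     rd            = at rd
  drain (u ∙ q) (s , s∈ , eq) = after (subst (Eventually (Ready nil)) (sym eq)
    (eventually-bind (begin?-ready u q (succ s s∈) (succ∈ s s∈) (pending? u (succ s s∈))) (drain q)))

  Started : D → Conf → Set
  Started u c = Σ[ q ∈ D ] Σ[ s ∈ D ] Σ[ s∈ ∈ s ∈ᴰ G ] c ≡ start u q s s∈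

  seek : ∀ {u q c} → u ∈ᴰ q → Ready q c → Eventually (Started u) c
  seek here                  (s , s∈ , eq) = after (at (_ , _ , _ , eq))
  seek {q = v ∙ q} (there u∈) (s , s∈ , eq) = after (subst (Eventually (Started _)) (sym eq)
    (eventually-bind (begin?-ready v q (succ s s∈) (succ∈ s s∈) (pending? v (succ s s∈))) (seek u∈)))

  -- Each walk is finite, so the current queue is exhausted; the next one is the whole of `subs x`,
  -- in which the turn of `u` comes.
  eventually-started : ∀ {u} → u ∈ᴰ subs x → ∀ c → Eventually (Started u) c
  eventually-started u∈ c with eventually-ready c
  ... | q , e = eventually-bind e λ rd → eventually-bind (drain q rd) λ (s , s∈ , eq) →
    after (subst (Eventually (Started _)) (sym eq) (seek u∈ (_ , _ , refl)))

  Done : D → Conf → Set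
  Done u c = Fulfils u (stage c)

  walk-done : ∀ {s s∈ q u} (r : Reach u s) → Eventually (Done u) (walk s s∈ q u r)
  walk-done (done h)       = at h
  walk-done (move s′∈ e r) = after (walk-done r)

  begin?-done : ∀ {u q s s∈} d → Pending u s → Eventually (Done u) (begin? u q s s∈ d)
  begin?-done (yes p) _ = walk-done (reach _ p)
  begin?-done (no ¬p) p = ⊥-elim (¬p p)

  local-stage : ∀ c {u} → u ∈ᴰ subs x →
                u ∈ᴰ stageP (stage c) ⇔
                LocalLinear (_∈ᴰ stageP (stage c)) (_∈ᴰ stageP (stage (next c))) (stageT (stage c)) u
  local-stage c {u} u∈ = ⇔-trans (≡⇒⇔ (cong (u ∈ᴰ_) (proj₂ (proj₂ (edge-next c))))) (∈-linearSet⇔ u∈)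

  until-stage : ∀ c {e} → untilCode ∙ e ∈ᴰ subs x →
                untilCode ∙ e ∈ᴰ stageP (stage c) ⇔
                (tail e ∈ᴰ stageP (stage c) ⊎
                 (head e ∈ᴰ stageP (stage c) × untilCode ∙ e ∈ᴰ stageP (stage (next c))))
  until-stage c u∈ = local-stage c u∈

  -- By the expansion law, a pending until formula is either fulfilled at once or still pending at
  -- the next stage. If it is not fulfilled earlier, it is pending when its turn comes, and the walk
  -- started then fulfils it.
  eventually-done : ∀ {u} c → Pending u (stage c) → Eventually (Started u) c → Eventually (Done u) c
  eventually-done {u} c p (at (q , s , s∈ , refl)) =
    begin?-done (pending? u s) (subst (Pending u) (stage-begin? u q s s∈ (pending? u s)) p)
  eventually-done {op ∙ e} c (u∈ , refl , u∈p) (after ev) with to (until-stage c u∈) u∈p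
  ... | inj₁ h         = at h
  ... | inj₂ (_ , u∈′) = after (eventually-done (next c) (u∈ , refl , u∈′) ev)

  conf : ℕ → Conf
  conf zero    = ready _ (proj₁ (proj₂ (proj₁ good))) nil
  conf (suc i) = next (conf i)

  eventually⇒∃ : ∀ {P} i → Eventually P (conf i) → Σ[ j ∈ ℕ ] i ≤ j × P (conf j)
  eventually⇒∃ i (at p)    = i , ≤-refl , p
  eventually⇒∃ i (after e) with eventually⇒∃ (suc i) e
  ... | j , i<j , p = j , <⇒≤ i<j , p

  p : ℕ → D
  p i = stageP (stage (conf i))

  fulfilled : ∀ i {e} → untilCode ∙ e ∈ᴰ subs x → untilCode ∙ e ∈ᴰ p i → Σ[ j ∈ ℕ ] i ≤ j × tail e ∈ᴰ p j
  fulfilled i u∈ u∈p = eventually⇒∃ i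
    (eventually-done (conf i) (u∈ , refl , u∈p) (eventually-started u∈ (conf i)))

  stageS≡ : ∀ i → stageS (stage (conf i)) ≡ fullTypes i
  stageS≡ zero    = proj₁ (proj₂ (proj₂ (proj₁ good)))
  stageS≡ (suc i) = trans (proj₁ (edge-next (conf i))) (cong (λ S → typesOver (fullSons S) x) (stageS≡ i))

  stageT∈ : ∀ i → stageT (stage (conf i)) ∈ᴰ almostTypes i
  stageT∈ zero    = subst (stageT (stage (conf 0)) ∈ᴰ_) (stageS≡ 0) (proj₁ (proj₂ (proj₂ (proj₂ (proj₁ good)))))
  stageT∈ (suc i) = subst (λ S → stageT (stage (conf (suc i))) ∈ᴰ typesOver (almostSons S) x) (stageS≡ i)
    (proj₁ (proj₂ (edge-next (conf i))))

  matrix∈p : matrix x ∈ᴰ p 0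
  matrix∈p = proj₂ (proj₂ (proj₂ (proj₂ (proj₁ good))))

module Soundness (k″ n : ℕ) (x G : D) (good : Procedure.Good (suc k″) G x) where
  open Layers k″ x
  open Procedure k′
  open Trees k′ x
  open Types k′ x
  open Run k″ x G good

  private
    A : Set
    A = MonolithicEQCTL* k n

    raw : ℕ → RTree
    raw i = proj₁ (almostTypes⁻ i (stageT∈ i))

    raw-almost : ∀ i → Almost i (raw i)
    raw-almost i = proj₁ (proj₂ (almostTypes⁻ i (stageT∈ i)))

    raw-type : ∀ i → stageT (stage (conf i)) ≡ typ (raw i)
    raw-type i = proj₂ (proj₂ (almostTypes⁻ i (stageT∈ i)))

    open Glue n raw raw-almost

    W : ℕ → A → Set
    W i (α , _) = treeAt model i ⊨ᵗ α

    letterCode : ℕ → D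
    letterCode j = unary 0 ∙ unary 0 ∙ binary (fromℕ j)

    -- A letter with index `q` outside `j` further quantifiers has index `j + q` in the matrix, and
    -- it is under this index that the stages record its truth value.
    bitsFrom : ℕ → ∀ m → ℕ → Subset m
    bitsFrom j zero    i = []
    bitsFrom j (suc m) i = does (letterCode j ∈ᴰ? p i) ∷ bitsFrom (suc j) m i

    ∈-bitsFrom⇔ : ∀ j m i (q : Fin m) → q ∈ bitsFrom j m i ⇔ letterCode (j + toℕ q) ∈ᴰ p i
    ∈-bitsFrom⇔ j (suc m) i zero rewrite +-identityʳ j = zero∈ (letterCode j ∈ᴰ? p i)
    ∈-bitsFrom⇔ j (suc m) i (suc q) rewrite +-suc j (toℕ q) =
      ⇔-trans (mk⇔ (λ { (there h) → h }) there) (∈-bitsFrom⇔ (suc j) m i q)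

  private
    bitsOf : ∀ m → ℕ → Subset m
    bitsOf m = bitsFrom 0 m

  true⇔ : ∀ {m} (ψ : PLTL (Fin m ⊎ A)) → encodePLTL encodeLetter ψ ∈ᴰ subs x → ∀ i →
          (bitsOf m ⊕ W , i ⊨ ψ) ⇔ encodePLTL encodeLetter ψ ∈ᴰ p i
  true⇔ (letter (inj₁ q)) d∈ i = ∈-bitsFrom⇔ 0 _ i q
  true⇔ (letter (inj₂ (α , _))) d∈ i = ⇔-trans
    (holds⇔ (treeAt-agree i) α (proj₂ (closed (proj₂ (closed d∈)))))
    (⇔-trans (≡⇒⇔ (cong (HoldsIn (encodeᵗ α)) (sym (raw-type i)))) (⇔-sym (local-stage (conf i) d∈)))
  true⇔ (¬̇ ψ)   d∈ i = ⇔-trans (⇔-¬ (true⇔ ψ (proj₂ (closed d∈)) i)) (⇔-sym (local-stage (conf i) d∈))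
  true⇔ (ψ ∧̇ χ) d∈ i = ⇔-trans
    (⇔-× (true⇔ ψ (proj₁ (closed (proj₂ (closed d∈)))) i) (true⇔ χ (proj₂ (closed (proj₂ (closed d∈)))) i))
    (⇔-sym (local-stage (conf i) d∈))
  true⇔ (○ ψ)   d∈ i = ⇔-trans (true⇔ ψ (proj₂ (closed d∈)) (suc i)) (⇔-sym (local-stage (conf i) d∈))
  true⇔ {m} (ψ U χ) d∈ i = mk⇔
    (λ ¬¬u → decidable-stable (u ∈ᴰ? p i) (¬¬-map (λ (y , i≤y , h , hs) →
       backwards (y ∸ i) i y (m+[n∸m]≡n i≤y) h hs) ¬¬u))
    (λ u∈ ¬u → case fulfilled i d∈ u∈ of λ (j , i≤j , h) → ¬u (forwards (j ∸ i) i j (m+[n∸m]≡n i≤j) h u∈))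
    where
    u : D
    u = encodePLTL encodeLetter (ψ U χ)

    V : ℕ → Fin m ⊎ A → Set
    V = bitsOf m ⊕ W

    ψ⇔ : ∀ i → (V , i ⊨ ψ) ⇔ encodePLTL encodeLetter ψ ∈ᴰ p i
    ψ⇔ = true⇔ ψ (proj₁ (closed (proj₂ (closed d∈))))

    χ⇔ : ∀ i → (V , i ⊨ χ) ⇔ encodePLTL encodeLetter χ ∈ᴰ p i
    χ⇔ = true⇔ χ (proj₂ (closed (proj₂ (closed d∈))))

    backwards : ∀ d i y → i + d ≡ y → V , y ⊨ χ → (∀ z → i ≤ z → z < y → V , z ⊨ ψ) → u ∈ᴰ p i
    backwards zero    i y eq h hs = from (until-stage (conf i) d∈)
      (inj₁ (to (χ⇔ i) (subst (λ y → V , y ⊨ χ) (trans (sym eq) (+-identityʳ i)) h)))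
    backwards (suc d) i y eq h hs = from (until-stage (conf i) d∈) (inj₂
      ( to (ψ⇔ i) (hs i ≤-refl (subst (i <_) eq (≤-trans (s≤s (m≤m+n i d)) (≤-reflexive (sym (+-suc i d))))))
      , backwards d (suc i) y (trans (sym (+-suc i d)) eq) h (λ z i<z z<y → hs z (<⇒≤ i<z) z<y)))

    -- The instant `j` only bounds the search: the until formula is unfolded from `i` on, and the
    -- witness is the first instant at which `χ` is found true, so that `ψ` holds at all earlier
    -- ones.
    forwards : ∀ d i j → i + d ≡ j → encodePLTL encodeLetter χ ∈ᴰ p j → u ∈ᴰ p i →
               Σ[ y ∈ ℕ ] i ≤ y × (V , y ⊨ χ) × (∀ z → i ≤ z → z < y → V , z ⊨ ψ)
    forwards d i j eq h u∈ with to (until-stage (conf i) d∈) u∈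
    ... | inj₁ hχ = i , ≤-refl , from (χ⇔ i) hχ , λ z i≤z z<i → ⊥-elim (<⇒≱ z<i i≤z)
    forwards zero i j eq h u∈ | inj₂ _ =
      i , ≤-refl , from (χ⇔ i) (subst (λ j → encodePLTL encodeLetter χ ∈ᴰ p j) (trans (sym eq) (+-identityʳ i)) h) ,
      λ z i≤z z<i → ⊥-elim (<⇒≱ z<i i≤z)
    forwards (suc d) i j eq h u∈ | inj₂ (hψ , u∈′)
      with forwards d (suc i) j (trans (sym (+-suc i d)) eq) h u∈′
    ... | y , i<y , hy , hs = y , <⇒≤ i<y , hy , λ z i≤z z<y →
      [ (λ i<z → hs z i<z z<y) , (λ { refl → from (ψ⇔ i) hψ }) ]′ (m≤n⇒m<n∨m≡n i≤z)

  private
    depth : ∀ {m} → EQLTL A m → ℕ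
    depth (pltl _) = 0
    depth (∃̇ φ)    = suc (depth φ)

    holds : ∀ {m} (φ : EQLTL A m) → matrix (encodeEQLTL φ) ∈ᴰ subs x → matrix (encodeEQLTL φ) ∈ᴰ p 0 →
            Holds W (bitsFrom (depth φ) m) 0 φ
    holds (pltl ψ) d∈ h = from (true⇔ ψ d∈ 0) h
    holds (∃̇ φ)    d∈ h = (λ i → does (letterCode (depth φ) ∈ᴰ? p i)) , holds φ d∈ h

  satisfiable : (φ : EQLTL[EQCTL*] k n) → encodeEQLTL φ ≡ x → Satisfiable (n , φ)
  satisfiable φ refl = model , holds φ (matrix∈ x (∈-addSubs-self x nil)) matrix∈p

-- The running time

-- The slack on the left pays for the constructors, such as state and ctl*, that
-- do not contribute to the length of a formula.
module EncodingSize (k C : ℕ) (C≥ : 30 + (k + k) ≤ C) where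

  within : ∀ {e} → e ≤ 30 + (k + k) → e ≤ C
  within e≤ = ≤-trans e≤ C≥

  wrap : ∀ {e a n} → e ≤ C → a ≤ C * n → e + a ≤ C * suc n
  wrap {n = n} e≤ a≤ = ≤-trans (+-mono-≤ e≤ a≤) (≤-reflexive (sym (*-suc C n)))

  join : ∀ {a b m n} → a ≤ C * m → b ≤ C * n → a + b ≤ C * (m + n)
  join {m = m} {n} a≤ b≤ = ≤-trans (+-mono-≤ a≤ b≤) (≤-reflexive (sym (*-distribˡ-+ C m n)))

  drop : ∀ s {a m} → s + a ≤ m → a ≤ m
  drop s = ≤-trans (m≤n+m _ s)

  binary-size : ∀ b → ⟪ binary b ⟫ ≤ suc (size b * 4)
  binary-size zeroᵇ     = s≤s z≤n
  binary-size 2[1+ b ] = s≤s (≤-trans (s≤s (binary-size b)) (m≤n⇒m≤1+n (m≤n⇒m≤1+n ≤-refl)))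
  binary-size 1+[2 b ] = s≤s (s≤s (s≤s (s≤s (binary-size b))))

  fin-size : ∀ {n} e (p : Fin n) → suc e ≤ C → e + ⟪ encodeFin p ⟫ ≤ C * ∣ p ∣ˡ
  fin-size e p e≤ = begin
    e + ⟪ encodeFin p ⟫   ≤⟨ +-monoʳ-≤ e (binary-size (fromℕ (toℕ p))) ⟩
    e + suc (m * 4)       ≡⟨ +-suc e (m * 4) ⟩
    suc e + m * 4         ≤⟨ wrap e≤ (≤-trans (≤-reflexive (*-comm m 4)) (*-monoˡ-≤ m (within (m≤m+n 4 _)))) ⟩
    C * suc m             ∎
    where
    open ≤-Reasoning
    m = size (fromℕ (toℕ p))

  unary-size : ∀ m → ⟪ unary m ⟫ ≡ suc (m + m)
  unary-size zero    = refl
  unary-size (suc m) = cong (2 +_) (trans (unary-size m) (sym (+-suc m m)))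

  module _ {n : ℕ} where
    mutual
      state-size : ∀ (φ : StateFormula k n) → 10 + ⟪ encodeˢ φ ⟫ ≤ C * ∣ φ ∣ˢ
      state-size (letter p) = fin-size 12 p (within (m≤m+n 13 _))
      state-size (¬̇ φ)      = wrap (within (m≤m+n 14 _)) (drop 10 (state-size φ))
      state-size (φ ∧̇ χ)    = wrap (within (m≤m+n 17 _)) (join (drop 10 (state-size φ)) (drop 10 (state-size χ)))
      state-size (𝐄 ψ)      = wrap (within (m≤m+n 18 _)) (drop 8 (path-size ψ))
      state-size (𝐀 ψ)      = wrap (within (m≤m+n 20 _)) (drop 8 (path-size ψ))

      path-size : ∀ (ψ : PathFormula k n) → 8 + ⟪ encodeᵖ ψ ⟫ ≤ C * ∣ ψ ∣ᵖ
      path-size (state φ)  = state-size φ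
      path-size (¬̇ ψ)      = wrap (within (m≤m+n 12 _)) (drop 8 (path-size ψ))
      path-size (ψ ∧̇ χ)    = wrap (within (m≤m+n 15 _)) (join (drop 8 (path-size ψ)) (drop 8 (path-size χ)))
      path-size (ψ U χ)    = wrap (within (m≤m+n 17 _)) (join (drop 8 (path-size ψ)) (drop 8 (path-size χ)))
      path-size (X ψ)      = wrap (within (m≤m+n 18 _)) (drop 8 (path-size ψ))
      -- The direction counts as part of one symbol but is encoded in unary, with size at most
      -- `k + k`; this is the origin of that summand of `C`.
      path-size (X[ c ] ψ) = wrap
        (within (+-mono-≤ (m≤m+n 21 9) (≤-trans (≤-reflexive (unary-size (toℕ c)))
           (+-mono-≤ (toℕ<n c) (<⇒≤ (toℕ<n c))))))
        (drop 8 (path-size ψ))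

  tree-size : ∀ {n} (α : EQCTL* k n) → 8 + ⟪ encodeᵗ α ⟫ ≤ C * ∣ α ∣ᵗ
  tree-size (ctl* φ) = state-size φ
  tree-size (∃̇ α)    = wrap (within (m≤m+n 12 _)) (drop 8 (tree-size α))

  module _ {n : ℕ} where

    letter-size : ∀ {m} (l : Fin m ⊎ MonolithicEQCTL* k n) → 4 + ⟪ encodeLetter l ⟫ ≤ C * lengthLetter l
    letter-size (inj₁ q)       = fin-size 6 q (within (m≤m+n 7 _))
    letter-size (inj₂ (α , _)) = tree-size α

    pltl-size : ∀ {m} (ψ : PLTL (Fin m ⊎ MonolithicEQCTL* k n)) →
                2 + ⟪ encodePLTL encodeLetter ψ ⟫ ≤ C * lengthPLTL lengthLetter ψ
    pltl-size (letter l) = letter-size l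
    pltl-size (¬̇ ψ)      = wrap (within (m≤m+n 6 _)) (drop 2 (pltl-size ψ))
    pltl-size (ψ ∧̇ χ)    = wrap (within (m≤m+n 9 _)) (join (drop 2 (pltl-size ψ)) (drop 2 (pltl-size χ)))
    pltl-size (○ ψ)      = wrap (within (m≤m+n 10 _)) (drop 2 (pltl-size ψ))
    pltl-size (ψ U χ)    = wrap (within (m≤m+n 13 _)) (join (drop 2 (pltl-size ψ)) (drop 2 (pltl-size χ)))

    formula-size : ∀ {m} (φ : EQLTL (MonolithicEQCTL* k n) m) → ⟪ encodeEQLTL φ ⟫ ≤ C * lengthEQLTL φ
    formula-size (pltl ψ) = pltl-size ψ
    formula-size (∃̇ φ)    = wrap (within (m≤m+n 4 _)) (formula-size φ)

m*m≤tower : ∀ m → m * m ≤ tower 2 m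
m*m≤tower m = begin
  m * m            ≤⟨ *-mono-≤ (m≤2^m m) (m≤2^m m) ⟩
  2 ^ m * 2 ^ m    ≡⟨ sym (^-distribˡ-+-* 2 m m) ⟩
  2 ^ (m + m)      ≤⟨ ^-monoʳ-≤ 2 (2*m≤2^m m) ⟩
  tower 2 m        ∎
  where open ≤-Reasoning

linear≤tower : ∀ c n → 1 ≤ n → c * n ≤ tower (2 + c) n
linear≤tower c n 1≤n = ≤-trans
  (*-mono-≤ (h≤tower c 1≤n) (subst (λ h → n ≤ tower h n) (+-identityʳ c) (tower-raise c 0 n)))
  (m*m≤tower (tower c n))

-- That the output differs from `nil` is itself a negation, so it may be derived from the double
-- negation of acceptance.
decider⇒elementary : {P : D → Set} (p : Decider P) {I : Set} (encode : I → D) (length : I → ℕ)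
                     (Q : I → Set) (c : ℕ) → (∀ y → ⟪ encode y ⟫ ≤ c * length y) →
                     (∀ y → P (encode y) → Q y) → (∀ y → Q y → ¬ ¬ P (encode y)) →
                     Elementary encode length Q
decider⇒elementary {P} p encode length Q c small sound complete =
  -- `height` bounds the time in terms of the size of the code; the remaining `2 + c` levels absorb
  -- the factor `c` between this size and the length.
  program , height + (2 + c) , λ y →
    runTime (encode y) , test p (encode y) ,
    ([] , seq assign (seq (run (test-comp p) (encode y) nil) assign)) ,
    ≤-trans (bound (encode y)) (≤-trans
      (tower-mono height (≤-trans (small y) (linear≤tower c (length y) (1≤length y))))
      (≤-reflexive (tower-+ height (2 + c) (length y)))) ,
    mk⇔ (λ t → sound y (to (correct p (encode y)) t))
        (λ q eq → complete y q (λ py → from (correct p (encode y)) py eq))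
  where

  program : Program
  program = record
    { extraVars = 0
    ; body = zero ≔ cons (var zero) nil ⨾ code (test-comp p) ⨾ zero ≔ hd (var zero)
    }

  runTime : D → ℕ
  runTime d = 4 + (time (test-comp p) d + 3)

  open Bounded (elem-+ (elem-const 4) (elem-+ (time-elem (test-comp p)) (elem-const 3)))

  1≤length : ∀ y → 1 ≤ length y
  1≤length y with length y | small y
  ... | zero  | s = ⊥-elim (<⇒≱ 1≤⟪ encode y ⟫ (≤-trans s (≤-reflexive (*-comm c 0))))
  ... | suc _ | _ = s≤s z≤n

theorem3p10 : (k : ℕ) → 2 ≤ k →
    Elementary (encodeFormula {k}) (formulaLength {k}) (Satisfiable {k})
theorem3p10 k@(suc (suc k″)) (s≤s (s≤s z≤n)) =
  decider⇒elementary (Procedure.acceptsᵉ (suc k″)) encodeFormula formulaLength Satisfiable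
    (30 + (k + k))
    (λ (n , φ) → EncodingSize.formula-size k (30 + (k + k)) ≤-refl φ)
    (λ (n , φ) (G , _ , good) → Soundness.satisfiable k″ n (encodeEQLTL φ) G good φ refl)
    (λ (n , φ) → Completeness.complete k″ n φ)
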